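{- Let $\Gamma$ be a graph of girth at least $5$ on $25$ vertices with $57$ edges. Then $(\delta,\Delta)=(3,5)$, $(4,5)$ or $(4,6)$. If $(\delta,\Delta)=(3,5)$ or $(4,5)$, then either $\Gamma$ has an embedded $S_{5,[4,4,4,4,3]}$ star, or $\Gamma$ has no embedded $S_{5,[4,4,4,4,3]}$ star and has an embedded $S_{5,[4,4,4,3,3]}$ star. If $(\delta,\Delta)=(4,6)$, then $1\le deg_6\le 2$ and $\Gamma$ has an embedded $S_{6,[3,3,3,3,3,3]}$ star.
   Context: Graphs are finite and simple. A graph has girth at least $5$ if it contains no $3$-cycle and no $4$-cycle. $\delta$ and $\Delta$ denote the minimum and maximum degree of $\Gamma$, and $deg_i$ denotes the number of vertices of degree $i$. The maximum number of edges of a graph of girth at least $5$ on $25$ vertices is $57$. A graph $\Gamma$ of girth at least $5$ has an embedded $S_{D,[d_0-1,\ldots,d_{D-1}-1]}$ star if $\Gamma$ has a vertex of degree $D$ whose $D$ neighbours have degrees at least $d_0,\ldots,d_{D-1}$ respectively (for some ordering of the neighbours). -}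

module Defs where

open import Data.Fin.Base using (Fin)
open import Data.Fin.Properties using (_<?_)
open import Data.List.Base using (List; length; map; filter; allFin; cartesianProduct)
open import Data.List.Extrema using (min; max)
open import Data.List.Relation.Binary.Permutation.Propositional using (_↭_)
open import Data.Nat.Base using (ℕ; suc; _≤_)
open import Data.Nat.Properties using (_≟_; ≤-totalOrder)
open import Data.Product.Base using (_×_; _,_; Σ-syntax)
open import Data.Vec.Base using (Vec; toList)
open import Data.Vec.Relation.Binary.Pointwise.Inductive using (Pointwise)
open import Level using (0ℓ)
open import Relation.Binary.Core using (Rel)
open import Relation.Binary.Definitions using (Decidable; Irreflexive; Symmetric)
open import Relation.Binary.PropositionalEquality.Core using (_≡_; _≢_)
open import Relation.Nullary.Decidable.Core using (_×-dec_)
open import Relation.Nullary.Negation.Core using (¬_)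

record Graph (n : ℕ) : Set₁ where
  infix 4 _~_ _~?_
  field
    _~_      : Rel (Fin n) 0ℓ
    _~?_     : Decidable _~_
    ~-sym    : Symmetric _~_
    ~-irrefl : Irreflexive _≡_ _~_

module _ {n : ℕ} (Γ : Graph n) where
  open Graph Γ

  -- Each edge is listed once, with its smaller endpoint first.
  edges : List (Fin n × Fin n)
  edges = filter (λ (u , v) → (u <? v) ×-dec (u ~? v))
                 (cartesianProduct (allFin n) (allFin n))

  edgeCount : ℕ
  edgeCount = length edges

  neighbours : Fin n → List (Fin n)
  neighbours v = filter (v ~?_) (allFin n)

  degree : Fin n → ℕ
  degree v = length (neighbours v)

  -- The first argument of min and max is the value at the empty list.  It never
  -- affects the result when n > 0, since every degree lies between 0 and n.
  δ : ℕ
  δ = min ≤-totalOrder n (map degree (allFin n))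

  Δ : ℕ
  Δ = max ≤-totalOrder 0 (map degree (allFin n))

  deg : ℕ → ℕ
  deg i = length (filter (λ v → degree v ≟ i) (allFin n))

  -- In both cycles the remaining pairs of vertices are adjacent, hence distinct
  -- by irreflexivity.
  Is3Cycle : (a b c : Fin n) → Set
  Is3Cycle a b c = a ~ b × b ~ c × c ~ a

  Is4Cycle : (a b c d : Fin n) → Set
  Is4Cycle a b c d = a ~ b × b ~ c × c ~ d × d ~ a × a ≢ c × b ≢ d

  GirthAtLeast5 : Set
  GirthAtLeast5 = (∀ a b c → ¬ Is3Cycle a b c) × (∀ a b c d → ¬ Is4Cycle a b c d)

  -- The vector es is [d₀ - 1, …, d_{D-1} - 1], so an entry e asks for a neighbour of
  -- degree at least suc e.  The vector ws is an ordering of the neighbours of v.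
  HasStar : (D : ℕ) → Vec ℕ D → Set
  HasStar D es =
    Σ[ v ∈ Fin n ] degree v ≡ D ×
      (Σ[ ws ∈ Vec (Fin n) D ] toList ws ↭ neighbours v ×
         Pointwise (λ e w → suc e ≤ degree w) es ws)

{-# OPTIONS --safe #-}
-- A vertex added to a graph of girth at least 5 is joined to vertices that are pairwise
-- at distance at least 3.  A graph with as many edges as possible offers few such sets,
-- and deleting a suitable set of vertices of small degree from a dense graph leaves a
-- graph with as many edges as possible on fewer vertices.  Restoring the deleted
-- vertices in all possible ways and identifying isomorphic results therefore yields,
-- starting from a single vertex, all extremal graphs on up to 11 and on 13, 14, 15, 18,
-- 19 and 20 vertices, and the absence of extensions yields the bounds up to 54 edges on
-- 24 vertices.  In a graph with 25 vertices and 57 edges every vertex then has degree at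
-- least 3 and any two vertices meet at least seven edges.  What remains is counting:
-- the walks of length at most 2 from a vertex reach every other vertex at most once,
-- which leaves too little room for the vertices of degree 5 or 6 unless there is a star.
module Submission where

open import Defs
open import Data.Bool.Base using (Bool; true; false; _∧_; _∨_; not; if_then_else_; T)
open import Data.Bool.ListAction using (any)
open import Data.Bool.Properties using (T-≡; ∨-assoc)
open import Data.Empty using (⊥; ⊥-elim)
open import Data.Fin.Base as Fin using (Fin)
open import Data.Fin.Properties using () renaming (<-cmp to <F-cmp; _<?_ to _<F?_)
open import Data.List.Base
  using (List; []; _∷_; _++_; map; filter; zipWith; concatMap; length; drop; upTo; applyUpTo; allFin; cartesianProduct)
open import Data.List.Membership.Propositional using (_∈_; lose)
open import Data.List.Membership.Propositional.Properties
  using (∈-map⁺; ∈-map⁻; ∈-++⁺ˡ; ∈-++⁺ʳ; ∈-concat⁺′; ∈-∃++; ∈-allFin; ∈-filter⁻)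
open import Data.List.Properties using (map-cong; map-∘; map-upTo; ++-assoc; length-++; length-tabulate)
open import Data.List.Relation.Binary.Permutation.Propositional
  using (_↭_; refl; prep; swap; trans; ↭-refl; ↭-trans; ↭-sym; ↭-reflexive)
open import Data.List.Relation.Binary.Permutation.Propositional.Properties
  using (map⁺; ++⁺ˡ; All-resp-↭; ↭-length; shift; ∈-resp-↭)
open import Data.List.Relation.Unary.All as All using (All; []; _∷_)
open import Data.List.Relation.Unary.All.Properties using (applyUpTo⁺₁)
open import Data.List.Relation.Unary.AllPairs using ([]; _∷_)
open import Data.List.Relation.Unary.Any using (here; there)
open import Data.List.Relation.Unary.Unique.Propositional using (Unique)
open import Data.List.Relation.Unary.Unique.Propositional.Properties using (allFin⁺)
open import Data.Maybe.Base using (Maybe; just; nothing)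
open import Data.Nat.Base
open import Data.Nat.DivMod using (_%_; _/_)
open import Data.Nat.Properties
open import Data.List.Extrema ≤-totalOrder using (v≤min⁺; min≤v⁺; min≤xs; max≤v⁺; v≤max⁺; xs≤max)
open import Data.Nat.Solver using (module +-*-Solver)
open import Data.Product.Base using (Σ-syntax; ∃-syntax; _×_; _,_; proj₁; proj₂)
open import Data.Sum.Base using (_⊎_; inj₁; inj₂)
open import Data.Unit.Base using (⊤; tt)
open import Data.Vec.Base as Vec using (Vec; []; _∷_; toList)
open import Data.Vec.Relation.Binary.Pointwise.Inductive using (Pointwise; []; _∷_)
open import Function.Base using (_∘_; const; id; case_of_)
open import Function.Bundles using (Equivalence)
open import Relation.Binary.Definitions using (tri<; tri≈; tri>)
open import Relation.Binary.PropositionalEquality as ≡ using (_≡_; _≢_; refl; sym; cong; cong₂; subst; subst₂)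
open import Relation.Nullary.Decidable using (dec-true; dec-false)
open import Relation.Nullary.Decidable.Core using (Dec; does; yes; no; _×-dec_)
open import Relation.Nullary.Negation.Core using (¬_)

open +-*-Solver using (solve; _:+_; _:*_; _:=_; con)

-- Let e(n) be the maximum number of edges on n vertices. Deleting a vertex of least degree gives (n
-- - 2) e(n) ≤ n e(n - 1). At many orders this suffices; at the others it leaves one or two values
-- too many, and each has to be refuted by an enumeration or a count. The obstacle is that the rest
-- after a deletion must again have the maximum number of edges, or no list applies. Single vertices
-- often cost too much, so an edge, a path or a star of vertices of small degree is deleted, whose
-- inner edges are lost only once; averaging arguments provide such sets. The adjacencies inside the
-- deleted set are known in advance, and only its edges to the rest are enumerated. Isomorphism is
-- never decided: each graph produced comes with a permutation that takes it to a listed graph, and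
-- only that permutation is checked. On 25 vertices, 57 exceeds the bounds for 24 and 23 vertices by
-- 3 and 7; this is where the two degree conditions come from.

private variable
  A B C : Set

-- Codes of graphs and the enumeration of extensions

-- A graph on the vertices v ∷ vs is stored as its strictly upper triangular
-- adjacency matrix: the first row is the adjacency of v to vs.
Row Code : Set
Row  = List Bool
Code = List Row

-- The list prescribes the adjacency of a new vertex to the vertices added last, most recent first;
-- the number is its degree into everything present when it is added.
Step : Set
Step = List Bool × ℕ

full : Code → List Row
full []      = []
full (r ∷ M) = (false ∷ r) ∷ zipWith _∷_ r (full M)

-- Applied to a row of the full matrix with that same row as `acc`, it marks the vertices reached by
-- a walk of length 1 or 2.
spread : Row → List Row → Row → Row
spread (true  ∷ bs) (s ∷ ss) acc = zipWith _∨_ s (spread bs ss acc)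
spread (false ∷ bs) (s ∷ ss) acc = spread bs ss acc
spread _            _        acc = acc

tri : ℕ → List Row → List Row
tri i []       = []
tri i (r ∷ rs) = drop i r ∷ tri (suc i) rs

farRows : List Row → List Row
farRows fl = map (λ r → map not (spread r fl r)) fl

-- Strictly upper triangular, so that `rows` can discard one row of it with every vertex that it
-- decides.
far : Code → List Row
far M = tri 1 (farRows (full M))

-- All rows of weight d that start with the given prefix and whose support is
-- contained in the allowed set and pairwise far apart: since the girth is at least
-- 5, these are the possible neighbourhoods of a new vertex.
rows : List Bool → ℕ → Row → List Row → List Row
rows []          zero    al       F       = map (const false) al ∷ []
rows []          (suc d) (b ∷ al) (f ∷ F) =
  (if b then map (true ∷_) (rows [] d (zipWith _∧_ al f) F) else [])
  ++ map (false ∷_) (rows [] (suc d) al F)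
rows (true ∷ p)  (suc d) (b ∷ al) (f ∷ F) =
  if b then map (true ∷_) (rows p d (zipWith _∧_ al f) F) else []
rows (false ∷ p) d       (b ∷ al) (f ∷ F) = map (false ∷_) (rows p d al F)
rows _           _       _        _       = []

extend : Step → Code → List Code
extend (p , d) M = map (_∷ M) (rows p d (map (const true) M) (far M))

extensions : List Step → Code → List Code
extensions []       M = M ∷ []
extensions (s ∷ ss) M = concatMap (extensions ss) (extend s M)

nth : A → List A → ℕ → A
nth d []       i       = d
nth d (x ∷ xs) zero    = x
nth d (x ∷ xs) (suc i) = nth d xs i

codeOn : List Row → List ℕ → Code
codeOn fl []      = []
codeOn fl (i ∷ π) = map (nth false (nth [] fl i)) π ∷ codeOn fl π

relabel : Code → List ℕ → Code
relabel M π = codeOn (full M) π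

delete : ℕ → List ℕ → Maybe (List ℕ)
delete i []       = nothing
delete i (j ∷ js) with i ≡ᵇ j
... | true  = just js
... | false with delete i js
...   | nothing = nothing
...   | just ks = just (j ∷ ks)

isPerm : List ℕ → List ℕ → Bool
isPerm []      []       = true
isPerm []      (_ ∷ _)  = false
isPerm (i ∷ π) xs with delete i xs
... | nothing = false
... | just ys = isPerm π ys

eqRow : Row → Row → Bool
eqRow []           []           = true
eqRow (true  ∷ r)  (true  ∷ s)  = eqRow r s
eqRow (false ∷ r)  (false ∷ s)  = eqRow r s
eqRow _            _            = false

eqCode : Code → Code → Bool
eqCode []      []      = true
eqCode (r ∷ M) (s ∷ N) = eqRow r s ∧ eqCode M N
eqCode _       _       = false

elemCode : Code → List Code → Bool
elemCode M []       = false
elemCode M (N ∷ Ns) = eqCode M N ∨ elemCode M Ns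

-- Base 32 has a digit for every vertex, as no list goes beyond 20 vertices.
digits : ℕ → ℕ → List ℕ
digits zero    m = []
digits (suc k) m = m % 32 ∷ digits k (m / 32)

-- certs holds one permutation for each case, written in base 32.
matches : List Code → List Code → List ℕ → Bool
matches L []       _        = true
matches L (M ∷ Ms) []       = false
matches L (M ∷ Ms) (c ∷ cs) =
  (isPerm π (upTo (length M)) ∧ elemCode (relabel M π) L) ∧ matches L Ms cs
  where π = digits (length M) c

covers : List Step → List Code → List Code → List ℕ → Bool
covers ss L L′ certs = matches L′ (concatMap (extensions ss) L) certs

-- A record with the lists as parameters keeps the equation out of the types, so that comparing two
-- such types need not run `covers`.
record Covers (ss : List Step) (L L′ : List Code) (certs : List ℕ) : Set where
  constructor checked
  field check : covers ss L L′ certs ≡ true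

isEmpty : List A → Bool
isEmpty []      = true
isEmpty (_ ∷ _) = false

dead : List Step → List Code → Bool
dead ss L = isEmpty (concatMap (extensions ss) L)

record Dead (ss : List Step) (L : List Code) : Set where
  constructor checked
  field check : dead ss L ≡ true

-- Soundness of the Boolean checks

∧-split : ∀ x {y} → x ∧ y ≡ true → x ≡ true × y ≡ true
∧-split true  e = refl , e
∧-split false ()

eqRow-sound : ∀ r s → eqRow r s ≡ true → r ≡ s
eqRow-sound []          []          e = refl
eqRow-sound (true ∷ r)  (true ∷ s)  e = cong (true ∷_) (eqRow-sound r s e)
eqRow-sound (false ∷ r) (false ∷ s) e = cong (false ∷_) (eqRow-sound r s e)
eqRow-sound (true ∷ r)  (false ∷ s) ()
eqRow-sound (false ∷ r) (true ∷ s)  ()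

eqCode-sound : ∀ M N → eqCode M N ≡ true → M ≡ N
eqCode-sound []      []      e = refl
eqCode-sound (r ∷ M) (s ∷ N) e =
  cong₂ _∷_ (eqRow-sound r s (proj₁ (∧-split (eqRow r s) e)))
            (eqCode-sound M N (proj₂ (∧-split (eqRow r s) e)))

elemCode-sound : ∀ M L → elemCode M L ≡ true → M ∈ L
elemCode-sound M (N ∷ L) e with eqCode M N in eq
... | true  = here (eqCode-sound M N eq)
... | false = there (elemCode-sound M L e)

≡ᵇ-sound : ∀ i j → (i ≡ᵇ j) ≡ true → i ≡ j
≡ᵇ-sound zero    zero    e = refl
≡ᵇ-sound (suc i) (suc j) e = cong suc (≡ᵇ-sound i j e)

delete-sound : ∀ i xs {ys} → delete i xs ≡ just ys → i ∷ ys ↭ xs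
delete-sound i (j ∷ js) e with i ≡ᵇ j in eq
delete-sound i (j ∷ js) refl | true rewrite ≡ᵇ-sound i j eq = ↭-refl
delete-sound i (j ∷ js) e | false with delete i js in eq′
delete-sound i (j ∷ js) refl | false | just ks =
  ↭-trans (swap i j ↭-refl) (prep j (delete-sound i js eq′))

isPerm-sound : ∀ π xs → isPerm π xs ≡ true → π ↭ xs
isPerm-sound []      []       e = ↭-refl
isPerm-sound (i ∷ π) xs       e with delete i xs in eq
... | just ys = ↭-trans (prep i (isPerm-sound π ys e)) (delete-sound i xs eq)

zipWith-map : ∀ {D : Set} (f : A → B → C) (g : D → A) (h : D → B) xs →
              zipWith f (map g xs) (map h xs) ≡ map (λ x → f (g x) (h x)) xs
zipWith-map f g h []       = refl
zipWith-map f g h (x ∷ xs) = cong (f (g x) (h x) ∷_) (zipWith-map f g h xs)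

drop-map : ∀ (f : A → B) xs y ys → drop (suc (length xs)) (map f (xs ++ y ∷ ys)) ≡ map f ys
drop-map f []       y ys = refl
drop-map f (x ∷ xs) y ys = drop-map f xs y ys

map-const : ∀ (c : B) {f : A → B} xs → All (λ x → f x ≡ c) xs → map f xs ≡ map (const c) xs
map-const c []       []       = refl
map-const c (x ∷ xs) (e ∷ es) = cong₂ _∷_ e (map-const c xs es)

upper : (A → A → Bool) → List A → List Row
upper f []       = []
upper f (v ∷ vs) = map (f v) vs ∷ upper f vs

-- Generalised over the vertices `xs` already passed: a row drops these and its own diagonal entry,
-- hence the successor.
tri-upper : ∀ (f : A → A → Bool) xs ys →
            tri (suc (length xs)) (map (λ u → map (f u) (xs ++ ys)) ys) ≡ upper f ys
tri-upper f xs []       = refl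
tri-upper f xs (y ∷ ys) = cong₂ _∷_ (drop-map (f y) xs y ys) (≡.trans reassociate (tri-upper f (xs ++ y ∷ []) ys))
  where
  len : ∀ (zs : List _) → suc (suc (length zs)) ≡ suc (length (zs ++ y ∷ []))
  len []       = refl
  len (z ∷ zs) = cong suc (len zs)
  reassociate : tri (suc (suc (length xs))) (map (λ u → map (f u) (xs ++ y ∷ ys)) ys)
        ≡ tri (suc (length (xs ++ y ∷ []))) (map (λ u → map (f u) ((xs ++ y ∷ []) ++ ys)) ys)
  reassociate = cong₂ tri (len xs)
    (map-cong (λ u → cong (map (f u)) (sym (++-assoc xs (y ∷ []) ys))) ys)

nth-map : ∀ (f : A → B) d e xs i → i < length xs → nth e (map f xs) i ≡ f (nth d xs i)
nth-map f d e (x ∷ xs) zero    _         = refl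
nth-map f d e (x ∷ xs) (suc i) (s≤s i<n) = nth-map f d e xs i i<n

map-nth-upTo : ∀ (d : A) xs → map (nth d xs) (upTo (length xs)) ≡ xs
map-nth-upTo d xs = ≡.trans (map-upTo (nth d xs) (length xs)) (go xs)
  where
  go : ∀ ys → applyUpTo (nth d ys) (length ys) ≡ ys
  go []       = refl
  go (y ∷ ys) = cong (y ∷_) (go ys)

⟦_⟧ : Bool → ℕ
⟦ true  ⟧ = 1
⟦ false ⟧ = 0

∑ : (A → ℕ) → List A → ℕ
∑ f []       = 0
∑ f (x ∷ xs) = f x + ∑ f xs

-- Completeness of the enumeration

module Coding {V : Set} (a : V → V → Bool)
              (a-sym : ∀ u v → a u v ≡ a v u) (a-irrefl : ∀ v → a v v ≡ false) where

  code : List V → Code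
  code []       = []
  code (v ∷ vs) = map (a v) vs ∷ code vs

  degIn : V → List V → ℕ
  degIn u = ∑ (λ v → ⟦ a u v ⟧)

  full-code : ∀ vs → full (code vs) ≡ map (λ u → map (a u) vs) vs
  full-code []       = refl
  full-code (v ∷ vs) rewrite full-code vs | a-irrefl v = cong ((false ∷ map (a v) vs) ∷_)
    (≡.trans (zipWith-map _∷_ (a v) (λ u → map (a u) vs) vs)
           (map-cong (λ u → cong (_∷ map (a u) vs) (a-sym v u)) vs))

  via : List V → V → V → Bool
  via ys u x = any (λ v → a u v ∧ a v x) ys

  spread-code : ∀ ys vs u f →
    spread (map (a u) ys) (map (λ v → map (a v) vs) ys) (map f vs) ≡ map (λ x → via ys u x ∨ f x) vs
  spread-code []       vs u f = refl
  spread-code (y ∷ ys) vs u f with a u y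
  ... | true  rewrite spread-code ys vs u f =
    ≡.trans (zipWith-map _∨_ (a y) (λ x → via ys u x ∨ f x) vs)
          (map-cong (λ x → sym (∨-assoc (a y x) _ (f x))) vs)
  ... | false = spread-code ys vs u f

  isFar : List V → V → V → Bool
  isFar vs u x = not (via vs u x ∨ a u x)

  far-code : ∀ vs → far (code vs) ≡ upper (isFar vs) vs
  far-code vs rewrite full-code vs = ≡.trans (cong (tri 1) eq) (tri-upper (isFar vs) [] vs)
    where
    fl = map (λ u → map (a u) vs) vs
    eq : farRows fl ≡ map (λ u → map (isFar vs u) vs) vs
    eq = ≡.trans (sym (map-∘ vs)) (map-cong (λ u →
           ≡.trans (cong (map not) (spread-code vs vs u (a u))) (sym (map-∘ vs))) vs)

  Match : List Bool → V → List V → Set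
  Match []      w vs       = ⊤
  Match (b ∷ p) w []       = ⊥
  Match (b ∷ p) w (v ∷ vs) = a w v ≡ b × Match p w vs

  -- Records how an actual vertex list arises by prepending vertices that obey the steps, so that
  -- completeness of `extensions` is an induction on it.
  data Fits : List Step → List V → List V → Set where
    done : ∀ {vs} → Fits [] vs vs
    add  : ∀ {p d ss vs us} w → Unique (w ∷ vs) → Match p w vs → degIn w vs ≡ d →
           Fits ss (w ∷ vs) us → Fits ((p , d) ∷ ss) vs us

  private
    zero-deg : ∀ w us → degIn w us ≡ 0 → All (λ u → a w u ≡ false) us
    zero-deg w []       e = []
    zero-deg w (u ∷ us) e with a w u in eq
    ... | false = eq ∷ zero-deg w us e

  -- The induction needs a variable set `ok` of allowed vertices that contains the neighbours of `w`
  -- still to come. Once a neighbour `u` is taken, it shrinks to the vertices that `f` relates to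
  -- `u`.
  rows-complete : ∀ f p d w us ok → Unique us → Match p w us → degIn w us ≡ d →
    (∀ {x} → x ∈ us → a w x ≡ true → ok x ≡ true) →
    (∀ {x y} → x ∈ us → y ∈ us → x ≢ y → a w x ≡ true → a w y ≡ true → f x y ≡ true) →
    map (a w) us ∈ rows p d (map ok us) (upper f us)
  rows-complete f [] zero w us ok un m e al fr =
    here (≡.trans (map-const false us (zero-deg w us e)) (map-∘ us))
  rows-complete f [] (suc d) w (u ∷ us) ok (u∉ ∷ un) m e al fr with a w u in eq
  ... | true rewrite al (here refl) eq | zipWith-map _∧_ ok (f u) us =
    ∈-++⁺ˡ (∈-map⁺ (true ∷_) (rows-complete f [] d w us _ un tt (cong pred e)
      (λ x∈ ax → cong₂ _∧_ (al (there x∈) ax) (fr (here refl) (there x∈) (All.lookup u∉ x∈) eq ax))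
      (λ x∈ y∈ → fr (there x∈) (there y∈))))
  ... | false = ∈-++⁺ʳ (if ok u then _ else []) (∈-map⁺ (false ∷_) (rows-complete f [] (suc d) w us ok un tt e
      (al ∘ there) (λ x∈ y∈ → fr (there x∈) (there y∈))))
  rows-complete f (true ∷ p) d w (u ∷ us) ok (u∉ ∷ un) (eq , m) e al fr
    rewrite eq | al (here refl) eq | sym e | zipWith-map _∧_ ok (f u) us =
    ∈-map⁺ (true ∷_) (rows-complete f p _ w us _ un m refl
      (λ x∈ ax → cong₂ _∧_ (al (there x∈) ax) (fr (here refl) (there x∈) (All.lookup u∉ x∈) eq ax))
      (λ x∈ y∈ → fr (there x∈) (there y∈)))
  rows-complete f (false ∷ p) d w (u ∷ us) ok (u∉ ∷ un) (eq , m) e al fr rewrite eq =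
    ∈-map⁺ (false ∷_) (rows-complete f p d w us ok un m e
      (al ∘ there) (λ x∈ y∈ → fr (there x∈) (there y∈)))

  module _ (no3 : ∀ {u v w} → a u v ≡ true → a v w ≡ true → a w u ≡ true → ⊥)
           (no4 : ∀ {u v w x} → a u v ≡ true → a v w ≡ true → a w x ≡ true → a x u ≡ true →
                  u ≢ w → v ≢ x → ⊥) where

    -- `w` itself joins `x` to `y`, hence the assumption that it is not in `ys`; a second common
    -- neighbour would close a 4-cycle.
    via-none : ∀ ys {w x y} → All (w ≢_) ys → x ≢ y → a w x ≡ true → a w y ≡ true → via ys x y ≡ false
    via-none []       _         x≢y wx wy = refl
    via-none (z ∷ ys) {w} {x} {y} (w≢z ∷ w∉) x≢y wx wy with a x z in xz | a z y in zy
    ... | true  | true  with () ← no4 wx xz zy (≡.trans (a-sym y _) wy) w≢z x≢y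
    ... | true  | false = via-none ys w∉ x≢y wx wy
    ... | false | _     = via-none ys w∉ x≢y wx wy

    far-nbrs : ∀ vs {w x y} → All (w ≢_) vs → x ≢ y → a w x ≡ true → a w y ≡ true →
               isFar vs x y ≡ true
    far-nbrs vs {w} {x} {y} w∉ x≢y wx wy rewrite via-none vs w∉ x≢y wx wy with a x y in xy
    ... | false = refl
    ... | true  with () ← no3 wx xy (≡.trans (a-sym y w) wy)

    extensions-complete : ∀ {ss vs us} → Fits ss vs us → code us ∈ extensions ss (code vs)
    extensions-complete done = here refl
    extensions-complete {(p , d) ∷ ss} {vs} (add w (w∉ ∷ un) m e fits) =
      ∈-concat⁺′ (extensions-complete fits) (∈-map⁺ (extensions ss) (∈-map⁺ (_∷ code vs) row))
      where
      row : map (a w) vs ∈ rows p d (map (const true) (code vs)) (far (code vs))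
      row rewrite far-code vs = subst (λ al → map (a w) vs ∈ rows p d al (upper (isFar vs) vs)) (sym (len vs))
            (rows-complete (isFar vs) p d w vs (const true) un m e (λ _ _ → refl)
              (λ _ _ → far-nbrs vs w∉))
        where
        len : ∀ us → map (const true) (code us) ≡ map (const true) us
        len []       = refl
        len (u ∷ us) = cong (true ∷_) (len us)

    -- Relabelling a code amounts to reordering the vertex list. A checked permutation thus yields a
    -- reordering of the vertices whose code is listed.
    codeOn-code : ∀ vs d π → All (_< length vs) π →
                  codeOn (full (code vs)) π ≡ code (map (nth d vs) π)
    codeOn-code vs d []      [] = refl
    codeOn-code vs d (i ∷ π) (i< ∷ π<) = cong₂ _∷_ row (codeOn-code vs d π π<)
      where
      u = nth d vs i
      go : ∀ π → All (_< length vs) π → map (nth false (nth [] (full (code vs)) i)) π ≡ map (a u) (map (nth d vs) π)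
      go []      []          = refl
      go (j ∷ π) (j< ∷ π<) rewrite full-code vs | nth-map (λ u → map (a u) vs) d [] vs i i< =
        cong₂ _∷_ (nth-map (a u) d false vs j j<) (go′ π π<)
        where
        go′ : ∀ π → All (_< length vs) π → map (nth false (map (a u) vs)) π ≡ map (a u) (map (nth d vs) π)
        go′ []      []         = refl
        go′ (j ∷ π) (j< ∷ π<) = cong₂ _∷_ (nth-map (a u) d false vs j j<) (go′ π π<)
      row = go π π<

-- The extremal graphs

bits : ℕ → ℕ → Row
bits zero    m = []
bits (suc k) m = (m % 2 ≡ᵇ 1) ∷ bits k (m / 2)

shiftRight : ℕ → ℕ → ℕ
shiftRight zero    m = m
shiftRight (suc k) m = shiftRight k (m / 2)

-- A whole matrix is packed into one number, the first row in its least significant bits.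
decode : ℕ → ℕ → Code
decode zero    m = []
decode (suc k) m = bits k m ∷ decode k (shiftRight k m)

-- Outside the abstract block, since `known1` finds the code of a single vertex by computation.
graphs1 : List Code
graphs1 = map (decode 1) (
  0 ∷ [])

steps2 : List Step
steps2 = ([] , 1) ∷ []

steps3 : List Step
steps3 = ([] , 1) ∷ []

steps4 : List Step
steps4 = ([] , 1) ∷ []

steps5 : List Step
steps5 = ([] , 2) ∷ []

steps6a : List Step
steps6a = ([] , 1) ∷ []

steps6b : List Step
steps6b = ([] , 1) ∷ ([] , 2) ∷ []

steps7 : List Step
steps7 = ([] , 2) ∷ []

steps8 : List Step
steps8 = ([] , 2) ∷ []

steps9 : List Step
steps9 = ([] , 2) ∷ []

steps10 : List Step
steps10 = ([] , 3) ∷ []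

steps11a : List Step
steps11a = ([] , 1) ∷ []

steps11b : List Step
steps11b = ([] , 2) ∷ ([] , 2) ∷ []

steps13 : List Step
steps13 = ([] , 2) ∷ (true ∷ [] , 3) ∷ []

steps14a : List Step
steps14a = ([] , 2) ∷ []

-- A vertex of degree 3 with two neighbours of degree 3: it comes first with its one remaining edge,
-- and each neighbour is joined to it but not to the other.
steps14b : List Step
steps14b = ([] , 1) ∷ (true ∷ [] , 3) ∷ (false ∷ true ∷ [] , 3) ∷ []

steps15 : List Step
steps15 = ([] , 3) ∷ []

-- A vertex of degree 4 with two neighbours of degree 3.
steps18a : List Step
steps18a = ([] , 2) ∷ (true ∷ [] , 3) ∷ (false ∷ true ∷ [] , 3) ∷ []

-- A vertex of degree 5 with three neighbours of degree 3.
steps18b : List Step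
steps18b = ([] , 2) ∷ (true ∷ [] , 3) ∷ (false ∷ true ∷ [] , 3) ∷ (false ∷ false ∷ true ∷ [] , 3) ∷ []

-- A path with degrees 3, 4, 4, 3, restored from its inner vertices outwards.
steps18c : List Step
steps18c = ([] , 2) ∷ (true ∷ [] , 3) ∷ (false ∷ true ∷ [] , 3) ∷ (false ∷ true ∷ false ∷ [] , 3) ∷ []

steps19 : List Step
steps19 = ([] , 4) ∷ []

steps20 : List Step
steps20 = ([] , 3) ∷ []

-- Opaque, so that the checks are evaluated here and later proofs treat lists and certificates as
-- constants.
abstract

  graphs2 : List Code
  graphs2 = map (decode 2) (
    1 ∷ [])

  certs2 : List ℕ
  certs2 =
    32 ∷ []

  covers2 : Covers steps2 graphs1 graphs2 certs2
  covers2 = checked refl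

  graphs3 : List Code
  graphs3 = map (decode 3) (
    3 ∷ [])

  certs3 : List ℕ
  certs3 =
    2049 ∷ 1026 ∷ []

  covers3 : Covers steps3 graphs2 graphs3 certs3
  covers3 = checked refl

  graphs4 : List Code
  graphs4 = map (decode 4) (
    7 ∷ 19 ∷ [])

  certs4 : List ℕ
  certs4 =
    100353 ∷ 98338 ∷ 65571 ∷ []

  covers4 : Covers steps4 graphs3 graphs4 certs4
  covers4 = checked refl

  graphs5 : List Code
  graphs5 = map (decode 5) (
    803 ∷ [])

  certs5 : List ℕ
  certs5 =
    4259875 ∷ []

  covers5 : Covers steps5 graphs4 graphs5 certs5
  covers5 = checked refl

  graphs6 : List Code
  graphs6 = map (decode 6) (
    5203 ∷ 25667 ∷ [])

  certs6a : List ℕ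
  certs6a =
    5377089 ∷ 5345314 ∷ 4264995 ∷ 3183684 ∷ 2134117 ∷ []

  covers6a : Covers steps6a graphs5 graphs6 certs6a
  covers6a = checked refl

  certs6b : List ℕ
  certs6b =
    168823938 ∷ 135269538 ∷ 168824930 ∷ 101716130 ∷ 135271522 ∷ 101717122 ∷ 139463714 ∷ 38800514 ∷
    171968547 ∷ 37750947 ∷ 172001283 ∷ 170919972 ∷ 38895684 ∷ 139496450 ∷ 170952708 ∷ 37814373 ∷ []

  covers6b : Covers steps6b graphs4 graphs6 certs6b
  covers6b = checked refl

  graphs7 : List Code
  graphs7 = map (decode 7) (
    591438 ∷ [])

  certs7 : List ℕ
  certs7 =
    5372053633 ∷ 4297264289 ∷ 5506138305 ∷ 6547341474 ∷ 6514835587 ∷ []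

  covers7 : Covers steps7 graphs6 graphs7 certs7
  covers7 = checked refl

  graphs8 : List Code
  graphs8 = map (decode 8) (
    3312284 ∷ [])

  certs8 : List ℕ
  certs8 =
    209384968231 ∷ 243743659046 ∷ []

  covers8 : Covers steps8 graphs7 graphs8 certs8
  covers8 = checked refl

  graphs9 : List Code
  graphs9 = map (decode 9) (
    4853405996 ∷ [])

  certs9 : List ℕ
  certs9 =
    7902876175621 ∷ 8968029112550 ∷ []

  covers9 : Covers steps9 graphs8 graphs9 certs9
  covers9 = checked refl

  graphs10 : List Code
  graphs10 = map (decode 10) (
    28733501354540 ∷ [])

  certs10 : List ℕ
  certs10 =
    323428353608967 ∷ []

  covers10 : Covers steps10 graphs9 graphs10 certs10
  covers10 = checked refl

  graphs11 : List Code
  graphs11 = map (decode 11) (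
    1273412715569671 ∷ 10207970378396419 ∷ 28292771996525612 ∷ [])

  certs11a : List ℕ
  certs11a =
    354360776430721 ∷ 353261232298082 ∷ 356558723880003 ∷ 355459179747364 ∷ 358723321367589 ∷
    357623775137862 ∷ 325667106654247 ∷ 324567525822568 ∷ 289312254269609 ∷ 216743414112490 ∷ []

  covers11a : Covers steps11a graphs10 graphs11 certs11a
  covers11a = checked refl

  certs11b : List ℕ
  certs11b =
    11266735488632966 ∷ 11265634869709991 ∷ 353190503681154 ∷ 1136144619341928 ∷ 1135042893123753 ∷
    10138638673513668 ∷ 10137538121697509 ∷ 317935298250947 ∷ 1137211983662152 ∷ 1135008530209994 ∷
    9010539810559170 ∷ 9009439258743011 ∷ 282680060252357 ∷ 1137177621763209 ∷ 1136075894529226 ∷ []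

  covers11b : Covers steps11b graphs9 graphs11 certs11b
  covers11b = checked refl

  graphs13 : List Code
  graphs13 = map (decode 13) (
    20111878277410442846268 ∷ [])

  certs13 : List ℕ
  certs13 =
    11536218157860659362 ∷ 11535127442359426242 ∷ 11571155139866762434 ∷ 11572245855367995554 ∷ []

  covers13 : Covers steps13 graphs11 graphs13 certs13
  covers13 = checked refl

  graphs14 : List Code
  graphs14 = map (decode 14) (
    319463444006083263713330232 ∷ 1093022436361155801334711345 ∷ 783997912685281555330992225 ∷
    1939268130425664425391915816 ∷ [])

  certs14a : List ℕ
  certs14a =
    10641316807146015809 ∷ 12908735322016614497 ∷ 9418553294225443905 ∷ 15249550461068773473 ∷
    11759368433277602881 ∷ 14026786948148201569 ∷ 14166256635173307490 ∷ 15354150338338063458 ∷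
    12978465286450971746 ∷ []

  covers14a : Covers steps14a graphs13 graphs14 certs14a
  covers14a = checked refl

  certs14b : List ℕ
  certs14b =
    36980617099766604900 ∷ 445073877214240550022 ∷ 369375188642288577667 ∷ 36979525318039869540 ∷
    481963986596754729097 ∷ 406305828188064098435 ∷ 445037883601593674886 ∷ 481927992984107853961 ∷
    407458749658311207043 ∷ 187104299667989833828 ∷ 370528110112535686275 ∷ 187104333752850294884 ∷
    36980617100805775461 ∷ 445072751278933781671 ∷ 369374061641797446819 ∷ 36979525316998601829 ∷
    481965112529914013864 ∷ 406306955186407745699 ∷ 445036757666286906535 ∷ 481929118917267138728 ∷
    407459876656654854307 ∷ 150175908590172612709 ∷ 370526983112044555427 ∷ 150175942675033073765 ∷
    481969611834702010663 ∷ 73836984563245722851 ∷ 481933618222055135527 ∷ 74953877270833605859 ∷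
    481969612935286332678 ∷ 73836984596499246275 ∷ 481933619322639457542 ∷ 74953877304087129283 ∷
    445039002011171922153 ∷ 445074995623818797289 ∷ 73838076308432890147 ∷ 74954969016020773155 ∷
    445039003109610857672 ∷ 445074996722257732808 ∷ 73838076343831800067 ∷ 74954969051419683075 ∷
    488083417580503960712 ∷ 481203181727013769539 ∷ 481167082632084067587 ∷ 490425254133642923178 ∷
    488082291681670859912 ∷ 480014162226988848387 ∷ 485526576614868389192 ∷ 480050261321918550339 ∷
    490424128234809822378 ∷ 485526576648154385736 ∷ 489236374269449343079 ∷ 481203181693760277828 ∷
    481167117816421554404 ∷ 490425218914878591178 ∷ 489235248370616242279 ∷ 480014197411326335204 ∷
    486643504506794807623 ∷ 480050261288665058628 ∷ 490424093016045490378 ∷ 486643504540080804167 ∷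
    481167082598863080709 ∷ 491578246006926840937 ∷ 488083347177333986504 ∷ 481203216911316654373 ∷
    480014162193767861509 ∷ 488082221278500885704 ∷ 486643572709769188617 ∷ 491577120108093740137 ∷
    480050296506221435173 ∷ 486643572676483192073 ∷ 481167117783200567526 ∷ 491578210788162508937 ∷
    489236303866279368871 ∷ 481203216878063162662 ∷ 480014197378105348326 ∷ 489235177967446268071 ∷
    485526681101659379945 ∷ 491577084889329408137 ∷ 480050296472967943462 ∷ 485526681068373383401 ∷
    222877975836366347524 ∷ 149057222476677127430 ∷ 221725054331793054980 ∷ 147904300972103834886 ∷
    185985613623213826275 ∷ 112164860263524606181 ∷ 184832692118640533731 ∷ 111011938758951313637 ∷
    222805918205822215493 ∷ 185877527128004994374 ∷ 221652996701248922949 ∷ 184724605623431701830 ∷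
    149021193779517172003 ∷ 112092802701699950884 ∷ 147868272274943879459 ∷ 110939881197126658340 ∷ []

  covers14b : Covers steps14b graphs11 graphs14 certs14b
  covers14b = checked refl

  graphs15 : List Code
  graphs15 = map (decode 15) (
    11408855520233319783114016882928 ∷ [])

  certs15 : List ℕ
  certs15 =
    15359735108955463092577 ∷ 14177991657484379653474 ∷ 13372057622196286235905 ∷
    15585456676688074157128 ∷ []

  covers15 : Covers steps15 graphs14 graphs15 certs15
  covers15 = checked refl

  graphs18 : List Code
  graphs18 = map (decode 18) (
    264760960806578872771334803852680780471300 ∷ 4089385708846007780944159056951645342912 ∷
    109773068812106770044597344425460469098760 ∷ 7081977929560420456809512592665325848523265 ∷
    7080606138064493754254186299762245376831500 ∷ 7102384209527151406312190604213931291078668 ∷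
    8583285752795991109908608431108546806345729 ∷ 115250070703220803006798741485717473798521648 ∷
    140806549226594203534041177377221017581781580 ∷ 136114669489417253670323777756434382755203464 ∷
    140949087993149887841278280069785909467941004 ∷ 136072123892706371310664043923632784947677956 ∷
    94953928598556394911450954252891200045449231 ∷ 46036312973630622954051957321764908425412714 ∷
    92382983663872065670771414879210349357170718 ∷ [])

  certs18a : List ℕ
  certs18a =
    19392965706333642101464200 ∷ 58040813002138818530352264 ∷ 20603035260075519066085544 ∷
    59250882555880695494973608 ∷ 16975189079057508387099849 ∷ 55623036374862684815987913 ∷
    18185258632799385351721193 ∷ 56833105928604561780609257 ∷ 593632679227991537199911173 ∷
    16975113795933819230397700 ∷ 593594901449050084645048581 ∷ 18185183348619064446985477 ∷
    56833030644424240875873541 ∷ 39269301388902548888663144 ∷ 55622961091738995659285764 ∷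
    39232701931801653157344360 ∷ 671004005504078828613671207 ∷ 19393040300681116574425382 ∷
    670966227725137376058808615 ∷ 20603109853366361791013159 ∷ 59250957149171538219901223 ∷
    39347254951457512999891049 ∷ 58040887596486293003313446 ∷ 39310655494356617268572265 ∷
    557365588136382845004425509 ∷ 503557016571577623076244805 ∷ 541657040533415323335266629 ∷
    557327846098008035261819173 ∷ 19396583151636258878662761 ∷ 542091708090386315014901865 ∷
    504764761799571534839647557 ∷ 58044430447441435307550825 ∷ 620821522170792367603584327 ∷
    543299453318380226778304617 ∷ 55631250702811349208148071 ∷ 542828187421166995348263237 ∷
    619613776942798455840181575 ∷ 16983403407006172779260007 ∷ 633527912394131348500195591 ∷
    464795868218566658780138823 ∷ 619025929500756831153592647 ∷ 633490170355756538757589255 ∷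
    619425105518823776439310440 ∷ 16977479439584761268709480 ∷ 620632850746817688202713192 ∷
    58046667338117312473671781 ∷ 466003613446560570543541575 ∷ 55625326735389937697597544 ∷
    543374675029245271931653445 ∷ 620197076388508503166589255 ∷ 19398820042312136044783717 ∷
    542166929801251360168250693 ∷ 596050032583516242367917348 ∷ 503519237638625016606428516 ∷
    580341450428896062310061412 ∷ 596012290545141432625311012 ∷ 20605473229592394794806377 ∷
    580777298578612570753963113 ∷ 504726982866618928369831268 ∷ 59253320525397571223694441 ∷
    659469369502591123360845158 ∷ 581985043806606482517365865 ∷ 56839032823132325184449638 ∷
    581512597316647734323058020 ∷ 658261624274597211597442406 ∷ 18191185527327148755561574 ∷
    672212356841264745863687430 ∷ 464758089285614052310322534 ∷ 657710339396237570128387430 ∷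
    672174614802889936121081094 ∷ 658110696007050032178371688 ∷ 18186369517540897184853096 ∷
    659318441235043943941774440 ∷ 59254449458438288449973348 ∷ 465965834513607964073725286 ∷
    56834216813346073613741160 ∷ 582022522361044027688914276 ∷ 658881486283989242141384038 ∷
    20606602162633112021085284 ∷ 580814777133050115925511524 ∷ 677036572819666894009374828 ∷
    39344968282482966723468419 ∷ 19394097991357147733308620 ∷ 39271843084220358079157443 ∷
    597247431905995182646136941 ∷ 16976320065993257979785357 ∷ 676999974479424654258968684 ∷
    39308334201675150352881827 ∷ 20601880076776359361524972 ∷ 39235209003412541708570851 ∷
    597210833565752942895730797 ∷ 18184102151412469608001709 ∷ 58041945287162324162196684 ∷
    56831949447217646036889773 ∷ 437669038806907559306633613 ∷ 55624167361798434408673421 ∷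
    59249727372581535790413036 ∷ 437669038876645117302941100 ∷ []

  covers18a : Covers steps18a graphs15 graphs18 certs18a
  covers18a = checked refl

  certs18b : List ℕ
  certs18b =
    621407993767295675713917219 ∷ 581513477495448401332081955 ∷ 484819402398578475910992163 ∷
    621445735805670485456523555 ∷ 581496326491235257632856355 ∷ 484781660360203666168385827 ∷
    523541628155473201343894819 ∷ 523540484457340631351694627 ∷ 620199104841169193958314275 ∷
    582722366421574883087684899 ∷ 523505029815230961593488675 ∷ 620181951603102531966867747 ∷
    523467287776856151850882339 ∷ 582760108459949692830291235 ∷ 484856000738820715661398307 ∷
    484854857040688145669198115 ∷ 621426295171338683480676643 ∷ 523502742418965821609088291 ∷
    621389696831096443730270499 ∷ 523466144078723581858682147 ∷ 582704071719229169396259107 ∷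
    484780516662071096176185635 ∷ 582740670059471409146665251 ∷ 484817115002313335926591779 ∷
    677075214065956206062768387 ∷ 677074070367823636070568195 ∷ 677038615725713966312362243 ∷
    677000873687339156569755907 ∷ 677036328329448826327961859 ∷ 676999729989206586577555715 ∷
    484780842946872101307552995 ∷ 484817441287114341057959139 ∷ 484782022385571314112009443 ∷
    484819800164512766666872035 ∷ 484855219066055793612821731 ∷ 484856398504755006417278179 ∷
    444886327794167137419007171 ∷ 444922926134409377169413315 ∷ 444887507232866350223463619 ∷
    444925285011807802778326211 ∷ 444960703913350829724275907 ∷ 444961883352050042528732355 ∷
    557316077404085999569736835 ∷ 557352675744328239320142979 ∷ 557316077404085999569736835 ∷
    557352675744328239320142979 ∷ 557317221102218569561937027 ∷ 557354963140593379304543363 ∷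
    557390417782703049062749315 ∷ 557391561480835619054949507 ∷ 557317221102218569561937027 ∷
    557354963140593379304543363 ∷ 557390417782703049062749315 ∷ 557391561480835619054949507 ∷
    594792777813229153262277763 ∷ 594829376153471393012683907 ∷ 594792777813229153262277763 ∷
    594829376153471393012683907 ∷ 594793921511361723254477955 ∷ 594831663549736532997084291 ∷
    594867118191846202755290243 ∷ 594868261889978772747490435 ∷ 594793921511361723254477955 ∷
    594831663549736532997084291 ∷ 594867118191846202755290243 ∷ 594868261889978772747490435 ∷
    597211029023175238579522790 ∷ 597247627363417478329928934 ∷ 597212209578767158971862246 ∷
    597249988474601319114607846 ∷ 597285406259251638472674534 ∷ 597286586814843558865013990 ∷
    633526717155738310042496227 ∷ 633488975117363500299889891 ∷ 633564494934679762597358819 ∷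
    633564530675246405409615075 ∷ 633489010857930143112146147 ∷ 633526788636871595667008739 ∷
    673420088646339500957838531 ∷ 673382346607964691215232195 ∷ 673457866425280953512701123 ∷
    673457902165847596324957379 ∷ 673382382348531334027488451 ∷ 673420160127472786582351043 ∷ []

  covers18b : Covers steps18b graphs14 graphs18 certs18b
  covers18b = checked refl

  certs18c : List ℕ
  certs18c =
    59766617357572550789828870 ∷ 673420102214557779607335115 ∷ 59766616203560297394771174 ∷
    672211176358950636258211018 ∷ 677036758432427146442089611 ∷ 677036758432427146442089611 ∷
    59841956131174728551665990 ∷ 672219432291250959026562191 ∷ 581513836057232711091657002 ∷
    672200662866912703024374925 ∷ 557370918417878272766551308 ∷ 543318896217108207322305672 ∷
    673425992424109911166980267 ∷ 59653417007088841027528840 ∷ 673409759462889960309400746 ∷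
    675827832649932065253500074 ∷ 675827832649932065253500074 ∷ 620199499143484962190530859 ∷
    673409589875441348868449452 ∷ 59804178353325055576151398 ∷ 673427178671005255684433072 ∷
    556163173153854498866865389 ∷ 543281117284155668529713319 ∷ 672217066603403468054238346 ∷
    59615601182863669672062119 ∷ 672200796713792471591724171 ∷ 446699713786346312214810861 ∷
    427393508235290485332447527 ∷ 620199399568088784031848743 ∷ 581513809082076910349359400 ∷
    407976345521392984938288396 ∷ 388707917748152710702929192 ∷ 677000158939264501596464267 ∷
    21157473637667961972232518 ∷ 580342688016594718843902250 ∷ 677000158939264501596464267 ∷
    672181690216848451776619663 ∷ 672164027634308215761708173 ∷ 18188804489927035673025704 ∷
    58045540748979305955336327 ∷ 39225790830226723178783148 ∷ 620632827065543939209859334 ∷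
    21082171685497437103198470 ∷ 673382360175057104317624523 ∷ 557333140637810921378587916 ∷
    542110007254952929621480584 ∷ 20968970218155104613476488 ∷ 673388249232813631177265323 ∷
    673373159970852115858990250 ∷ 580777235693506404175615206 ∷ 675791233156769420407874730 ∷
    619028351102846969942776107 ∷ 21119695859818288996717926 ∷ 675791233156769420407874730 ∷
    673372954642836861605782700 ∷ 673389436596602748434490544 ∷ 19397693417180516879573127 ∷
    56836651821725824748788904 ∷ 39225790831351558972906893 ∷ 581984980921534400799479014 ∷
    21082170531485183708140774 ∷ 672173434319449960968500426 ∷ 556125395373787147478901997 ∷
    542072228322000390828888231 ∷ 20931154393929933258009767 ∷ 672179323412107188064523402 ∷
    672164197221754627141313675 ∷ 619425081837515942585995526 ∷ 446698534311618303465132269 ∷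
    426185762971267810909819175 ∷ 619028252644308349359626535 ∷ 580342662158296475677137192 ∷
    407975166046664976188609804 ∷ 387500172484130036280300840 ∷ 466091685521879311330742535 ∷
    671408374277789867596488842 ∷ 504134518776460333962962183 ∷ 639523507678962605178885385 ∷
    504142561381552571198773508 ∷ 52362242175638384339491079 ∷ 677415225388209293864607917 ∷
    446131679990447372028351622 ∷ 427369459835985515974398214 ∷ 633893893819855899110580361 ∷
    542818928637038209144170758 ∷ 677000209241027229118502154 ∷ 542827045027945622579518724 ∷
    53533353286828701415283974 ∷ 639976303874862915847856302 ∷ 483608344623031301087433863 ∷
    668989378697085692721370378 ∷ 20893531826207991439439109 ∷ 631474898240311742320219401 ∷
    19722420679057012771928325 ∷ 464882796595751764423250183 ∷ 502963371888707562439386375 ∷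
    13677796538465102613092615 ∷ 639560105983176082270065929 ∷ 677414081690041540574060717 ∷
    671407230579657331930472586 ∷ 504142740363616374532285576 ∷ 446095081650240316616479878 ∷
    581506758283450896631507174 ∷ 464871359681840860224558215 ∷ 427355735492030344281199750 ∷
    581503259922619446589624649 ∷ 442468660182155313117930692 ∷ 426160570909857969066905862 ∷
    541647781749285437620594950 ∷ 14848907649655419688885510 ∷ 677036807545240706209682698 ∷
    639975160176695162557309102 ∷ 633892750121723363444564105 ∷ 542827224044911258913450120 ∷
    483571746282824245675562119 ∷ 581507902016487428887749831 ∷ 426147990264002347657335942 ∷
    466079104909868856848422023 ∷ 581503295664275739785761066 ∷ 479945323695628855067322596 ∷
    668990522395219361151456522 ∷ 59577977498284203563955461 ∷ 479981923152763802405611748 ∷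
    631476041938445410750305545 ∷ 58406866351133224896444677 ∷ 442505259639290260456219844 ∷
    658884030064299467342161256 ∷ 619024789654435114550273195 ∷ 657709344855072414242122889 ∷
    17417914370541704672612713 ∷ 620197153992358635095924906 ∷ 620196041455472196150665393 ∷
    596038853906306424612623494 ∷ 521063602086367096893378737 ∷ 658879274292654368095447176 ∷
    556107703483914773469598855 ∷ 658880379907008394812565648 ∷ 556121269148862681857758352 ∷
    57273506859403777640927560 ∷ 481207971517320573719154865 ∷ 596052383796980990862496912 ∷
    21157914021064303944342856 ∷ 52324387959343620009921802 ∷ 635912742499433381368111275 ∷
    349396646480279851002696964 ∷ 673385902252823674751264905 ∷ 426766607626481747091493189 ∷
    57289869233179994458591462 ∷ 52340829082299182375837895 ∷ 55626395523943055357231268 ∷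
    620199473385458889567444264 ∷ 659469566293946429795014919 ∷ 632269547251192349693649063 ∷
    668573958335527258047129734 ∷ 425590866352907141606716744 ∷ 15774146908231458648173764 ∷
    657712883176546696891278696 ∷ 619026007104606997409112234 ∷ 657708127404902730408634504 ∷
    18589061223391545832673608 ∷ 620195936542186752237085867 ∷ 620197186270531591877174449 ∷
    556144301824155948068115591 ∷ 481170229478945765049241777 ∷ 658880491742824051928935561 ∷
    596002255566065250014106758 ∷ 658879235091949065657986192 ∷ 596014641758606182192583824 ∷
    56102360006553936480866665 ∷ 521101344124741905563291825 ∷ 556159011187237490527671440 ∷
    21157949760540230114580841 ∷ 51077647467300456014155051 ∷ 637120486575665772218262698 ∷
    310712163949653537477334308 ∷ 672178158176661650497809544 ∷ 388079837701771724718281061 ∷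
    56119866043524608588681415 ∷ 51095267994051268919534822 ∷ 56834176493628411369308324 ∷
    620199509127116248954673417 ∷ 659469602033351987288186150 ∷ 631060620315809814399001766 ∷
    667365033631680534990335111 ∷ 386904022641254977974219113 ∷ 14565184157975119033510116 ∷
    658261821065951418521032967 ∷ 668537359995249833958189190 ∷ 632306145591469773782589607 ∷
    426762013240658814692406600 ∷ 658884030888598879896574314 ∷ 16981855136904763226367205 ∷
    658261856805356976014204198 ∷ 667328435291403110901394567 ∷ 631097218656087238487942310 ∷
    388075169529006651059908969 ∷ 658883995149122951578852683 ∷ 18190817884911570770075845 ∷
    59842359693140517141552456 ∷ 13639942359325000849590538 ∷ 677036427106058260611182822 ∷
    635950484537808225436901547 ∷ 349396218751863703266989192 ∷ 56838664027830426964205765 ∷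
    59842395432616443311790441 ∷ 12393201867281836853823787 ∷ 676999828730913123748655334 ∷
    637158228614040616287052970 ∷ 310711771963984397431313545 ∷ 55629701279823619420497125 ∷
    54421993051150314842303684 ∷ 672215900215036494566599816 ∷ 388079481456667099262128299 ∷
    673423644291198518820055177 ∷ 426766287124126259630837930 ∷ 53213030300893975227640036 ∷
    18604244158433332188844262 ∷ 13655204007517369021046983 ∷ 16978548192144266281468068 ∷
    17434240968777946318934215 ∷ 12409642919269455564743910 ∷ 18186329161829622293545124 ∷
    39196065445761608989316486 ∷ 17342057931648138231261318 ∷ 19646572808355137791963332 ∷
    557325477905118598798675144 ∷ 39305788983101041698774406 ∷ 39159465987499695518585255 ∷
    18551019527857074404959399 ∷ 20855534331416896150385893 ∷ 594803358941981566977576168 ∷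
    39342423099937655021214119 ∷ 39342458799082778438743175 ∷ 562152032026068936286447846 ∷
    348644096458262537652510855 ∷ 674997688813343116378936710 ∷ 668574365027767392366147844 ∷
    56026754935258859396447405 ∷ 39305859341981950353158310 ∷ 599628769364800433985823943 ∷
    387366319910405037085794470 ∷ 637521025333645438836150695 ∷ 631097700325412783661661445 ∷
    57235716459377284937496716 ∷ 57235465163939674956309671 ∷ 594841100980356376753735912 ∷
    59539979967464346655864037 ∷ 39342421977616972973683911 ∷ 599665367705041574258156743 ∷
    637519845894945126521115047 ∷ 388575208836566703179931814 ∷ 631061101985171643389328645 ∷
    309958470300400129567696071 ∷ 517458566416923808940235113 ∷ 19390568422378168227375399 ∷
    581505756091824505518075270 ∷ 327656873356268016824097063 ∷ 56026503567730738782611590 ∷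
    557363219943493408574834888 ∷ 58331018444402588297441476 ∷ 39305785626992814171697382 ∷
    562188630366310076558780646 ∷ 674996509374642804063901062 ∷ 349852985384424203746648199 ∷
    668537766687526252093815044 ∷ 309995067524874495411398886 ∷ 479981901786555359303900522 ∷
    20599530018554185658803526 ∷ 542818912380137124161465767 ∷ 326447910678102222235409734 ∷
    58038415719309244529551655 ∷ 311203956451036161505536230 ∷ 479945303446313085193788778 ∷
    311167359226561795661833415 ∷ 517421968076681534830123369 ∷ 59247377315485261960979782 ∷
    17342309298085543311359149 ∷ 18551270822203968852408460 ∷ 580334608051151363257970054 ∷
    327620275016025743787694375 ∷ 541647764339463981901360551 ∷ 326411312337859949199007046 ∷ []

  covers18c : Covers steps18c graphs14 graphs18 certs18c
  covers18c = checked refl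

  graphs19 : List Code
  graphs19 = map (decode 19) (
    2456076695880505706966128013988616272227497016295439 ∷ [])

  certs19 : List ℕ
  certs19 =
    22300351608014304111173440577 ∷ 19039524332427194707936887014 ∷ 17856180901142229841766489483 ∷ []

  covers19 : Covers steps19 graphs18 graphs19 certs19
  covers19 = checked refl

  graphs20 : List Code
  graphs20 = map (decode 20) (
    198081081924166599669819981230454209326080315634747703356 ∷ [])

  certs20 : List ℕ
  certs20 =
    24218507093652311555326553417 ∷ []

  covers20 : Covers steps20 graphs19 graphs20 certs20
  covers20 = checked refl

  -- Extremal graphs without suitable extensions

  dead3 : Dead (([] , 2) ∷ []) graphs2
  dead3 = checked refl

  dead4 : Dead (([] , 2) ∷ []) graphs3
  dead4 = checked refl

  dead6 : Dead (([] , 2) ∷ []) graphs5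
  dead6 = checked refl

  dead11a : Dead (([] , 2) ∷ []) graphs10
  dead11a = checked refl

  dead11b : Dead (([] , 3) ∷ []) graphs10
  dead11b = checked refl

  dead11c : Dead (([] , 2) ∷ ([] , 3) ∷ []) graphs9
  dead11c = checked refl

  dead12 : Dead (([] , 3) ∷ []) graphs11
  dead12 = checked refl

  dead14 : Dead (([] , 3) ∷ []) graphs13
  dead14 = checked refl

  dead16 : Dead (([] , 3) ∷ []) graphs15
  dead16 = checked refl

  dead20 : Dead (([] , 4) ∷ []) graphs19
  dead20 = checked refl

  dead21 : Dead (([] , 4) ∷ []) graphs20
  dead21 = checked refl

  dead22 : Dead (([] , 3) ∷ (true ∷ [] , 4) ∷ []) graphs20
  dead22 = checked refl

  dead23 : Dead (([] , 2) ∷ (true ∷ [] , 4) ∷ (false ∷ true ∷ [] , 4) ∷ []) graphs20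
  dead23 = checked refl

  -- The configuration of `few-low-nbrs`, restored in the order `z`, `y`, `x`, `f`, `w`, `u`: `u` is
  -- joined to all but `f`, and `w` also to `f`. The six meet 3 + 3 + 3 + 3 + 3 + 5 = 20 of the 54
  -- edges, which leaves 34.
  dead24 : Dead (([] , 3) ∷ (false ∷ [] , 3) ∷ (false ∷ false ∷ [] , 3) ∷ (false ∷ false ∷ false ∷ [] , 3) ∷ (true ∷ false ∷ false ∷ false ∷ [] , 3) ∷ (true ∷ false ∷ true ∷ true ∷ true ∷ [] , 5) ∷ []) graphs18
  dead24 = checked refl

-- Finite sums

infix 4 _≤!_
_≤!_ : ∀ m n → {_ : T (m ≤ᵇ n)} → m ≤ n
(m ≤! n) {p} = ≤ᵇ⇒≤ m n p

∑-mono : ∀ {f g : A → ℕ} xs → (∀ {x} → x ∈ xs → f x ≤ g x) → ∑ f xs ≤ ∑ g xs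
∑-mono []       h = z≤n
∑-mono (x ∷ xs) h = +-mono-≤ (h (here refl)) (∑-mono xs (h ∘ there))

∑-cong : ∀ {f g : A → ℕ} xs → (∀ {x} → x ∈ xs → f x ≡ g x) → ∑ f xs ≡ ∑ g xs
∑-cong []       h = refl
∑-cong (x ∷ xs) h = cong₂ _+_ (h (here refl)) (∑-cong xs (h ∘ there))

+-interchange : ∀ a b c d → (a + b) + (c + d) ≡ (a + c) + (b + d)
+-interchange = solve 4 (λ a b c d → (a :+ b) :+ (c :+ d) := (a :+ c) :+ (b :+ d)) refl

∑-+ : ∀ (f g : A → ℕ) xs → ∑ (λ x → f x + g x) xs ≡ ∑ f xs + ∑ g xs
∑-+ f g []       = refl
∑-+ f g (x ∷ xs) rewrite ∑-+ f g xs = +-interchange (f x) (g x) (∑ f xs) (∑ g xs)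

∑-const : ∀ c (xs : List A) → ∑ (const c) xs ≡ length xs * c
∑-const c []       = refl
∑-const c (x ∷ xs) = cong (c +_) (∑-const c xs)

∑-*ˡ : ∀ c (f : A → ℕ) xs → ∑ (λ x → c * f x) xs ≡ c * ∑ f xs
∑-*ˡ c f []       = sym (*-zeroʳ c)
∑-*ˡ c f (x ∷ xs) rewrite ∑-*ˡ c f xs = sym (*-distribˡ-+ c (f x) (∑ f xs))

∑-*ʳ : ∀ c (f : A → ℕ) xs → ∑ (λ x → f x * c) xs ≡ ∑ f xs * c
∑-*ʳ c f []       = refl
∑-*ʳ c f (x ∷ xs) rewrite ∑-*ʳ c f xs = sym (*-distribʳ-+ c (f x) (∑ f xs))

∑-swap : ∀ (g : A → B → ℕ) xs ys → ∑ (λ x → ∑ (g x) ys) xs ≡ ∑ (λ y → ∑ (λ x → g x y) xs) ys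
∑-swap g []       ys = sym (≡.trans (∑-const 0 ys) (*-zeroʳ (length ys)))
∑-swap g (x ∷ xs) ys rewrite ∑-swap g xs ys = sym (∑-+ (g x) (λ y → ∑ (λ x → g x y) xs) ys)

∑-↭ : ∀ (f : A → ℕ) {xs ys} → xs ↭ ys → ∑ f xs ≡ ∑ f ys
∑-↭ f refl        = refl
∑-↭ f (prep x p)  = cong (f x +_) (∑-↭ f p)
∑-↭ f (swap {xs} {ys} x y p) rewrite ∑-↭ f p =
  solve 3 (λ b c d → b :+ (c :+ d) := c :+ (b :+ d)) refl (f x) (f y) (∑ f ys)
∑-↭ f (trans p q) = ≡.trans (∑-↭ f p) (∑-↭ f q)

∈⇒↭ : ∀ {v : A} {vs} → v ∈ vs → ∃[ us ] vs ↭ v ∷ us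
∈⇒↭ v∈ with xs , ys , refl ← ∈-∃++ v∈ = xs ++ ys , shift _ xs ys

Unique-↭ : ∀ {xs ys : List A} → xs ↭ ys → Unique xs → Unique ys
Unique-↭ refl         un                          = un
Unique-↭ (prep x p)   (x∉ ∷ un)                   = All-resp-↭ p x∉ ∷ Unique-↭ p un
Unique-↭ (swap x y p) ((x≢y ∷ x∉) ∷ y∉ ∷ un)      =
  (x≢y ∘ sym ∷ All-resp-↭ p y∉) ∷ All-resp-↭ p x∉ ∷ Unique-↭ p un
Unique-↭ (trans p q)  un                          = Unique-↭ q (Unique-↭ p un)

Unique-drop : ∀ (xs : List A) {ys} → Unique (xs ++ ys) → Unique ys
Unique-drop []       un       = un
Unique-drop (x ∷ xs) (_ ∷ un) = Unique-drop xs un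

∑-least : ∀ (f : A → ℕ) x xs → ∃[ v ] v ∈ x ∷ xs × (∀ {y} → y ∈ x ∷ xs → f v ≤ f y)
∑-least f x [] = x , here refl , λ { (here refl) → ≤-refl }
∑-least f x (y ∷ ys) with v , v∈ , least ← ∑-least f y ys with ≤-total (f x) (f v)
... | inj₁ x≤v = x , here refl , λ { (here refl) → ≤-refl ; (there z∈) → ≤-trans x≤v (least z∈) }
... | inj₂ v≤x = v , there v∈ , λ { (here refl) → v≤x ; (there z∈) → least z∈ }

∑-average : ∀ (f : A → ℕ) x xs → ∃[ v ] v ∈ x ∷ xs × length (x ∷ xs) * f v ≤ ∑ f (x ∷ xs)
∑-average f x xs with v , v∈ , least ← ∑-least f x xs =
  v , v∈ , subst (_≤ ∑ f (x ∷ xs)) (∑-const (f v) (x ∷ xs)) (∑-mono (x ∷ xs) least)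

count : (A → Bool) → List A → ℕ
count p = ∑ (⟦_⟧ ∘ p)

pick : ∀ (p : A → Bool) {m} xs → suc m ≤ count p xs →
       ∃[ x ] ∃[ ys ] xs ↭ x ∷ ys × p x ≡ true × m ≤ count p ys
pick p (x ∷ xs) le with p x in px
... | true  = x , xs , ↭-refl , px , s≤s⁻¹ le
... | false with y , ys , per , py , le′ ← pick p xs le =
  y , x ∷ ys , ↭-trans (prep x per) (swap x y ↭-refl) , py , subst (λ b → _ ≤ ⟦ b ⟧ + count p ys) (sym px) le′

count-< : ∀ (p q : A → Bool) xs → count q xs < count p xs → ∃[ x ] x ∈ xs × p x ≡ true × q x ≡ false
count-< p q (x ∷ xs) lt with p x in px | q x in qx
... | true  | false = x , here refl , px , qx
... | true  | true  = let y , y∈ , h = count-< p q xs (s≤s⁻¹ lt) in y , there y∈ , h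
... | false | false = let y , y∈ , h = count-< p q xs lt in y , there y∈ , h
... | false | true  = let y , y∈ , h = count-< p q xs (≤-trans (n≤1+n _) lt) in y , there y∈ , h

count-∈ : ∀ (p : A → Bool) {x xs} → x ∈ xs → p x ≡ true → 1 ≤ count p xs
count-∈ p (here refl) px rewrite px = s≤s z≤n
count-∈ p {xs = y ∷ _} (there x∈) px = ≤-trans (count-∈ p x∈ px) (m≤n+m _ ⟦ p y ⟧)

count-≤1 : ∀ (p : A → Bool) {xs} → Unique xs →
           (∀ {x y} → x ∈ xs → y ∈ xs → p x ≡ true → p y ≡ true → x ≢ y → ⊥) → count p xs ≤ 1
count-≤1 p {[]}     _          h = z≤n
count-≤1 p {x ∷ xs} (x∉ ∷ un) h with p x in px
... | false = count-≤1 p un (λ x∈ y∈ → h (there x∈) (there y∈))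
... | true  = s≤s (go xs (λ y∈ → y∈) )
  where
  go : ∀ ys → (∀ {y} → y ∈ ys → y ∈ xs) → count p ys ≤ 0
  go []       sub = z≤n
  go (y ∷ ys) sub with p y in py
  ... | true  = ⊥-elim (h (here refl) (there (sub (here refl))) px py (All.lookup x∉ (sub (here refl))))
  ... | false = go ys (sub ∘ there)

count-zero : ∀ (p : A → Bool) xs → count p xs ≡ 0 → ∀ {x} → x ∈ xs → p x ≡ false
count-zero p xs e {x} x∈ with p x in px
... | false = refl
... | true with () ← subst (1 ≤_) e (count-∈ p x∈ px)

∑-≤-length : ∀ (f : A → ℕ) xs → (∀ {x} → x ∈ xs → f x ≤ 1) → ∑ f xs ≤ length xs
∑-≤-length f xs h = subst (∑ f xs ≤_) (≡.trans (∑-const 1 xs) (*-identityʳ _)) (∑-mono xs h)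

⟦⟧≤1 : ∀ b → ⟦ b ⟧ ≤ 1
⟦⟧≤1 true  = ≤-refl
⟦⟧≤1 false = z≤n

search : ∀ (p : A → Bool) xs → (∃[ x ] x ∈ xs × p x ≡ true) ⊎ (∀ {x} → x ∈ xs → p x ≡ false)
search p []       = inj₂ λ ()
search p (x ∷ xs) with p x in px | search p xs
... | true  | _                    = inj₁ (x , here refl , px)
... | false | inj₁ (y , y∈ , py)   = inj₁ (y , there y∈ , py)
... | false | inj₂ h               = inj₂ λ { (here refl) → px ; (there y∈) → h y∈ }

∈-tail : ∀ {x y : A} {vs us} → vs ↭ x ∷ us → y ∈ vs → x ≢ y → y ∈ us
∈-tail p y∈ x≢y with ∈-resp-↭ p y∈
... | here refl = ⊥-elim (x≢y refl)
... | there y∈′ = y∈′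

extract : ∀ {vs : List A} xs → All (_∈ vs) xs → Unique xs → ∃[ us ] vs ↭ xs ++ us
extract []       []         []        = _ , ↭-refl
extract (x ∷ xs) (x∈ ∷ xs∈) (x∉ ∷ un) with vs′ , p ← ∈⇒↭ x∈
  with us , q ← extract xs (All.zipWith (λ { (y∈ , x≢y) → ∈-tail p y∈ x≢y }) (xs∈ , x∉)) un
  = us , ↭-trans p (prep x q)

≡ᵇ-true : ∀ {m n} → m ≡ n → (m ≡ᵇ n) ≡ true
≡ᵇ-true e = Equivalence.to T-≡ (≡⇒≡ᵇ _ _ e)

≡ᵇ-false : ∀ {m n} → (m ≡ᵇ n) ≡ false → m ≢ n
≡ᵇ-false {m} e refl with () ← ≡.trans (sym e) (≡ᵇ-true {m} refl)

≤ᵇ-true : ∀ m n → (m ≤ᵇ n) ≡ true → m ≤ n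
≤ᵇ-true m n e = ≤ᵇ⇒≤ m n (Equivalence.from T-≡ e)

≤ᵇ-false : ∀ m n → (m ≤ᵇ n) ≡ false → n < m
≤ᵇ-false m n e = ≰⇒> λ m≤n → case ≡.trans (sym e) (Equivalence.to T-≡ (≤⇒≤ᵇ m≤n)) of λ ()

⟦∧⟧ : ∀ b c → ⟦ b ∧ c ⟧ ≡ ⟦ b ⟧ * ⟦ c ⟧
⟦∧⟧ true  c = sym (+-identityʳ ⟦ c ⟧)
⟦∧⟧ false c = refl

true≢false : ∀ {b} → b ≡ true → b ≡ false → ⊥
true≢false refl ()

-- Edge counts, and the passage from checks to actual graphs

module Girth5 {V : Set} (a : V → V → Bool) (v₀ : V)
  (a-sym : ∀ u v → a u v ≡ a v u) (a-irrefl : ∀ v → a v v ≡ false)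
  (no3 : ∀ {u v w} → a u v ≡ true → a v w ≡ true → a w u ≡ true → ⊥)
  (no4 : ∀ {u v w x} → a u v ≡ true → a v w ≡ true → a w x ≡ true → a x u ≡ true →
         u ≢ w → v ≢ x → ⊥) where

  open Coding a a-sym a-irrefl public

  E : List V → ℕ
  E []       = 0
  E (v ∷ vs) = degIn v vs + E vs

  sym-true : ∀ {u v b} → a u v ≡ b → a v u ≡ b
  sym-true {u} {v} e = ≡.trans (a-sym v u) e

  deg-↭ : ∀ u {vs us} → vs ↭ us → degIn u vs ≡ degIn u us
  deg-↭ u = ∑-↭ (λ v → ⟦ a u v ⟧)

  E-↭ : ∀ {vs us} → vs ↭ us → E vs ≡ E us
  E-↭ refl         = refl
  E-↭ (prep x p)   = cong₂ _+_ (deg-↭ x p) (E-↭ p)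
  E-↭ (swap {xs} {ys} x y p) rewrite E-↭ p | deg-↭ x p | deg-↭ y p | a-sym y x =
    solve 4 (λ e b c d → (e :+ b) :+ (c :+ d) := (e :+ c) :+ (b :+ d)) refl ⟦ a x y ⟧ (degIn x ys) (degIn y ys) (E ys)
  E-↭ (trans p q)  = ≡.trans (E-↭ p) (E-↭ q)

  deg-self : ∀ v vs → degIn v (v ∷ vs) ≡ degIn v vs
  deg-self v vs rewrite a-irrefl v = refl

  degree-sum : ∀ vs → ∑ (λ u → degIn u vs) vs ≡ 2 * E vs
  degree-sum [] = refl
  degree-sum (v ∷ vs) rewrite a-irrefl v
    | ∑-+ (λ u → ⟦ a u v ⟧) (λ u → degIn u vs) vs | degree-sum vs
    | ∑-cong {f = λ u → ⟦ a u v ⟧} {g = λ u → ⟦ a v u ⟧} vs (λ {u} _ → cong ⟦_⟧ (a-sym u v)) =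
    solve 2 (λ d e → d :+ (d :+ (e :+ (e :+ con 0))) := (d :+ e) :+ ((d :+ e) :+ con 0)) refl (degIn v vs) (E vs)

  deg-≤ : ∀ u vs → degIn u vs ≤ length vs
  deg-≤ u vs = ∑-≤-length _ vs (λ {x} _ → ⟦⟧≤1 (a u x))

  remove : ∀ {v vs} → Unique vs → v ∈ vs →
           ∃[ us ] vs ↭ v ∷ us × Unique (v ∷ us) × degIn v vs ≡ degIn v us × E vs ≡ degIn v vs + E us
  remove {v} {vs} un v∈ with us , p ← ∈⇒↭ v∈ =
    us , p , Unique-↭ p un , d , ≡.trans (E-↭ p) (cong (_+ E us) (sym d))
    where
    d = ≡.trans (deg-↭ v p) (deg-self v us)

  record Minimal (vs : List V) : Set where
    field
      v     : V
      us    : List V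
      perm  : vs ↭ v ∷ us
      uniq  : Unique (v ∷ us)
      size  : length vs ≡ suc (length us)
      E-split : E vs ≡ degIn v us + E us
      small : length vs * degIn v us ≤ 2 * E vs

  minimal : ∀ {n} vs → Unique vs → length vs ≡ suc n → Minimal vs
  minimal (x ∷ xs) un _ with v , v∈ , av ← ∑-average (λ u → degIn u (x ∷ xs)) x xs
                        with us , p , un′ , d , e ← remove un v∈ = record
    { v = v ; us = us ; perm = p ; uniq = un′ ; size = ↭-length p
    ; E-split = subst (λ k → E (x ∷ xs) ≡ k + E us) d e
    ; small = subst₂ _≤_ (cong (length (x ∷ xs) *_) d) (degree-sum (x ∷ xs)) av }

  -- Stated for the vertex lists of one fixed graph: deleting vertices means passing to a shorter
  -- list, and isomorphism becomes reordering.
  Bound : ℕ → ℕ → Set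
  Bound n f = ∀ vs → Unique vs → length vs ≡ n → E vs ≤ f

  Known : ℕ → ℕ → List Code → Set
  Known n e L = ∀ vs → Unique vs → length vs ≡ n → E vs ≡ e → ∃[ us ] us ↭ vs × code us ∈ L

  dead-sound : ∀ {ss L us vs} → Dead ss L → code us ∈ L → Fits ss us vs → ⊥
  dead-sound {ss} {L} (checked d) us∈ fits
    with concatMap (extensions ss) L | ∈-concat⁺′ (extensions-complete no3 no4 fits) (∈-map⁺ (extensions ss) us∈)
  dead-sound (checked ()) us∈ fits | _ ∷ _ | _
  dead-sound _ us∈ fits | [] | ()

  matches-sound : ∀ L Ms cs {M} → matches L Ms cs ≡ true → M ∈ Ms →
                  ∃[ π ] π ↭ upTo (length M) × relabel M π ∈ L
  matches-sound L (M ∷ Ms) (c ∷ cs) e M∈ with e₁ , e₂ ← ∧-split (isPerm (digits (length M) c) (upTo (length M)) ∧ _) e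
                                         with e₃ , e₄ ← ∧-split (isPerm (digits (length M) c) (upTo (length M))) e₁
                                         with M∈
  ... | here refl = digits (length M) c , isPerm-sound _ _ e₃ , elemCode-sound _ _ e₄
  ... | there M∈′ = matches-sound L Ms cs e₂ M∈′

  length-code : ∀ vs → length (code vs) ≡ length vs
  length-code []       = refl
  length-code (v ∷ vs) = cong suc (length-code vs)

  covers-sound : ∀ {ss L L′ cs us ws} → Covers ss L L′ cs → code us ∈ L → Fits ss us ws →
                 ∃[ vs ] vs ↭ ws × code vs ∈ L′
  covers-sound {ss} {L} {L′} {cs} {us} {ws} (checked ok) us∈ fits
    with π , π↭ , M∈ ← matches-sound L′ (concatMap (extensions ss) L) cs ok
           (∈-concat⁺′ (extensions-complete no3 no4 fits) (∈-map⁺ (extensions ss) us∈)) =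
    map (nth v₀ ws) π ,
    ↭-trans (map⁺ (nth v₀ ws) π↭′) (↭-reflexive (map-nth-upTo v₀ ws)) ,
    subst (_∈ L′) (codeOn-code no3 no4 ws v₀ π (All-resp-↭ (↭-sym π↭′) (applyUpTo⁺₁ id (length ws) id))) M∈
    where
    π↭′ : π ↭ upTo (length ws)
    π↭′ = subst (λ k → π ↭ upTo k) (length-code ws) π↭

  private
    -- With n = `2 + k`: from nE ≤ nd + nf and nd ≤ 2E follows (n - 2)E ≤ nf.
    over : ∀ k {E d f} → E ≤ d + f → (2 + k) * d ≤ 2 * E → k * E ≤ (2 + k) * f
    over k {E} {d} {f} E≤ d≤ = +-cancelˡ-≤ (2 * E) (k * E) ((2 + k) * f) (begin
      2 * E + k * E             ≡⟨ *-distribʳ-+ E 2 k ⟨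
      (2 + k) * E               ≤⟨ *-monoʳ-≤ (2 + k) E≤ ⟩
      (2 + k) * (d + f)         ≡⟨ *-distribˡ-+ (2 + k) d f ⟩
      (2 + k) * d + (2 + k) * f ≤⟨ +-monoˡ-≤ _ d≤ ⟩
      2 * E + (2 + k) * f       ∎)
      where open ≤-Reasoning

  degree-range : ∀ {k f vs} (m : Minimal vs) → Bound (suc k) f → length vs ≡ 2 + k →
                 let open Minimal m in
                 E vs ≤ degIn v us + f × (2 + k) * degIn v us ≤ 2 * E vs × k * E vs ≤ (2 + k) * f
  degree-range {k} {f} {vs} m bd len = E≤ , d≤ , over k {d = degIn v us} {f} E≤ d≤
    where
    open Minimal m
    un′ : Unique us
    un′ with _ ∷ u ← uniq = u
    E≤ : E vs ≤ degIn v us + f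
    E≤ = subst (_≤ degIn v us + f) (sym E-split) (+-monoʳ-≤ (degIn v us) (bd us un′ (cong pred (≡.trans (sym size) len))))
    d≤ : (2 + k) * degIn v us ≤ 2 * E vs
    d≤ = subst (λ l → l * degIn v us ≤ 2 * E vs) len small

  bound-average : ∀ k {f} f′ → Bound (suc k) f → {_ : T (suc ((2 + k) * f) ≤ᵇ k * suc f′)} → Bound (2 + k) f′
  bound-average k {f} f′ bd {ok} vs un len = ≮⇒≥ λ f′<E →
    <⇒≱ (≤ᵇ⇒≤ _ _ ok) (≤-trans (*-monoʳ-≤ k f′<E) (proj₂ (proj₂ (degree-range (minimal vs un len) bd len))))

  -- S lists the vertices added to us so far.
  data Attach (us : List V) : List Step → List V → List V → Set where
    done : ∀ {S} → Attach us [] S S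
    add  : ∀ {p d ss S S′} w → Match p w S → degIn w (S ++ us) ≡ d →
           Attach us ss (w ∷ S) S′ → Attach us ((p , d) ∷ ss) S S′

  Match-++ : ∀ p w S {us} → Match p w S → Match p w (S ++ us)
  Match-++ []      w S       m       = tt
  Match-++ (b ∷ p) w (s ∷ S) (e , m) = e , Match-++ p w S m

  -- `Attach` speaks of `us` as it sits in the graph, the listed code of a reordering `ws`. Degrees
  -- do not see the difference, and the new vertices stay in front, where the prefixes look.
  fits : ∀ {ss S S′ us ws} → us ↭ ws → Attach us ss S S′ → Unique (S′ ++ ws) →
         Fits ss (S ++ ws) (S′ ++ ws) × Unique (S ++ ws)
  fits p done un = done , un
  fits {S = S} p (add {q} w m d at) un with f , un′@(_ ∷ un″) ← fits p at un =
    add w un′ (Match-++ q w S m) (≡.trans (deg-↭ w (++⁺ˡ S (↭-sym p))) d) f , un″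

  attach-dead : ∀ {n e L ss S us vs} → Known n e L → Dead ss L → Unique vs → vs ↭ S ++ us →
                Attach us ss [] S → length us ≡ n → E us ≡ e → ⊥
  attach-dead {S = S} {us} known dd un p at len e
    with ws , q , ws∈ ← known us (Unique-drop S (Unique-↭ p un)) len e =
    dead-sound dd ws∈ (proj₁ (fits (↭-sym q) at (Unique-↭ (↭-trans p (++⁺ˡ S (↭-sym q))) un)))

  attach-known : ∀ {n e L L′ ss cs S us vs} → Known n e L → Covers ss L L′ cs → Unique vs →
                 vs ↭ S ++ us → Attach us ss [] S → length us ≡ n → E us ≡ e →
                 ∃[ ws ] ws ↭ vs × code ws ∈ L′
  attach-known {cs = cs} {S} {us} known cov un p at len e
    with ws , q , ws∈ ← known us (Unique-drop S (Unique-↭ p un)) len e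
    with p′ ← ↭-trans p (++⁺ˡ S (↭-sym q))
    with xs , r , xs∈ ← covers-sound {cs = cs} cov ws∈ (proj₁ (fits (↭-sym q) at (Unique-↭ p′ un))) =
    xs , ↭-trans r (↭-sym p′) , xs∈

  -- The lower end is the least that a deletion must cost if the rest has at most `f` edges; the
  -- upper end comes from the average degree.
  least-degree : ∀ k q {f e} vs → Bound (suc k) f → Unique vs → length vs ≡ 2 + k → E vs ≡ e →
    {_ : T (2 * e <ᵇ (2 + k) * suc q)} →
    ∃[ v ] ∃[ us ] vs ↭ v ∷ us × Unique us × length us ≡ suc k ×
      e ∸ f ≤ degIn v us × degIn v us ≤ q × E us ≡ e ∸ degIn v us
  least-degree k q {f} {e} vs bd un len refl {ok} with m ← minimal vs un len = v , us , perm , tail uniq ,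
      cong pred (≡.trans (sym size) len) , lo , hi , Eus
    where
    open Minimal m
    r = degree-range m bd len
    lo : E vs ∸ f ≤ degIn v us
    lo = m≤n+o⇒m∸n≤o (E vs) f (subst (E vs ≤_) (+-comm (degIn v us) f) (proj₁ r))
    hi : degIn v us ≤ q
    hi = s≤s⁻¹ (*-cancelˡ-< (2 + k) (degIn v us) (suc q) (≤-<-trans (proj₁ (proj₂ r)) (<ᵇ⇒< _ _ ok)))
    Eus : E us ≡ E vs ∸ degIn v us
    Eus = sym (≡.trans (cong (_∸ degIn v us) E-split) (m+n∸m≡n (degIn v us) (E us)))
    tail : Unique (v ∷ us) → Unique us
    tail (_ ∷ u) = u

  split : ∀ {d n} → d ≤ suc n → d ≤ n ⊎ d ≡ suc n
  split d≤ with m≤n⇒m<n∨m≡n d≤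
  ... | inj₁ d< = inj₁ (s≤s⁻¹ d<)
  ... | inj₂ d≡ = inj₂ d≡

  -- The third condition says that averaging already excludes `2 + f′` edges. With `1 + f′` edges
  -- the least degree is squeezed to `d`, and the rest has exactly `f` edges.
  bound-dead : ∀ k d {f f′ L} → Known (suc k) f L → Bound (suc k) f → Dead (([] , d) ∷ []) L →
               {_ : T (suc f′ ∸ f ≡ᵇ d)} {_ : T (suc f′ ∸ d ≡ᵇ f)}
               {_ : T ((2 + k) * f <ᵇ k * (2 + f′))} {_ : T (2 * suc f′ <ᵇ (2 + k) * suc d)} →
               Bound (2 + k) f′
  bound-dead k d {f} {f′} {L} known bd dd {c₁} {c₂} {c₃} {c₄} vs un len = ≮⇒≥ λ f′<E → go (eq f′<E)
    where
    eq : f′ < E vs → E vs ≡ suc f′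
    eq f′<E = ≤-antisym (s≤s⁻¹ (*-cancelˡ-< k (E vs) (2 + f′) (≤-<-trans
      (proj₂ (proj₂ (degree-range (minimal vs un len) bd len))) (<ᵇ⇒< _ _ c₃)))) f′<E
    go : E vs ≡ suc f′ → ⊥
    go e with v , us , p , un′ , len′ , lo , hi , Eus ← least-degree k d vs bd un len e {c₄}
         with d≡ ← ≤-antisym hi (subst (_≤ degIn v us) (≡ᵇ⇒≡ _ _ c₁) lo) =
      attach-dead {ss = ([] , d) ∷ []} {S = v ∷ []} known dd un p (add v tt d≡ done) len′
        (≡.trans Eus (≡.trans (cong (suc f′ ∸_) d≡) (≡ᵇ⇒≡ _ _ c₂)))

  known-minimal : ∀ k d {f f′ L L′ cs} → Known (suc k) f L → Bound (suc k) f →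
                  Covers (([] , d) ∷ []) L L′ cs →
                  {_ : T (f′ ∸ f ≡ᵇ d)} {_ : T (f′ ∸ d ≡ᵇ f)} {_ : T (2 * f′ <ᵇ (2 + k) * suc d)} →
                  Known (2 + k) f′ L′
  known-minimal k d {f} {f′} {cs = cs} known bd cov {c₁} {c₂} {c₄} vs un len e
    with v , us , p , un′ , len′ , lo , hi , Eus ← least-degree k d vs bd un len e {c₄}
    with d≡ ← ≤-antisym hi (subst (_≤ degIn v us) (≡ᵇ⇒≡ _ _ c₁) lo) =
    attach-known {ss = ([] , d) ∷ []} {cs = cs} {S = v ∷ []} known cov un p (add v tt d≡ done) len′
      (≡.trans Eus (≡.trans (cong (f′ ∸_) d≡) (≡ᵇ⇒≡ _ _ c₂)))

  -- Up to 12 vertices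

  bound1 : Bound 1 0
  bound1 (x ∷ []) un refl = z≤n

  known1 : Known 1 0 graphs1
  known1 (x ∷ []) un refl e = x ∷ [] , ↭-refl , here refl

  bound2 : Bound 2 1
  bound2 (x ∷ y ∷ []) un refl = subst (_≤ 1) (sym (≡.trans (+-identityʳ _) (+-identityʳ _))) (⟦⟧≤1 (a x y))

  known2 : Known 2 1 graphs2
  known2 = known-minimal 0 1 known1 bound1 covers2

  bound3 : Bound 3 2
  bound3 = bound-dead 1 2 known2 bound2 dead3

  known3 : Known 3 2 graphs3
  known3 = known-minimal 1 1 known2 bound2 covers3

  bound4 : Bound 4 3
  bound4 = bound-dead 2 2 known3 bound3 dead4

  known4 : Known 4 3 graphs4
  known4 = known-minimal 2 1 known3 bound3 covers4

  bound5 : Bound 5 5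
  bound5 = bound-average 3 5 bound4

  known5 : Known 5 5 graphs5
  known5 = known-minimal 3 2 known4 bound4 covers5

  bound6 : Bound 6 6
  bound6 = bound-dead 4 2 known5 bound5 dead6

  known6 : Known 6 6 graphs6
  known6 vs un len e = case least-degree 4 2 vs bound5 un len e of λ where
    (v , us , p , un′ , len′ , lo , hi , Eus) → case split hi of λ where
      (inj₁ hi) → let d = ≤-antisym hi lo in
        attach-known {cs = certs6a} {S = v ∷ []} known5 covers6a un p (add v tt d done) len′
          (≡.trans Eus (cong (6 ∸_) d))
      -- The rest has 4 edges, one below the maximum on 5 vertices, so a vertex of degree 1 is
      -- deleted as well.
      (inj₂ d) → case least-degree 3 1 us bound4 un′ len′ (≡.trans Eus (cong (6 ∸_) d)) of λ where
        (w , ws , q , un″ , len″ , lo′ , hi′ , Ews) → let d′ = ≤-antisym hi′ lo′ in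
          attach-known {cs = certs6b} {S = v ∷ w ∷ []} known4 covers6b un (↭-trans p (prep v q))
            (add w tt d′ (add v tt (≡.trans (deg-↭ v (↭-sym q)) d) done)) len″ (≡.trans Ews (cong (4 ∸_) d′))

  bound7 : Bound 7 8
  bound7 = bound-average 5 8 bound6

  known7 : Known 7 8 graphs7
  known7 = known-minimal 5 2 known6 bound6 covers7

  bound8 : Bound 8 10
  bound8 = bound-average 6 10 bound7

  known8 : Known 8 10 graphs8
  known8 = known-minimal 6 2 known7 bound7 covers8

  bound9 : Bound 9 12
  bound9 = bound-average 7 12 bound8

  known9 : Known 9 12 graphs9
  known9 = known-minimal 7 2 known8 bound8 covers9

  bound10 : Bound 10 15
  bound10 = bound-average 8 15 bound9

  known10 : Known 10 15 graphs10
  known10 = known-minimal 8 3 known9 bound9 covers10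

  -- The one order at which averaging leaves two surplus values, 17 and 18, since 11 · 15 / 9 lies
  -- between 18 and 19.
  bound11 : Bound 11 16
  bound11 vs un len = ≮⇒≥ λ lt → case m≤n⇒m<n∨m≡n lt of λ where
      (inj₁ lt′) → go18 (≤-antisym (s≤s⁻¹ (*-cancelˡ-< 9 (E vs) 19 (≤-<-trans
        (proj₂ (proj₂ (degree-range (minimal vs un len) bound10 len))) (166 ≤! 171)))) lt′)
      (inj₂ e)   → go17 (sym e)
    where
    go18 : E vs ≡ 18 → ⊥
    go18 e = case least-degree 9 3 vs bound10 un len e of λ where
      (v , us , p , un′ , len′ , lo , hi , Eus) → let d = ≤-antisym hi lo in
        attach-dead {S = v ∷ []} known10 dead11b un p (add v tt d done) len′ (≡.trans Eus (cong (18 ∸_) d))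
    go17 : E vs ≡ 17 → ⊥
    go17 e = case least-degree 9 3 vs bound10 un len e of λ where
      (v , us , p , un′ , len′ , lo , hi , Eus) → case split hi of λ where
        (inj₁ hi) → let d = ≤-antisym hi lo in
          attach-dead {S = v ∷ []} known10 dead11a un p (add v tt d done) len′ (≡.trans Eus (cong (17 ∸_) d))
        (inj₂ d) → case least-degree 8 2 us bound9 un′ len′ (≡.trans Eus (cong (17 ∸_) d)) of λ where
          (w , ws , q , un″ , len″ , lo′ , hi′ , Ews) → let d′ = ≤-antisym hi′ lo′ in
            attach-dead {S = v ∷ w ∷ []} known9 dead11c un (↭-trans p (prep v q))
              (add w tt d′ (add v tt (≡.trans (deg-↭ v (↭-sym q)) d) done)) len″ (≡.trans Ews (cong (14 ∸_) d′))

  known11 : Known 11 16 graphs11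
  known11 vs un len e = case least-degree 9 2 vs bound10 un len e of λ where
    (v , us , p , un′ , len′ , lo , hi , Eus) → case split hi of λ where
      (inj₁ hi) → let d = ≤-antisym hi lo in
        attach-known {cs = certs11a} {S = v ∷ []} known10 covers11a un p (add v tt d done) len′
          (≡.trans Eus (cong (16 ∸_) d))
      (inj₂ d) → case least-degree 8 2 us bound9 un′ len′ (≡.trans Eus (cong (16 ∸_) d)) of λ where
        (w , ws , q , un″ , len″ , lo′ , hi′ , Ews) → let d′ = ≤-antisym hi′ lo′ in
          attach-known {cs = certs11b} {S = v ∷ w ∷ []} known9 covers11b un (↭-trans p (prep v q))
            (add w tt d′ (add v tt (≡.trans (deg-↭ v (↭-sym q)) d) done)) len″ (≡.trans Ews (cong (14 ∸_) d′))

  bound12 : Bound 12 18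
  bound12 = bound-dead 10 3 known11 bound11 dead12

  bound13 : Bound 13 21
  bound13 = bound-average 11 21 bound12

  -- Sums over neighbourhoods

  adj-≢ : ∀ {u v} → a u v ≡ true → u ≢ v
  adj-≢ {u} e refl = true≢false e (a-irrefl u)

  no3-false : ∀ {u v w} → a u v ≡ true → a u w ≡ true → a v w ≡ false
  no3-false {u} {v} {w} uv uw with a v w in vw
  ... | false = refl
  ... | true  = ⊥-elim (no3 uv vw (sym-true uw))

  degree-≥ : ∀ {n f vs u} → Bound n f → Unique vs → length vs ≡ suc n → u ∈ vs → E vs ∸ f ≤ degIn u vs
  degree-≥ {n} {f} {vs} {u} bd un len u∈ with us , p , (_ ∷ un′) , _ , e ← remove un u∈ =
    m≤n+o⇒m∸n≤o (E vs) f (subst (E vs ≤_) (+-comm (degIn u vs) f)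
      (subst (_≤ degIn u vs + f) (sym e) (+-monoʳ-≤ (degIn u vs) (bd us un′ (cong pred (≡.trans (sym (↭-length p)) len))))))

  nsum : (V → ℕ) → V → List V → ℕ
  nsum f v = ∑ (λ u → ⟦ a v u ⟧ * f u)

  nbrs : (V → Bool) → V → List V → ℕ
  nbrs q v = count (λ u → a v u ∧ q u)

  nbrs-nsum : ∀ q v vs → nbrs q v vs ≡ nsum (⟦_⟧ ∘ q) v vs
  nbrs-nsum q v vs = ∑-cong vs (λ {u} _ → ⟦∧⟧ (a v u) (q u))

  nbrs-≤ : ∀ q v vs → nbrs q v vs ≤ degIn v vs
  nbrs-≤ q v vs = ∑-mono vs λ {u} _ → le (a v u) (q u)
    where
    le : ∀ b c → ⟦ b ∧ c ⟧ ≤ ⟦ b ⟧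
    le true  c = ⟦⟧≤1 c
    le false c = z≤n

  nsum-swap : ∀ f vs us → ∑ (λ v → nsum f v us) vs ≡ ∑ (λ u → degIn u vs * f u) us
  nsum-swap f vs us = ≡.trans (∑-swap (λ v u → ⟦ a v u ⟧ * f u) vs us)
    (∑-cong us λ {u} _ → ≡.trans (∑-cong vs λ {v} _ → cong (λ b → ⟦ b ⟧ * f u) (a-sym v u))
                                 (∑-*ʳ (f u) (λ v → ⟦ a u v ⟧) vs))

  -- By the girth condition the walks of length at most 2 from v reach every other
  -- vertex at most once.
  reach : ∀ f {v vs} → Unique vs → v ∈ vs →
          nsum (λ w → nsum f w vs) v vs + nsum f v vs + f v ≤ ∑ f vs + degIn v vs * f v
  reach f {v} {vs} un v∈ with us , p , un′@(v∉ ∷ _) , d , _ ← remove un v∈ = begin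
    nsum (λ w → nsum f w vs) v vs + nsum f v vs + f v
      ≡⟨ cong (λ k → k + nsum f v vs + f v) (≡.trans
           (∑-cong vs λ {w} _ → sym (∑-*ˡ ⟦ a v w ⟧ (λ x → ⟦ a w x ⟧ * f x) vs))
           (≡.trans (∑-swap (λ w x → ⟦ a v w ⟧ * (⟦ a w x ⟧ * f x)) vs vs)
             (∑-cong vs λ {x} _ → ≡.trans (∑-cong vs λ {w} _ → sym (*-assoc ⟦ a v w ⟧ ⟦ a w x ⟧ (f x)))
                                          (∑-*ʳ (f x) (λ w → ⟦ a v w ⟧ * ⟦ a w x ⟧) vs)))) ⟩
    ∑ (λ x → codeg x * f x) vs + nsum f v vs + f v
      ≡⟨ cong (_+ f v) (∑-+ (λ x → codeg x * f x) (λ x → ⟦ a v x ⟧ * f x) vs) ⟨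
    ∑ (λ x → codeg x * f x + ⟦ a v x ⟧ * f x) vs + f v
      ≡⟨ cong (_+ f v) (∑-↭ (λ x → codeg x * f x + ⟦ a v x ⟧ * f x) p) ⟩
    codeg v * f v + ⟦ a v v ⟧ * f v + rest + f v
      ≤⟨ +-monoˡ-≤ (f v) (+-mono-≤ self (∑-mono us λ {x} x∈ → other (λ v≡x → All.lookup v∉ x∈ v≡x))) ⟩
    degIn v vs * f v + ∑ f us + f v
      ≡⟨ solve 3 (λ d s c → d :+ s :+ c := (c :+ s) :+ d) refl (degIn v vs * f v) (∑ f us) (f v) ⟩
    ∑ f (v ∷ us) + degIn v vs * f v
      ≡⟨ cong (_+ degIn v vs * f v) (∑-↭ f p) ⟨
    ∑ f vs + degIn v vs * f v ∎
    where
    open ≤-Reasoning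
    codeg : V → ℕ
    codeg x = ∑ (λ w → ⟦ a v w ⟧ * ⟦ a w x ⟧) vs
    rest = ∑ (λ x → codeg x * f x + ⟦ a v x ⟧ * f x) us
    -- `v` is reached again by one walk of length 2 through each neighbour, which accounts for the
    -- extra term on the right.
    self : codeg v * f v + ⟦ a v v ⟧ * f v ≤ degIn v vs * f v
    self rewrite a-irrefl v | +-identityʳ (codeg v * f v) = *-monoˡ-≤ (f v)
      (∑-mono vs λ {w} _ → subst (_≤ ⟦ a v w ⟧) (⟦∧⟧ (a v w) (a w v)) (le (a v w) (a w v)))
      where
      le : ∀ b c → ⟦ b ∧ c ⟧ ≤ ⟦ b ⟧
      le true  c = ⟦⟧≤1 c
      le false c = z≤n
    -- A neighbour of `v` has no common neighbour with it, any other vertex at most one.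
    codeg≤ : ∀ {x} → v ≢ x → codeg x + ⟦ a v x ⟧ ≤ 1
    codeg≤ {x} v≢x with eq ← nbrs-nsum (λ w → a w x) v vs with a v x in vx
    ... | true  = subst (λ k → k + 1 ≤ 1) eq (+-monoˡ-≤ 1 (none vs))
      where
      none : ∀ ws → nbrs (λ w → a w x) v ws ≤ 0
      none []       = z≤n
      none (w ∷ ws) with a v w in vw
      ... | false = none ws
      ... | true  with a w x in wx
      ...   | true  = ⊥-elim (no3 vw wx (sym-true vx))
      ...   | false = none ws
    ... | false = subst (λ k → k + 0 ≤ 1) eq (≤-trans (≤-reflexive (+-identityʳ _))
      (count-≤1 (λ w → a v w ∧ a w x) un λ {w} {w′} _ _ h h′ w≢w′ →
        let vw , wx = ∧-split (a v w) h ; vw′ , wx′ = ∧-split (a v w′) h′ in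
        no4 vw wx (sym-true wx′) (sym-true vw′) v≢x w≢w′))
    other : ∀ {x} → v ≢ x → codeg x * f x + ⟦ a v x ⟧ * f x ≤ f x
    other {x} v≢x = subst₂ _≤_ (*-distribʳ-+ (f x) (codeg x) ⟦ a v x ⟧) (*-identityˡ (f x))
      (*-monoˡ-≤ (f x) (codeg≤ v≢x))

  -- `reach` for the constant weight 1; the walks back to `v` cancel against the walks of length 1,
  -- there being `degIn v vs` of each.
  moore : ∀ {v vs} → Unique vs → v ∈ vs → nsum (λ w → degIn w vs) v vs < length vs
  moore {v} {vs} un v∈ = +-cancelʳ-< (degIn v vs) _ _ (begin-strict
    nsum (λ w → degIn w vs) v vs + degIn v vs               ≡⟨ cong₂ _+_ (∑-cong vs λ {w} _ → cong (⟦ a v w ⟧ *_) (one w)) (one v) ⟩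
    nsum (λ w → nsum (const 1) w vs) v vs + nsum (const 1) v vs <⟨ ≤-reflexive (+-comm 1 _) ⟩
    nsum (λ w → nsum (const 1) w vs) v vs + nsum (const 1) v vs + 1 ≤⟨ reach (const 1) un v∈ ⟩
    ∑ (const 1) vs + degIn v vs * 1                       ≡⟨ cong₂ _+_ (≡.trans (∑-const 1 vs) (*-identityʳ (length vs))) (*-identityʳ (degIn v vs)) ⟩
    length vs + degIn v vs                                ∎)
    where
    open ≤-Reasoning
    one : ∀ w → degIn w vs ≡ nsum (const 1) w vs
    one w = ∑-cong vs λ {u} _ → sym (*-identityʳ ⟦ a w u ⟧)

  has : ℕ → List V → V → Bool
  has d vs u = degIn u vs ≡ᵇ d

  has-deg : ∀ {d vs u} → has d vs u ≡ true → degIn u vs ≡ d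
  has-deg {d} {vs} {u} = ≡ᵇ-sound (degIn u vs) d

  -- Otherwise the vertices of degree d would send too many edges to the others.
  dense : ∀ d c {n e} vs → length vs ≡ n → E vs ≡ e → (∀ {u} → u ∈ vs → d ≤ degIn u vs) →
          {_ : T (2 * e <ᵇ (d + d ∸ c) * (suc d * n ∸ 2 * e))} →
          ∃[ v ] v ∈ vs × degIn v vs ≡ d × c < nbrs (has d vs) v vs
  dense d c {n} {e} vs len eE ≥δ {ok} with search (λ v → has d vs v ∧ (suc c ≤ᵇ nbrs (has d vs) v vs)) vs
  ... | inj₁ (v , v∈ , h) = let h₁ , h₂ = ∧-split (has d vs v) h in
    v , v∈ , has-deg {vs = vs} h₁ , ≤ᵇ-true (suc c) (nbrs (has d vs) v vs) h₂
  ... | inj₂ none = ⊥-elim (<⇒≱ (<ᵇ⇒< _ _ ok) (begin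
    (d + d ∸ c) * (suc d * n ∸ 2 * e) ≤⟨ *-monoʳ-≤ (d + d ∸ c) x≥ ⟩
    (d + d ∸ c) * x                   ≡⟨ *-distribʳ-∸ x (d + d) c ⟩
    (d + d) * x ∸ c * x               ≤⟨ m≤n+o⇒m∸n≤o ((d + d) * x) (c * x) upper-bound ⟩
    2 * e                             ∎))
    where
    open ≤-Reasoning
    X = has d vs
    x = count X vs
    sumdeg : ∑ (λ u → degIn u vs) vs ≡ 2 * e
    sumdeg = ≡.trans (degree-sum vs) (cong (2 *_) eE)
    x≥ : suc d * n ∸ 2 * e ≤ x
    x≥ = m≤n+o⇒m∸n≤o (suc d * n) (2 * e) (begin
      suc d * n                          ≡⟨ ≡.trans (*-comm (suc d) n) (≡.trans (cong (_* suc d) (sym len)) (sym (∑-const (suc d) vs))) ⟩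
      ∑ (const (suc d)) vs               ≤⟨ ∑-mono vs point ⟩
      ∑ (λ u → degIn u vs + ⟦ X u ⟧) vs    ≡⟨ ≡.trans (∑-+ _ _ vs) (cong (_+ x) sumdeg) ⟩
      2 * e + x                          ∎)
      where
      point : ∀ {u} → u ∈ vs → suc d ≤ degIn u vs + ⟦ X u ⟧
      point {u} u∈ with degIn u vs ≡ᵇ d in h
      ... | true  = ≤-trans (≤-reflexive (+-comm 1 d)) (+-monoˡ-≤ 1 (≥δ u∈))
      ... | false = ≤-trans (≤∧≢⇒< (≥δ u∈) (≡ᵇ-false h ∘ sym)) (m≤m+n _ 0)
    total : ∑ (λ v → nbrs X v vs) vs ≡ d * x
    total = begin-equality
      ∑ (λ v → nbrs X v vs) vs       ≡⟨ ∑-cong vs (λ {v} _ → nbrs-nsum X v vs) ⟩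
      ∑ (λ v → nsum (⟦_⟧ ∘ X) v vs) vs ≡⟨ nsum-swap (⟦_⟧ ∘ X) vs vs ⟩
      ∑ (λ u → degIn u vs * ⟦ X u ⟧) vs  ≡⟨ ∑-cong vs point ⟩
      ∑ (λ u → d * ⟦ X u ⟧) vs         ≡⟨ ∑-*ˡ d (⟦_⟧ ∘ X) vs ⟩
      d * x                            ∎
      where
      point : ∀ {u} → u ∈ vs → degIn u vs * ⟦ X u ⟧ ≡ d * ⟦ X u ⟧
      point {u} u∈ with degIn u vs ≡ᵇ d in h
      ... | true  = cong (_* 1) (≡ᵇ-sound (degIn u vs) d h)
      ... | false = ≡.trans (*-zeroʳ (degIn u vs)) (sym (*-zeroʳ d))
    -- Counted over all vertices, the neighbours in `X` number `d * x`. The vertices of `X`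
    -- contribute at most `c` each, the others at most their degrees, which sum to `2 * e` less
    -- `d * x`.
    upper-bound : (d + d) * x ≤ c * x + 2 * e
    upper-bound = begin
      (d + d) * x                                        ≡⟨ *-distribʳ-+ x d d ⟩
      d * x + d * x                                      ≡⟨ cong₂ _+_ total (∑-*ˡ d (⟦_⟧ ∘ X) vs) ⟨
      ∑ (λ v → nbrs X v vs) vs + ∑ (λ v → d * ⟦ X v ⟧) vs ≡⟨ ∑-+ (λ v → nbrs X v vs) (λ v → d * ⟦ X v ⟧) vs ⟨
      ∑ (λ v → nbrs X v vs + d * ⟦ X v ⟧) vs             ≤⟨ ∑-mono vs point ⟩
      ∑ (λ v → c * ⟦ X v ⟧ + degIn v vs) vs                ≡⟨ ≡.trans (∑-+ _ _ vs) (cong₂ _+_ (∑-*ˡ c (⟦_⟧ ∘ X) vs) sumdeg) ⟩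
      c * x + 2 * e                                      ∎
      where
      point : ∀ {v} → v ∈ vs → nbrs X v vs + d * ⟦ X v ⟧ ≤ c * ⟦ X v ⟧ + degIn v vs
      point {v} v∈ with nv ← none v∈ | nb ← nbrs-≤ X v vs with degIn v vs ≡ᵇ d in h
      ... | true  = ≤-trans (+-mono-≤ (s≤s⁻¹ (≤ᵇ-false (suc c) (nbrs X v vs) nv))
                              (≤-reflexive (≡.trans (*-identityʳ d) (sym (≡ᵇ-sound (degIn v vs) d h)))))
                            (≤-reflexive (cong (_+ degIn v vs) (sym (*-identityʳ c))))
      ... | false rewrite *-zeroʳ d | *-zeroʳ c | +-identityʳ (nbrs X v vs) = nb

  nbr-pick : ∀ q {v vs} → v ∈ vs → 1 ≤ nbrs q v vs →
             ∃[ x ] ∃[ us ] vs ↭ x ∷ v ∷ us × a v x ≡ true × q x ≡ true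
  nbr-pick q {v} {vs} v∈ le with x , ys , p , h , _ ← pick (λ u → a v u ∧ q u) vs le =
    let vx , qx = ∧-split (a v x) h ; us , r = extract (x ∷ v ∷ []) (∈-resp-↭ (↭-sym p) (here refl) ∷ v∈ ∷ [])
                                     ((adj-≢ (sym-true vx) ∷ []) ∷ [] ∷ []) in
    x , us , r , vx , qx

  nbr-pick₂ : ∀ q {v vs} → v ∈ vs → Unique vs → 2 ≤ nbrs q v vs →
    ∃[ x ] ∃[ y ] ∃[ us ] vs ↭ x ∷ y ∷ v ∷ us × (a v x ≡ true × q x ≡ true) × (a v y ≡ true × q y ≡ true)
  nbr-pick₂ q {v} {vs} v∈ un le
    with x , ys , p , h , le₁ ← pick (λ u → a v u ∧ q u) vs le
    with y , zs , p′ , h′ , _ ← pick (λ u → a v u ∧ q u) ys le₁ =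
    let vx , qx = ∧-split (a v x) h ; vy , qy = ∧-split (a v y) h′
        p″ = ↭-trans p (prep x p′)
        x≢y = case Unique-↭ p″ un of λ { ((x≢y ∷ _) ∷ _) → x≢y }
        us , r = extract (x ∷ y ∷ v ∷ [])
          (∈-resp-↭ (↭-sym p″) (here refl) ∷ ∈-resp-↭ (↭-sym p″) (there (here refl)) ∷ v∈ ∷ [])
          ((x≢y ∷ adj-≢ (sym-true vx) ∷ []) ∷ (adj-≢ (sym-true vy) ∷ []) ∷ [] ∷ []) in
    x , y , us , r , (vx , qx) , (vy , qy)

  nbr-pick₃ : ∀ q {v vs} → v ∈ vs → Unique vs → 3 ≤ nbrs q v vs →
    ∃[ x ] ∃[ y ] ∃[ z ] ∃[ us ] vs ↭ x ∷ y ∷ z ∷ v ∷ us ×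
      (a v x ≡ true × q x ≡ true) × (a v y ≡ true × q y ≡ true) × (a v z ≡ true × q z ≡ true)
  nbr-pick₃ q {v} {vs} v∈ un le
    with x , ys , p , h , le₁ ← pick (λ u → a v u ∧ q u) vs le
    with y , zs , p′ , h′ , le₂ ← pick (λ u → a v u ∧ q u) ys le₁
    with z , ws , p″ , h″ , _ ← pick (λ u → a v u ∧ q u) zs le₂ =
    let vx , qx = ∧-split (a v x) h ; vy , qy = ∧-split (a v y) h′ ; vz , qz = ∧-split (a v z) h″
        r = ↭-trans p (prep x (↭-trans p′ (prep y p″)))
        x≢y , x≢z , y≢z = case Unique-↭ r un of λ { ((x≢y ∷ x≢z ∷ _) ∷ (y≢z ∷ _) ∷ _) → x≢y , x≢z , y≢z }
        us , s = extract (x ∷ y ∷ z ∷ v ∷ [])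
          (∈-resp-↭ (↭-sym r) (here refl) ∷ ∈-resp-↭ (↭-sym r) (there (here refl)) ∷
           ∈-resp-↭ (↭-sym r) (there (there (here refl))) ∷ v∈ ∷ [])
          ((x≢y ∷ x≢z ∷ adj-≢ (sym-true vx) ∷ []) ∷ (y≢z ∷ adj-≢ (sym-true vy) ∷ []) ∷
           (adj-≢ (sym-true vz) ∷ []) ∷ [] ∷ []) in
    x , y , z , us , s , (vx , qx) , (vy , qy) , (vz , qz)

  -- The number of edges that meet `S`, each counted at the first of its ends in `S`.
  gap : List V → List V → ℕ
  gap []      us = 0
  gap (x ∷ S) us = degIn x (S ++ us) + gap S us

  rest-edges : ∀ S us {vs e g} → vs ↭ S ++ us → gap S us ≡ g → E vs ≡ e → E us ≡ e ∸ g
  rest-edges S us {vs} p refl refl = sym (≡.trans (cong (_∸ gap S us) (≡.trans (E-↭ p) (split-E S)))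
                                                  (m+n∸m≡n (gap S us) (E us)))
    where
    split-E : ∀ S → E (S ++ us) ≡ gap S us + E us
    split-E []      = refl
    split-E (x ∷ S) = ≡.trans (cong (degIn x (S ++ us) +_) (split-E S)) (sym (+-assoc (degIn x (S ++ us)) (gap S us) (E us)))

  perm-length : ∀ {n us} {vs : List V} S → vs ↭ S ++ us → length vs ≡ length S + n → length us ≡ n
  perm-length {us = us} S p len = +-cancelˡ-≡ (length S) _ _
    (≡.trans (sym (length-++ S)) (≡.trans (sym (↭-length p)) len))

  weight : List Bool → ℕ
  weight = ∑ ⟦_⟧

  -- Typically `S` is an initial part of the deleted vertices that ends in `x`; then `us` still
  -- contains the later ones, and the result is the term of `x` in `gap`.
  rest-deg : ∀ x S bs {us vs k} → vs ↭ S ++ us → length S ≡ length bs → Match bs x S → degIn x vs ≡ k →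
             degIn x us ≡ k ∸ weight bs
  rest-deg x S bs {us} p l m refl = ≡.trans (go S bs l m) (cong (_∸ weight bs) (deg-↭ x (↭-sym p)))
    where
    go : ∀ S bs → length S ≡ length bs → Match bs x S → degIn x us ≡ degIn x (S ++ us) ∸ weight bs
    go []      []           l m       = refl
    go (s ∷ S) (true  ∷ bs) l (e , m) rewrite e = go S bs (suc-injective l) m
    go (s ∷ S) (false ∷ bs) l (e , m) rewrite e = go S bs (suc-injective l) m

  -- The common edge is lost only once, which in the uses below is just enough for the rest to be
  -- extremal.
  dense-pair : ∀ d {n e} vs → length vs ≡ n → E vs ≡ e → (∀ {u} → u ∈ vs → suc d ≤ degIn u vs) →
    {_ : T (2 * e <ᵇ (suc d + suc d) * (suc (suc d) * n ∸ 2 * e))} →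
    ∃[ x ] ∃[ v ] ∃[ us ] vs ↭ x ∷ v ∷ us × a x v ≡ true × degIn x (v ∷ us) ≡ suc d × degIn v us ≡ d ×
      E us ≡ e ∸ (suc d + d)
  dense-pair d vs len e ≥δ {ok} = case dense (suc d) 0 vs len e ≥δ {ok} of λ where
    (v , v∈ , dv , le) → case nbr-pick (has (suc d) vs) v∈ le of λ where
      (x , us , p , vx , hx) →
        let dx = rest-deg x (x ∷ []) (false ∷ []) p refl (a-irrefl x , tt) (has-deg {vs = vs} hx)
            dv′ = rest-deg v (x ∷ v ∷ []) (true ∷ false ∷ []) p refl (vx , a-irrefl v , tt) dv in
        x , v , us , p , sym-true vx , dx , dv′ ,
        rest-edges (x ∷ v ∷ []) us p (cong₂ _+_ dx (≡.trans (+-identityʳ _) dv′)) e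

  -- Extremal graphs on 13 to 20 vertices

  known13 : Known 13 21 graphs13
  known13 vs un len e = case dense-pair 2 vs len e (λ u∈ → subst (λ k → k ∸ 18 ≤ _) e (degree-≥ bound12 un len u∈)) of λ where
    (x , v , us , p , xv , dx , dv , e′) →
      attach-known {cs = certs13} {S = x ∷ v ∷ []} known11 covers13 un p
        (add v tt dv (add x (xv , tt) dx done)) (perm-length (x ∷ v ∷ []) p len) e′

  bound14 : Bound 14 23
  bound14 = bound-dead 12 3 known13 bound13 dead14

  known14 : Known 14 23 graphs14
  known14 vs un len e = case search (has 2 vs) vs of λ where
    (inj₁ (v , v∈ , h)) → case remove un v∈ of λ where
      (us , p , _ , d , _) → let dv = ≡.trans (sym d) (has-deg {vs = vs} h) in
        attach-known {cs = certs14a} {S = v ∷ []} known13 covers14a un p (add v tt dv done)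
          (perm-length (v ∷ []) p len) (rest-edges (v ∷ []) us p (cong₂ _+_ dv refl) e)
    -- All degrees are now at least 3. A path of three vertices of degree 3 meets 7 edges, which
    -- leaves 16 on 11 vertices.
    (inj₂ none) →
      case dense 3 1 vs len e (λ {u} u∈ → ≤∧≢⇒< (subst (λ k → k ∸ 21 ≤ _) e (degree-≥ bound13 un len u∈))
                                             (≡ᵇ-false (none u∈) ∘ sym)) of λ where
        (v , v∈ , dv , le) → case nbr-pick₂ (has 3 vs) v∈ un le of λ where
          (x , y , us , p , (vx , hx) , (vy , hy)) →
            let xy  = no3-false vx vy
                dx  = rest-deg x (x ∷ []) (false ∷ []) p refl (a-irrefl x , tt) (has-deg {vs = vs} hx)
                dy  = rest-deg y (x ∷ y ∷ []) (false ∷ false ∷ []) p refl (sym-true xy , a-irrefl y , tt)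
                        (has-deg {vs = vs} hy)
                dv′ = rest-deg v (x ∷ y ∷ v ∷ []) (true ∷ true ∷ false ∷ []) p refl (vx , vy , a-irrefl v , tt) dv in
            attach-known {cs = certs14b} {S = x ∷ y ∷ v ∷ []} known11 covers14b un p
              (add v tt dv′ (add y (sym-true vy , tt) dy (add x (xy , sym-true vx , tt) dx done)))
              (perm-length (x ∷ y ∷ v ∷ []) p len) (rest-edges (x ∷ y ∷ v ∷ []) us p (cong₂ _+_ dx (cong₂ _+_ dy (cong₂ _+_ dv′ refl))) e)

  bound15 : Bound 15 26
  bound15 = bound-average 13 26 bound14

  known15 : Known 15 26 graphs15
  known15 = known-minimal 13 3 known14 bound14 covers15

  bound16 : Bound 16 28
  bound16 = bound-dead 14 3 known15 bound15 dead16

  bound17 : Bound 17 31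
  bound17 = bound-average 15 31 bound16

  bound18 : Bound 18 34
  bound18 = bound-average 16 34 bound17

  nsum-mono : ∀ {f g} v vs → (∀ {w} → w ∈ vs → a v w ≡ true → f w ≤ g w) → nsum f v vs ≤ nsum g v vs
  nsum-mono {f} {g} v vs h = ∑-mono vs point
    where
    point : ∀ {w} → w ∈ vs → ⟦ a v w ⟧ * f w ≤ ⟦ a v w ⟧ * g w
    point {w} w∈ with a v w in vw
    ... | true  = +-monoˡ-≤ 0 (h w∈ vw)
    ... | false = z≤n

  nsum-const : ∀ c v vs → nsum (const c) v vs ≡ degIn v vs * c
  nsum-const c v = ∑-*ʳ c (λ w → ⟦ a v w ⟧)

  nsum-+ : ∀ f g v vs → nsum (λ w → f w + g w) v vs ≡ nsum f v vs + nsum g v vs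
  nsum-+ f g v vs = ≡.trans (∑-cong vs λ {w} _ → *-distribˡ-+ ⟦ a v w ⟧ (f w) (g w)) (∑-+ _ _ vs)

  nsum-adjoint : ∀ f g vs → ∑ (λ v → f v * nsum g v vs) vs ≡ ∑ (λ w → g w * nsum f w vs) vs
  nsum-adjoint f g vs = ≡.trans (∑-cong vs λ {v} _ → sym (∑-*ˡ (f v) (λ w → ⟦ a v w ⟧ * g w) vs))
    (≡.trans (∑-swap (λ v w → f v * (⟦ a v w ⟧ * g w)) vs vs)
      (∑-cong vs λ {w} _ → ≡.trans (∑-cong vs λ {v} _ → move v w) (∑-*ˡ (g w) (λ v → ⟦ a w v ⟧ * f v) vs)))
    where
    move : ∀ v w → f v * (⟦ a v w ⟧ * g w) ≡ g w * (⟦ a w v ⟧ * f v)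
    move v w rewrite a-sym v w =
      solve 3 (λ x y z → x :* (y :* z) := z :* (y :* x)) refl (f v) ⟦ a w v ⟧ (g w)

  nbrs-+ : ∀ q r v vs → (∀ {w} → w ∈ vs → ⟦ q w ⟧ + ⟦ r w ⟧ ≡ 1) → nbrs q v vs + nbrs r v vs ≡ degIn v vs
  nbrs-+ q r v vs h = ≡.trans (sym (∑-+ _ _ vs)) (∑-cong vs λ {w} w∈ → point (a v w) (h w∈))
    where
    point : ∀ b {w} → ⟦ q w ⟧ + ⟦ r w ⟧ ≡ 1 → ⟦ b ∧ q w ⟧ + ⟦ b ∧ r w ⟧ ≡ ⟦ b ⟧
    point true  h = h
    point false h = refl

  -- A neighbour of degree above `d` contributes at least `suc d` by itself, one of degree `d` with
  -- the help of the last term. An upper bound for the degree sum then forces neighbours of degree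
  -- `d`.
  low-nbrs : ∀ d u {vs} → (∀ {w} → w ∈ vs → d ≤ degIn w vs) →
             degIn u vs * suc d ≤ nsum (λ w → degIn w vs) u vs + nbrs (has d vs) u vs
  low-nbrs d u {vs} ≥δ = begin
    degIn u vs * suc d                                            ≡⟨ nsum-const (suc d) u vs ⟨
    nsum (const (suc d)) u vs                                   ≤⟨ nsum-mono u vs (λ w∈ _ → point w∈) ⟩
    nsum (λ w → degIn w vs + ⟦ has d vs w ⟧) u vs                 ≡⟨ nsum-+ (λ w → degIn w vs) (⟦_⟧ ∘ has d vs) u vs ⟩
    nsum (λ w → degIn w vs) u vs + nsum (⟦_⟧ ∘ has d vs) u vs     ≡⟨ cong (nsum (λ w → degIn w vs) u vs +_) (nbrs-nsum (has d vs) u vs) ⟨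
    nsum (λ w → degIn w vs) u vs + nbrs (has d vs) u vs           ∎
    where
    open ≤-Reasoning
    point : ∀ {w} → w ∈ vs → suc d ≤ degIn w vs + ⟦ has d vs w ⟧
    point {w} w∈ with degIn w vs ≡ᵇ d in h
    ... | true  = ≤-trans (≤-reflexive (+-comm 1 d)) (+-monoˡ-≤ 1 (≥δ w∈))
    ... | false = ≤-trans (≤∧≢⇒< (≥δ w∈) (≡ᵇ-false h ∘ sym)) (m≤m+n _ 0)

  -- A vertex of degree at least 5 has degree exactly 5 and three neighbours of degree 3, since by
  -- `moore` its neighbours have degree sum at most 17; these four vertices meet 11 edges. A vertex
  -- of degree 4 with two neighbours of degree 3 gives a set that meets 8. Failing both, there is a
  -- path with degrees 3, 4, 4, 3, which meets 11. The rest is extremal on 14, 15 and 14 vertices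
  -- respectively.
  known18 : Known 18 34 graphs18
  known18 vs un len e = case search (λ u → 5 ≤ᵇ degIn u vs) vs of λ where
      (inj₁ (u , u∈ , h)) → five u u∈ (≤ᵇ-true 5 (degIn u vs) h)
      (inj₂ small) → case search (λ p → has 4 vs p ∧ (2 ≤ᵇ nbrs three p vs)) vs of λ where
        (inj₁ (p , p∈ , h)) → let h₁ , h₂ = ∧-split (has 4 vs p) h in
          cherry p∈ (has-deg {vs = vs} h₁) (≤ᵇ-true 2 (nbrs three p vs) h₂)
        (inj₂ none) → path (λ {u} u∈ → s≤s⁻¹ (≤ᵇ-false 5 (degIn u vs) (small u∈))) none
    where
    three = has 3 vs
    Goal = ∃[ ws ] ws ↭ vs × code ws ∈ graphs18
    ≥δ : ∀ {u} → u ∈ vs → 3 ≤ degIn u vs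
    ≥δ u∈ = subst (λ k → k ∸ 31 ≤ _) e (degree-≥ bound17 un len u∈)
    deg3 : ∀ {u} → three u ≡ true → degIn u vs ≡ 3
    deg3 = has-deg {vs = vs}
    five : ∀ u → u ∈ vs → 5 ≤ degIn u vs → Goal
    five u u∈ 5≤ = case nbr-pick₃ three u∈ un c₃ of λ where
        (x , y , z , us , p , (ux , hx) , (uy , hy) , (uz , hz)) →
          let xy = no3-false ux uy ; xz = no3-false ux uz ; yz = no3-false uy uz
              dx = rest-deg x (x ∷ []) (false ∷ []) p refl (a-irrefl x , tt) (deg3 hx)
              dy = rest-deg y (x ∷ y ∷ []) (false ∷ false ∷ []) p refl (sym-true xy , a-irrefl y , tt) (deg3 hy)
              dz = rest-deg z (x ∷ y ∷ z ∷ []) (false ∷ false ∷ false ∷ []) p refl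
                     (sym-true xz , sym-true yz , a-irrefl z , tt) (deg3 hz)
              du = rest-deg u (x ∷ y ∷ z ∷ u ∷ []) (true ∷ true ∷ true ∷ false ∷ []) p refl
                     (ux , uy , uz , a-irrefl u , tt) d₅ in
          attach-known {cs = certs18b} {S = x ∷ y ∷ z ∷ u ∷ []} known14 covers18b un p
            (add u tt du (add z (sym-true uz , tt) dz (add y (yz , sym-true uy , tt) dy
              (add x (xy , xz , sym-true ux , tt) dx done))))
            (perm-length (x ∷ y ∷ z ∷ u ∷ []) p len)
            (rest-edges (x ∷ y ∷ z ∷ u ∷ []) us p (cong₂ _+_ dx (cong₂ _+_ dy (cong₂ _+_ dz (cong₂ _+_ du refl)))) e)
      where
      S≤ : nsum (λ w → degIn w vs) u vs ≤ 17
      S≤ = s≤s⁻¹ (subst (suc (nsum (λ w → degIn w vs) u vs) ≤_) len (moore un u∈))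
      d₅ : degIn u vs ≡ 5
      d₅ = ≤-antisym (s≤s⁻¹ (*-cancelʳ-< 3 (degIn u vs) 6 (≤-<-trans (≤-trans
             (≤-trans (≤-reflexive (sym (nsum-const 3 u vs))) (nsum-mono u vs (λ w∈ _ → ≥δ w∈))) S≤) (18 ≤! 18)))) 5≤
      c₃ : 3 ≤ nbrs three u vs
      c₃ = +-cancelˡ-≤ 17 3 _ (≤-trans (*-monoˡ-≤ 4 5≤) (≤-trans (low-nbrs 3 u ≥δ) (+-monoˡ-≤ _ S≤)))
    cherry : ∀ {v} → v ∈ vs → degIn v vs ≡ 4 → 2 ≤ nbrs three v vs → Goal
    cherry {v} v∈ dv le = case nbr-pick₂ three v∈ un le of λ where
      (x , y , us , p , (vx , hx) , (vy , hy)) →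
        let xy  = no3-false vx vy
            dx  = rest-deg x (x ∷ []) (false ∷ []) p refl (a-irrefl x , tt) (deg3 hx)
            dy  = rest-deg y (x ∷ y ∷ []) (false ∷ false ∷ []) p refl (sym-true xy , a-irrefl y , tt) (deg3 hy)
            dv′ = rest-deg v (x ∷ y ∷ v ∷ []) (true ∷ true ∷ false ∷ []) p refl (vx , vy , a-irrefl v , tt) dv in
        attach-known {cs = certs18a} {S = x ∷ y ∷ v ∷ []} known15 covers18a un p
          (add v tt dv′ (add y (sym-true vy , tt) dy (add x (xy , sym-true vx , tt) dx done)))
          (perm-length (x ∷ y ∷ v ∷ []) p len)
          (rest-edges (x ∷ y ∷ v ∷ []) us p (cong₂ _+_ dx (cong₂ _+_ dy (cong₂ _+_ dv′ refl))) e)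
    -- Deleting two such adjacent vertices would cost only 5 edges and leave 29 on 16 vertices.
    no33 : ∀ {x y} → x ∈ vs → y ∈ vs → three x ≡ true → three y ≡ true → a x y ≡ false
    no33 {x} {y} x∈ y∈ hx hy with a x y in xy
    ... | false = refl
    ... | true  = ⊥-elim (case extract (x ∷ y ∷ []) (x∈ ∷ y∈ ∷ []) ((adj-≢ xy ∷ []) ∷ [] ∷ []) of λ where
      (us , p) →
        let dx = rest-deg x (x ∷ []) (false ∷ []) p refl (a-irrefl x , tt) (deg3 hx)
            dy = rest-deg y (x ∷ y ∷ []) (true ∷ false ∷ []) p refl (sym-true xy , a-irrefl y , tt) (deg3 hy) in
        <⇒≱ (29 ≤! 29) (subst (_≤ 28) (rest-edges (x ∷ y ∷ []) us p (cong₂ _+_ dx (cong₂ _+_ dy refl)) e)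
          (bound16 us (Unique-drop (x ∷ y ∷ []) (Unique-↭ p un)) (perm-length (x ∷ y ∷ []) p len))))
    -- Every vertex has at most one neighbour of degree 3.  If r is such a neighbour
    -- of p then one of the three other neighbours of p also has one, since only two
    -- vertices of degree 4 have none.
    path : (∀ {u} → u ∈ vs → degIn u vs ≤ 4) →
           (∀ {p} → p ∈ vs → has 4 vs p ∧ (2 ≤ᵇ nbrs three p vs) ≡ false) → Goal
    path small none = case pick three vs (subst (1 ≤_) (sym #3) (1 ≤! 4)) of λ where
        (r , us , p , hr , _) → from-r (∈-resp-↭ (↭-sym p) (here refl)) hr
      where
      z : V → ℕ
      z v = nbrs three v vs
      four : ∀ {u} → u ∈ vs → three u ≡ false → degIn u vs ≡ 4
      four u∈ h = ≤-antisym (small u∈) (≤∧≢⇒< (≥δ u∈) (≡ᵇ-false h ∘ sym))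
      #3 : count three vs ≡ 4
      #3 = +-cancelˡ-≡ 68 _ _ (≡.trans (cong (_+ count three vs) (sym (≡.trans (degree-sum vs) (cong (2 *_) e))))
        (≡.trans (sym (∑-+ (λ u → degIn u vs) (⟦_⟧ ∘ three) vs)) (≡.trans (∑-cong vs point)
          (≡.trans (∑-const 4 vs) (cong (_* 4) len)))))
        where
        point : ∀ {u} → u ∈ vs → degIn u vs + ⟦ three u ⟧ ≡ 4
        point {u} u∈ with three u in h
        ... | true  = cong (_+ 1) (deg3 h)
        ... | false = ≡.trans (+-identityʳ _) (four u∈ h)
      z3 : ∀ {u} → u ∈ vs → three u ≡ true → z u ≡ 0
      z3 {u} u∈ h = ≡.trans (∑-cong vs point) (≡.trans (∑-const 0 vs) (*-zeroʳ (length vs)))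
        where
        point : ∀ {w} → w ∈ vs → ⟦ a u w ∧ three w ⟧ ≡ 0
        point {w} w∈ with a u w in uw | three w in h′
        ... | true  | true  = ⊥-elim (true≢false uw (no33 u∈ w∈ h h′))
        ... | true  | false = refl
        ... | false | _     = refl
      z≤1 : ∀ {u} → u ∈ vs → z u ≤ 1
      z≤1 {u} u∈ with three u in h
      ... | true  = ≤-trans (≤-reflexive (z3 u∈ h)) z≤n
      ... | false with nn ← none u∈ rewrite ≡ᵇ-true (four u∈ h) = s≤s⁻¹ (≤ᵇ-false 2 (z u) nn)
      zero? : V → Bool
      zero? v = z v ≡ᵇ 0
      -- The values of `z` are at most 1 and sum to 3 · 4 = 12 over 18 vertices. Of the six vertices
      -- with value 0, four are those of degree 3 themselves.
      #z : count zero? vs ≡ 6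
      #z = +-cancelˡ-≡ 12 _ _ (≡.trans (cong (_+ count zero? vs) (sym total))
        (≡.trans (sym (∑-+ z (⟦_⟧ ∘ zero?) vs)) (≡.trans (∑-cong vs point)
          (≡.trans (∑-const 1 vs) (cong (_* 1) len)))))
        where
        point : ∀ {u} → u ∈ vs → z u + ⟦ zero? u ⟧ ≡ 1
        point {u} u∈ with z u | z≤1 u∈
        ... | 0 | _ = refl
        ... | 1 | _ = refl
        ... | suc (suc _) | s≤s ()
        total : ∑ z vs ≡ 12
        total = ≡.trans (∑-cong vs (λ {v} _ → nbrs-nsum three v vs)) (≡.trans (nsum-swap (⟦_⟧ ∘ three) vs vs)
          (≡.trans (∑-cong vs pt) (≡.trans (∑-*ˡ 3 (⟦_⟧ ∘ three) vs) (cong (3 *_) #3))))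
          where
          pt : ∀ {u} → u ∈ vs → degIn u vs * ⟦ three u ⟧ ≡ 3 * ⟦ three u ⟧
          pt {u} _ with three u in h
          ... | true  = cong (_* 1) (deg3 h)
          ... | false = *-zeroʳ (degIn u vs)
      #z4 : count (λ w → not (three w) ∧ zero? w) vs ≡ 2
      #z4 = +-cancelˡ-≡ 4 _ _ (≡.trans (cong (_+ count (λ w → not (three w) ∧ zero? w) vs) (sym #3))
        (≡.trans (sym (∑-+ (⟦_⟧ ∘ three) _ vs)) (≡.trans (∑-cong vs point) #z)))
        where
        point : ∀ {w} → w ∈ vs → ⟦ three w ⟧ + ⟦ not (three w) ∧ zero? w ⟧ ≡ ⟦ zero? w ⟧
        point {w} w∈ with three w in h
        ... | true  rewrite z3 w∈ h = refl
        ... | false = refl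
      from-r : ∀ {r} → r ∈ vs → three r ≡ true → Goal
      from-r {r} r∈ hr = case pick (a r) vs (subst (1 ≤_) (sym (deg3 hr)) (1 ≤! 3)) of λ where
          (p , us , per , rp , _) → from-p (∈-resp-↭ (↭-sym per) (here refl)) rp
        where
        from-p : ∀ {p} → p ∈ vs → a r p ≡ true → Goal
        from-p {p} p∈ rp = case count-< (λ w → a p w ∧ not (three w)) (λ w → not (three w) ∧ zero? w) vs lt of λ where
            (p′ , p′∈ , h , h′) →
              let pp′ , n3 = ∧-split (a p p′) h in
              from-p′ p′∈ pp′ (not-true n3) (nonzero p′ n3 h′)
          where
          not-true : ∀ {b} → not b ≡ true → b ≡ false
          not-true {false} _ = refl
          hp : three p ≡ false
          hp with three p in h
          ... | false = refl
          ... | true  = ⊥-elim (true≢false rp (no33 r∈ p∈ hr h))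
          zp : z p ≡ 1
          zp = ≤-antisym (z≤1 p∈) (count-∈ (λ w → a p w ∧ three w) r∈ (cong₂ _∧_ (sym-true rp) hr))
          lt : count (λ w → not (three w) ∧ zero? w) vs < nbrs (not ∘ three) p vs
          lt = subst₂ _<_ (sym #z4) (sym three-others) (3 ≤! 3)
            where
            three-others : nbrs (not ∘ three) p vs ≡ 3
            three-others = +-cancelˡ-≡ 1 _ _ (≡.trans (cong (_+ nbrs (not ∘ three) p vs) (sym zp))
              (≡.trans (nbrs-+ three (not ∘ three) p vs (λ {w} _ → comp (three w))) (four p∈ hp)))
              where
              comp : ∀ b → ⟦ b ⟧ + ⟦ not b ⟧ ≡ 1
              comp true  = refl
              comp false = refl
          nonzero : ∀ p′ → not (three p′) ≡ true → not (three p′) ∧ zero? p′ ≡ false → 1 ≤ z p′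
          nonzero p′ n3 h rewrite n3 = n≢0⇒n>0 (≡ᵇ-false h)
          from-p′ : ∀ {p′} → p′ ∈ vs → a p p′ ≡ true → three p′ ≡ false → 1 ≤ z p′ → Goal
          from-p′ {p′} p′∈ pp′ hp′ le = case nbr-pick three p′∈ le of λ where
              (r′ , us , per , p′r′ , hr′) → finish (∈-resp-↭ (↭-sym per) (here refl)) p′r′ hr′
            where
            finish : ∀ {r′} → r′ ∈ vs → a p′ r′ ≡ true → three r′ ≡ true → Goal
            finish {r′} r′∈ p′r′ hr′ = case extract (r′ ∷ r ∷ p′ ∷ p ∷ [])
                (r′∈ ∷ r∈ ∷ p′∈ ∷ p∈ ∷ [])
                ((r′≢r ∷ adj-≢ (sym-true p′r′) ∷ differ hr′ hp ∷ []) ∷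
                 (differ hr hp′ ∷ adj-≢ rp ∷ []) ∷ (adj-≢ (sym-true pp′) ∷ []) ∷ [] ∷ []) of λ where
                (us , per) →
                  let dr′ = rest-deg r′ (r′ ∷ []) (false ∷ []) per refl (a-irrefl r′ , tt) (deg3 hr′)
                      dr  = rest-deg r (r′ ∷ r ∷ []) (false ∷ false ∷ []) per refl
                              (no33 r∈ r′∈ hr hr′ , a-irrefl r , tt) (deg3 hr)
                      dp′ = rest-deg p′ (r′ ∷ r ∷ p′ ∷ []) (true ∷ false ∷ false ∷ []) per refl
                              (p′r′ , p′r , a-irrefl p′ , tt) (four p′∈ hp′)
                      dp  = rest-deg p (r′ ∷ r ∷ p′ ∷ p ∷ []) (false ∷ true ∷ true ∷ false ∷ []) per refl
                              (pr′ , sym-true rp , pp′ , a-irrefl p , tt) (four p∈ hp) in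
                  attach-known {cs = certs18c} {S = r′ ∷ r ∷ p′ ∷ p ∷ []} known14 covers18c un per
                    (add p tt dp (add p′ (sym-true pp′ , tt) dp′ (add r (sym-true p′r , rp , tt) dr
                      (add r′ (no33 r′∈ r∈ hr′ hr , sym-true p′r′ , sym-true pr′ , tt) dr′ done))))
                    (perm-length (r′ ∷ r ∷ p′ ∷ p ∷ []) per len)
                    (rest-edges (r′ ∷ r ∷ p′ ∷ p ∷ []) us per
                      (cong₂ _+_ dr′ (cong₂ _+_ dr (cong₂ _+_ dp′ (cong₂ _+_ dp refl)))) e)
              where
              differ : ∀ {x y} → three x ≡ true → three y ≡ false → x ≢ y
              differ hx hy refl = true≢false hx hy
              r′≢r : r′ ≢ r
              r′≢r refl = no3 pp′ p′r′ rp
              p′r : a p′ r ≡ false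
              p′r = no3-false pp′ (sym-true rp)
              pr′ : a p r′ ≡ false
              pr′ = no3-false (sym-true pp′) p′r′

  bound19 : Bound 19 38
  bound19 = bound-average 17 38 bound18

  known19 : Known 19 38 graphs19
  known19 = known-minimal 17 4 known18 bound18 covers19

  bound20 : Bound 20 41
  bound20 = bound-dead 18 4 known19 bound19 dead20


  -- A vertex of degree 3 leaves 38 edges on 19 vertices. If all degrees are at least 4, some degree
  -- is at least 5 because 82 > 80, and such a vertex reaches at least 1 + 5 + 15 = 21 vertices.
  known20 : Known 20 41 graphs20
  known20 vs un len e = case search (has 3 vs) vs of λ where
      (inj₁ (v , v∈ , h)) → case remove un v∈ of λ where
        (us , p , _ , d , _) → let dv = ≡.trans (sym d) (has-deg {vs = vs} h) in
          attach-known {cs = certs20} {S = v ∷ []} known19 covers20 un p (add v tt dv done)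
            (perm-length (v ∷ []) p len) (rest-edges (v ∷ []) us p (cong₂ _+_ dv refl) e)
      (inj₂ none) → ⊥-elim (impossible λ {u} u∈ →
        ≤∧≢⇒< (subst (λ k → k ∸ 38 ≤ _) e (degree-≥ bound19 un len u∈)) (≡ᵇ-false (none u∈) ∘ sym))
    where
    impossible : (∀ {u} → u ∈ vs → 4 ≤ degIn u vs) → ⊥
    impossible ≥δ = case search (λ u → 5 ≤ᵇ degIn u vs) vs of λ where
      (inj₁ (u , u∈ , h)) → <⇒≱ (subst (nsum (λ w → degIn w vs) u vs <_) len (moore un u∈))
        (≤-trans (*-monoˡ-≤ 4 (≤ᵇ-true 5 (degIn u vs) h))
          (≤-trans (≤-reflexive (sym (nsum-const 4 u vs))) (nsum-mono u vs (λ w∈ _ → ≥δ w∈))))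
      (inj₂ small) → <⇒≱ (81 ≤! 82) (subst₂ _≤_
        (≡.trans (degree-sum vs) (cong (2 *_) e)) (≡.trans (∑-const 4 vs) (cong (_* 4) len))
        (∑-mono vs λ {u} u∈ → s≤s⁻¹ (≤ᵇ-false 5 (degIn u vs) (small u∈))))

  -- Bounds for 21 to 24 vertices

  bound21 : Bound 21 44
  bound21 = bound-dead 19 4 known20 bound20 dead21

  at-most-suc : ∀ k {f} f′ vs → Bound (suc k) f → Unique vs → length vs ≡ 2 + k →
                {_ : T ((2 + k) * f <ᵇ k * (2 + f′))} → (E vs ≡ suc f′ → ⊥) → E vs ≤ f′
  at-most-suc k f′ vs bd un len {ok} h = ≮⇒≥ λ f′<E → h (≤-antisym (s≤s⁻¹ (*-cancelˡ-< k (E vs) (2 + f′)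
    (≤-<-trans (proj₂ (proj₂ (degree-range (minimal vs un len) bd len))) (<ᵇ⇒< _ _ ok)))) f′<E)

  -- Averaging leaves 48 edges, with all degrees at least 4; two adjacent vertices of degree 4 meet
  -- 7 of them, which leaves 41 on 20 vertices.
  bound22 : Bound 22 47
  bound22 vs un len = at-most-suc 20 47 vs bound21 un len λ e →
    case dense-pair 3 vs len e (λ u∈ → subst (λ k → k ∸ 44 ≤ _) e (degree-≥ bound21 un len u∈)) of λ where
      (x , v , us , p , xv , dx , dv , e′) →
        attach-dead {S = x ∷ v ∷ []} known20 dead22 un p
          (add v tt dv (add x (xv , tt) dx done)) (perm-length (x ∷ v ∷ []) p len) e′

  -- With y the number of neighbours of degree 5, summing the reach of the vertices of
  -- degree 5 gives ∑ y² + ∑ y ≤ 140, the second sum being over degree 5.  The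
  -- sum of all y is 50, and y² ≥ 4y - 3 in degree 4, where y ≥ 3 if there is no path
  -- 4-4-4, and y² + y ≥ 4y - 2 in degree 5.
  bound23 : Bound 23 50
  bound23 vs un len = at-most-suc 21 50 vs bound22 un len λ e →
    case search (λ v → has 4 vs v ∧ (2 ≤ᵇ nbrs (has 4 vs) v vs)) vs of λ where
      (inj₁ (v , v∈ , h)) → let h₁ , h₂ = ∧-split (has 4 vs v) h in
        cherry e v∈ (has-deg {vs = vs} h₁) (≤ᵇ-true 2 (nbrs (has 4 vs) v vs) h₂)
      (inj₂ none) → count-contradiction e none
    where
    cherry : E vs ≡ 51 → ∀ {v} → v ∈ vs → degIn v vs ≡ 4 → 2 ≤ nbrs (has 4 vs) v vs → ⊥
    cherry e {v} v∈ dv le = case nbr-pick₂ (has 4 vs) v∈ un le of λ where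
      (x , y , us , p , (vx , hx) , (vy , hy)) →
        let xy  = no3-false vx vy
            dx  = rest-deg x (x ∷ []) (false ∷ []) p refl (a-irrefl x , tt) (has-deg {vs = vs} hx)
            dy  = rest-deg y (x ∷ y ∷ []) (false ∷ false ∷ []) p refl (sym-true xy , a-irrefl y , tt) (has-deg {vs = vs} hy)
            dv′ = rest-deg v (x ∷ y ∷ v ∷ []) (true ∷ true ∷ false ∷ []) p refl (vx , vy , a-irrefl v , tt) dv in
        attach-dead {S = x ∷ y ∷ v ∷ []} known20 dead23 un p
          (add v tt dv′ (add y (sym-true vy , tt) dy (add x (xy , sym-true vx , tt) dx done)))
          (perm-length (x ∷ y ∷ v ∷ []) p len)
          (rest-edges (x ∷ y ∷ v ∷ []) us p (cong₂ _+_ dx (cong₂ _+_ dy (cong₂ _+_ dv′ refl))) e)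
    count-contradiction : E vs ≡ 51 → (∀ {v} → v ∈ vs → has 4 vs v ∧ (2 ≤ᵇ nbrs (has 4 vs) v vs) ≡ false) → ⊥
    count-contradiction e none = <⇒≱ (200 ≤! 200) (begin
        200                                                  ≡⟨ cong (4 *_) ∑y ⟨
        4 * ∑ y vs                                           ≡⟨ ∑-*ˡ 4 y vs ⟨
        ∑ (λ w → 4 * y w) vs                                 ≤⟨ ∑-mono vs point ⟩
        ∑ (λ w → (y w * y w + t w * y w) + (3 * f w + 2 * t w)) vs
          ≡⟨ ≡.trans (∑-+ _ _ vs) (cong₂ _+_ (∑-+ _ _ vs)
               (≡.trans (∑-+ _ _ vs) (cong₂ _+_ (∑-*ˡ 3 f vs) (∑-*ˡ 2 t vs)))) ⟩
        (∑ (λ w → y w * y w) vs + ∑ (λ w → t w * y w) vs) + (3 * ∑ f vs + 2 * ∑ t vs)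
          -- The result is 140 + 3 · 13 + 2 · 10, one less than 4 · 50.
          ≤⟨ +-mono-≤ reached (≤-reflexive (cong₂ (λ m n → 3 * m + 2 * n) #f #t)) ⟩
        199 ∎)
      where
      open ≤-Reasoning
      F T′ : V → Bool
      F  = has 4 vs
      T′ = not ∘ F
      f t y : V → ℕ
      f w = ⟦ F w ⟧
      t w = ⟦ T′ w ⟧
      y w = nsum t w vs
      ≥δ : ∀ {u} → u ∈ vs → 4 ≤ degIn u vs
      ≥δ u∈ = subst (λ k → k ∸ 47 ≤ _) e (degree-≥ bound22 un len u∈)
      Δ≤5 : ∀ {u} → u ∈ vs → degIn u vs ≤ 5
      Δ≤5 {u} u∈ = s≤s⁻¹ (*-cancelʳ-< 4 (degIn u vs) 6 (≤-<-trans (≤-trans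
        (≤-reflexive (sym (nsum-const 4 u vs))) (nsum-mono u vs (λ w∈ _ → ≥δ w∈)))
        (<-≤-trans (subst (nsum (λ w → degIn w vs) u vs <_) len (moore un u∈)) (23 ≤! 24))))
      five : ∀ {u} → u ∈ vs → F u ≡ false → degIn u vs ≡ 5
      five u∈ h = ≤-antisym (Δ≤5 u∈) (≤∧≢⇒< (≥δ u∈) (≡ᵇ-false h ∘ sym))
      f+t : ∀ w → f w + t w ≡ 1
      f+t w with F w
      ... | true  = refl
      ... | false = refl
      #f : ∑ f vs ≡ 13
      #f = +-cancelˡ-≡ 102 _ _ (≡.trans (cong (_+ ∑ f vs) (sym (≡.trans (degree-sum vs) (cong (2 *_) e))))
        (≡.trans (sym (∑-+ (λ u → degIn u vs) f vs)) (≡.trans (∑-cong vs pt) (≡.trans (∑-const 5 vs) (cong (_* 5) len)))))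
        where
        pt : ∀ {u} → u ∈ vs → degIn u vs + f u ≡ 5
        pt {u} u∈ with F u in h
        ... | true  = cong (_+ 1) (has-deg {vs = vs} h)
        ... | false = ≡.trans (+-identityʳ _) (five u∈ h)
      #t : ∑ t vs ≡ 10
      #t = +-cancelˡ-≡ 13 _ _ (≡.trans (cong (_+ ∑ t vs) (sym #f)) (≡.trans (sym (∑-+ f t vs))
        (≡.trans (∑-cong vs (λ {w} _ → f+t w)) (≡.trans (∑-const 1 vs) (cong (_* 1) len)))))
      ∑y : ∑ y vs ≡ 50
      ∑y = ≡.trans (nsum-swap t vs vs) (≡.trans (∑-cong vs pt) (≡.trans (∑-*ˡ 5 t vs) (cong (5 *_) #t)))
        where
        pt : ∀ {u} → u ∈ vs → degIn u vs * t u ≡ 5 * t u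
        pt {u} u∈ with F u in h
        ... | true  = *-zeroʳ (degIn u vs)
        ... | false = cong (_* 1) (five u∈ h)
      y-nbrs : ∀ w → y w ≡ nbrs T′ w vs
      y-nbrs w = sym (nbrs-nsum T′ w vs)
      -- This is (n - 1)(n - 3) ≥ 0, and `4≤x²` below is (n - 1)(n - 2) ≥ 0.
      4≤y² : ∀ n → 3 ≤ n → 4 * n ≤ n * n + 0 + 3
      4≤y² 1 (s≤s ())
      4≤y² 2 (s≤s (s≤s ()))
      4≤y² 3 _ = 12 ≤! 12
      4≤y² n@(suc (suc (suc (suc m)))) _ = ≤-trans (*-monoˡ-≤ n (s≤s (s≤s (s≤s (s≤s (z≤n {m}))))))
        (≤-trans (m≤m+n (n * n) 0) (m≤m+n (n * n + 0) 3))
      4≤x² : ∀ n → 4 * n ≤ n * n + n + 2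
      4≤x² 0 = z≤n
      4≤x² 1 = 4 ≤! 4
      4≤x² 2 = 8 ≤! 8
      4≤x² n@(suc (suc (suc m))) = ≤-trans (≤-trans (≤-reflexive (+-comm n (3 * n)))
        (+-monoˡ-≤ n (*-monoˡ-≤ n (s≤s (s≤s (s≤s (z≤n {m}))))))) (m≤m+n _ 2)
      point : ∀ {w} → w ∈ vs → 4 * y w ≤ (y w * y w + t w * y w) + (3 * f w + 2 * t w)
      point {w} w∈ with nn ← none w∈ | fw ← five w∈ with F w in h
      ... | true  = 4≤y² (y w) (+-cancelˡ-≤ 1 3 (y w) (≤-trans
                      (≤-reflexive (≡.trans (sym (has-deg {vs = vs} h))
                        (sym (nbrs-+ F T′ w vs (λ {v} _ → f+t v)))))
                      (+-mono-≤ (s≤s⁻¹ (≤ᵇ-false 2 _ nn)) (≤-reflexive (sym (y-nbrs w))))))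
      ... | false = subst (λ k → 4 * y w ≤ y w * y w + k + 2) (sym (+-identityʳ (y w))) (4≤x² (y w))
      reached : ∑ (λ w → y w * y w) vs + ∑ (λ w → t w * y w) vs ≤ 140
      reached = +-cancelʳ-≤ 10 _ _ (begin
        ∑ (λ w → y w * y w) vs + ∑ (λ w → t w * y w) vs + 10
          ≡⟨ cong₂ (λ m n → m + ∑ (λ w → t w * y w) vs + n) (sym (nsum-adjoint t y vs)) (sym #t) ⟩
        ∑ (λ p → t p * nsum y p vs) vs + ∑ (λ w → t w * y w) vs + ∑ t vs
          ≡⟨ ≡.trans (∑-+ _ t vs) (cong (_+ ∑ t vs) (∑-+ _ _ vs)) ⟨
        ∑ (λ p → t p * nsum y p vs + t p * y p + t p) vs
          ≤⟨ ∑-mono vs at ⟩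
        ∑ (λ p → 15 * t p) vs
          ≡⟨ ≡.trans (∑-*ˡ 15 t vs) (cong (15 *_) #t) ⟩
        150 ∎)
        where
        -- For a vertex of degree 5, `reach` with the weight `t` allows 10 + 5.
        at : ∀ {p} → p ∈ vs → t p * nsum y p vs + t p * y p + t p ≤ 15 * t p
        at {p} p∈ with r ← reach t un p∈ | fp ← five p∈ with F p in h
        ... | true  = z≤n
        ... | false rewrite #t | fp refl | +-identityʳ (nsum y p vs) | +-identityʳ (y p) = r

  bound24 : Bound 24 54
  bound24 = bound-average 22 54 bound23

  codegree-≤1 : ∀ {x y vs} → Unique vs → x ≢ y → count (λ w → a x w ∧ a y w) vs ≤ 1
  codegree-≤1 {x} {y} un x≢y = count-≤1 (λ w → a x w ∧ a y w) un λ {w} {w′} _ _ h h′ w≢w′ →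
    let xw , yw = ∧-split (a x w) h ; xw′ , yw′ = ∧-split (a x w′) h′ in
    no4 xw (sym-true yw) yw′ (sym-true xw′) x≢y w≢w′

  no4-false : ∀ {u v w x} → a u v ≡ true → a v w ≡ true → a w x ≡ true → u ≢ w → v ≢ x → a u x ≡ false
  no4-false {u} {x = x} uv vw wx u≢w v≢x with a u x in ux
  ... | false = refl
  ... | true  = ⊥-elim (no4 uv vw wx (sym-true ux) u≢w v≢x)

  -- Otherwise the four neighbours of degree 4 already lead to too many vertices of
  -- degree 5, so one of them has a neighbour f of degree 4; removing u, four of its
  -- neighbours and f leaves an extremal graph on 18 vertices.
  few-low-nbrs : ∀ {u} vs → Unique vs → length vs ≡ 24 → E vs ≡ 54 → u ∈ vs → degIn u vs ≡ 5 →
                 4 ≤ nbrs (has 4 vs) u vs → ⊥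
  few-low-nbrs {u} vs un len e u∈ du le =
    case search (λ w → (a u w ∧ F w) ∧ (1 ≤ᵇ nbrs F w vs)) vs of λ where
      (inj₁ (w , w∈ , h)) → let h₁ , h₂ = ∧-split (a u w ∧ F w) h ; uw , Fw = ∧-split (a u w) h₁ in
        case nbr-pick F w∈ (≤ᵇ-true 1 (nbrs F w vs) h₂) of λ where
          (f , us , p , wf , Ff) → with-f w∈ uw Fw (∈-resp-↭ (↭-sym p) (here refl)) wf Ff
      (inj₂ none) → no-f none
    where
    F T′ : V → Bool
    F  = has 4 vs
    T′ = not ∘ F
    t y : V → ℕ
    t w = ⟦ T′ w ⟧
    y w = nsum t w vs
    degF : ∀ {w} → F w ≡ true → degIn w vs ≡ 4
    degF = has-deg {vs = vs}
    f+t : ∀ w → ⟦ F w ⟧ + t w ≡ 1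
    f+t w with F w
    ... | true  = refl
    ... | false = refl
    ≥δ : ∀ {w} → w ∈ vs → 4 ≤ degIn w vs
    ≥δ w∈ = subst (λ k → k ∸ 50 ≤ _) e (degree-≥ bound23 un len w∈)
    no-f : (∀ {w} → w ∈ vs → (a u w ∧ F w) ∧ (1 ≤ᵇ nbrs F w vs) ≡ false) → ⊥
    -- Each of the five neighbours of `u` has `y w + 3 * t w` at least 4: one of degree 4 has all
    -- four neighbours of degree above 4, any other has `u` among them and `t w` equal to 1. On the
    -- other hand `reach` gives at most 12 + 5, as at most 12 vertices have degree above 4, and
    -- `y u` is at most 1.
    no-f none = <⇒≱ (20 ≤! 20) (+-cancelʳ-≤ 1 20 19 (begin
      21                                            ≤⟨ +-monoˡ-≤ 1 (≤-trans (≤-reflexive (cong (_* 4) (sym du))) (≤-trans (≤-reflexive (sym (nsum-const 4 u vs))) lower)) ⟩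
      nsum (λ w → y w + 3 * t w) u vs + 1           ≡⟨ cong (_+ 1) (≡.trans (nsum-+ y (λ w → 3 * t w) u vs) (cong (nsum y u vs +_) triple)) ⟩
      nsum y u vs + 3 * y u + 1                     ≡⟨ solve 2 (λ n x → n :+ con 3 :* x :+ con 1 := (n :+ x :+ con 1) :+ con 2 :* x) refl (nsum y u vs) (y u) ⟩
      (nsum y u vs + y u + 1) + 2 * y u             ≤⟨ +-mono-≤ reached (*-monoʳ-≤ 2 yu) ⟩
      17 + 2                                        ≤⟨ 19 ≤! 20 ⟩
      20 ∎))
      where
      open ≤-Reasoning
      tu : t u ≡ 1
      tu rewrite du = refl
      triple : nsum (λ w → 3 * t w) u vs ≡ 3 * y u
      triple = ≡.trans (∑-cong vs λ {w} _ → solve 2 (λ x z → x :* (con 3 :* z) := con 3 :* (x :* z)) refl ⟦ a u w ⟧ (t w))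
                       (∑-*ˡ 3 (λ w → ⟦ a u w ⟧ * t w) vs)
      yu : y u ≤ 1
      yu = +-cancelˡ-≤ 4 (y u) 1 (≤-trans (+-mono-≤ le (≤-reflexive (sym (nbrs-nsum T′ u vs))))
        (≤-reflexive (≡.trans (nbrs-+ F T′ u vs (λ {w} _ → f+t w)) du)))
      #t : ∑ t vs ≤ 12
      #t = +-cancelˡ-≤ 96 _ _ (begin
        96 + ∑ t vs                          ≡⟨ cong (_+ ∑ t vs) (≡.trans (cong (_* 4) (sym len)) (sym (∑-const 4 vs))) ⟩
        ∑ (const 4) vs + ∑ t vs              ≡⟨ ∑-+ (const 4) t vs ⟨
        ∑ (λ w → 4 + t w) vs                 ≤⟨ ∑-mono vs pt ⟩
        ∑ (λ w → degIn w vs) vs                ≡⟨ ≡.trans (degree-sum vs) (cong (2 *_) e) ⟩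
        108 ∎)
        where
        pt : ∀ {w} → w ∈ vs → 4 + t w ≤ degIn w vs
        pt {w} w∈ with F w in h
        ... | true  = ≤-reflexive (sym (degF h))
        ... | false = ≤∧≢⇒< (≥δ w∈) (≡ᵇ-false h ∘ sym)
      reached : nsum y u vs + y u + 1 ≤ 17
      reached = ≤-trans (≤-reflexive (cong (nsum y u vs + y u +_) (sym tu)))
        (≤-trans (reach t un u∈) (+-mono-≤ #t (≤-reflexive (cong₂ _*_ du tu))))
      lower : nsum (const 4) u vs ≤ nsum (λ w → y w + 3 * t w) u vs
      lower = nsum-mono u vs pt
        where
        pt : ∀ {w} → w ∈ vs → a u w ≡ true → 4 ≤ y w + 3 * t w
        pt {w} w∈ uw with nn ← none w∈ rewrite uw with F w in h
        ... | true  = ≤-reflexive (sym (≡.trans (+-identityʳ (y w)) (≡.trans (sym (nbrs-nsum T′ w vs))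
                (≡.trans (cong (_+ nbrs T′ w vs) (sym (n<1⇒n≡0 (≤ᵇ-false 1 _ nn))))
                  (≡.trans (nbrs-+ F T′ w vs (λ {v} _ → f+t v)) (degF h))))))
        ... | false = +-monoˡ-≤ 3 (≤-trans (count-∈ (λ v → a w v ∧ T′ v) u∈ (cong₂ _∧_ (sym-true uw) Tu))
                                          (≤-reflexive (nbrs-nsum T′ w vs)))
          where
          Tu : T′ u ≡ true
          Tu rewrite du = refl
    with-f : ∀ {w f} → w ∈ vs → a u w ≡ true → F w ≡ true → f ∈ vs → a w f ≡ true → F f ≡ true → ⊥
    with-f {w} {f} w∈ uw Fw f∈ wf Ff = case remove un w∈ of λ where
        (us , p , un′ , _ , _) →
          case pick q us (s≤s⁻¹ (subst (4 ≤_) (≡.trans (∑-↭ _ p)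
                 (cong (λ b → ⟦ b ⟧ + count q us) (cong₂ _∧_ uw Fw))) le)) of λ where
            (x , xs , px , hx , le₁) → case pick q xs le₁ of λ where
              (y , ys , py , hy , le₂) → case pick q ys le₂ of λ where
                (z , zs , pz , hz , _) →
                  let r = ↭-trans p (prep w (↭-trans px (prep x (↭-trans py (prep y pz)))))
                      ux , Fx = ∧-split (a u x) hx ; uy , Fy = ∧-split (a u y) hy ; uz , Fz = ∧-split (a u z) hz in
                  four-nbrs r (ux , Fx) (uy , Fy) (uz , Fz)
      where
      q : V → Bool
      q v = a u v ∧ F v
      four-nbrs : ∀ {x y z zs} → vs ↭ w ∷ x ∷ y ∷ z ∷ zs → a u x ≡ true × F x ≡ true →
                  a u y ≡ true × F y ≡ true → a u z ≡ true × F z ≡ true → ⊥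
      four-nbrs {x} {y} {z} r (ux , Fx) (uy , Fy) (uz , Fz) with Unique-↭ r un
      ... | (w≢x ∷ w≢y ∷ w≢z ∷ _) ∷ (x≢y ∷ x≢z ∷ _) ∷ (y≢z ∷ _) ∷ _ =
        case extract (u ∷ w ∷ f ∷ x ∷ y ∷ z ∷ [])
          (u∈ ∷ w∈ ∷ f∈ ∷ in-r (there (here refl)) ∷ in-r (there (there (here refl))) ∷
           in-r (there (there (there (here refl)))) ∷ [])
          ((adj-≢ uw ∷ u≢f ∷ adj-≢ ux ∷ adj-≢ uy ∷ adj-≢ uz ∷ []) ∷
           (adj-≢ wf ∷ w≢x ∷ w≢y ∷ w≢z ∷ []) ∷ (f≢ wx ∷ f≢ wy ∷ f≢ wz ∷ []) ∷
           (x≢y ∷ x≢z ∷ []) ∷ (y≢z ∷ []) ∷ [] ∷ []) of λ where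
          (us , p) →
            let du′ = rest-deg u (u ∷ []) (false ∷ []) p refl (a-irrefl u , tt) du
                dw = rest-deg w (u ∷ w ∷ []) (true ∷ false ∷ []) p refl (sym-true uw , a-irrefl w , tt) (degF Fw)
                df = rest-deg f (u ∷ w ∷ f ∷ []) (false ∷ true ∷ false ∷ []) p refl
                       (sym-true uf , sym-true wf , a-irrefl f , tt) (degF Ff)
                dx = rest-deg x (u ∷ w ∷ f ∷ x ∷ []) (true ∷ false ∷ false ∷ false ∷ []) p refl
                       (sym-true ux , sym-true wx , sym-true (f-no ux w≢x) , a-irrefl x , tt) (degF Fx)
                dy = rest-deg y (u ∷ w ∷ f ∷ x ∷ y ∷ []) (true ∷ false ∷ false ∷ false ∷ false ∷ []) p refl
                       (sym-true uy , sym-true wy , sym-true (f-no uy w≢y) , sym-true xy , a-irrefl y , tt) (degF Fy)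
                dz = rest-deg z (u ∷ w ∷ f ∷ x ∷ y ∷ z ∷ []) (true ∷ false ∷ false ∷ false ∷ false ∷ false ∷ []) p refl
                       (sym-true uz , sym-true wz , sym-true (f-no uz w≢z) , sym-true xz , sym-true yz , a-irrefl z , tt)
                       (degF Fz) in
            attach-dead {S = u ∷ w ∷ f ∷ x ∷ y ∷ z ∷ []} known18 dead24 un p
              (add z tt dz (add y (yz , tt) dy (add x (xy , xz , tt) dx
                (add f (f-no ux w≢x , f-no uy w≢y , f-no uz w≢z , tt) df
                  (add w (wf , wx , wy , wz , tt) dw
                    (add u (uw , uf , ux , uy , uz , tt) du′ done))))))
              (perm-length (u ∷ w ∷ f ∷ x ∷ y ∷ z ∷ []) p len)
              (rest-edges (u ∷ w ∷ f ∷ x ∷ y ∷ z ∷ []) us p (cong₂ _+_ du′ (cong₂ _+_ dw (cong₂ _+_ df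
                (cong₂ _+_ dx (cong₂ _+_ dy (cong₂ _+_ dz refl)))))) e)
        where
        in-r : ∀ {v} → v ∈ w ∷ x ∷ y ∷ z ∷ _ → v ∈ vs
        in-r = ∈-resp-↭ (↭-sym r)
        wx = no3-false uw ux
        wy = no3-false uw uy
        wz = no3-false uw uz
        xy = no3-false ux uy
        xz = no3-false ux uz
        yz = no3-false uy uz
        uf : a u f ≡ false
        uf = no3-false (sym-true uw) wf
        u≢f : u ≢ f
        u≢f refl = case ≡.trans (sym du) (degF Ff) of λ ()
        f≢ : ∀ {v} → a w v ≡ false → f ≢ v
        f≢ wv refl = true≢false wf wv
        f-no : ∀ {v} → a u v ≡ true → w ≢ v → a f v ≡ false
        f-no uv w≢v = no4-false (sym-true wf) (sym-true uw) uv (u≢f ∘ sym) w≢v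

  -- Graphs with 25 vertices and 57 edges

  -- Turns a double count without slack into information about each single vertex.
  ∑-tight : ∀ {f g : V → ℕ} xs → (∀ {x} → x ∈ xs → f x ≤ g x) → ∑ g xs ≤ ∑ f xs →
            ∀ {x} → x ∈ xs → f x ≡ g x
  ∑-tight {f} {g} (x ∷ xs) h le (here refl) = ≤-antisym (h (here refl))
    (+-cancelʳ-≤ (∑ g xs) (g x) (f x) (≤-trans le (+-monoʳ-≤ (f x) (∑-mono xs (h ∘ there)))))
  ∑-tight {f} {g} (x ∷ xs) h le (there x∈) = ∑-tight xs (h ∘ there)
    (+-cancelˡ-≤ (g x) _ _ (≤-trans le (+-monoˡ-≤ (∑ f xs) (h (here refl))))) x∈

  not-true : ∀ {b} → not b ≡ true → b ≡ false
  not-true {false} _ = refl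

  module Order25 (vs : List V) (un : Unique vs) (len : length vs ≡ 25) (e : E vs ≡ 57) where

    open ≤-Reasoning

    D : V → ℕ
    D u = degIn u vs

    D-has : ∀ {d u} → has d vs u ≡ true → D u ≡ d
    D-has = has-deg {vs = vs}

    ∑D : ∑ D vs ≡ 114
    ∑D = ≡.trans (degree-sum vs) (cong (2 *_) e)

    3≤D : ∀ {u} → u ∈ vs → 3 ≤ D u
    3≤D u∈ = subst (λ k → k ∸ 54 ≤ _) e (degree-≥ bound24 un len u∈)

    -- Deleting both vertices leaves at most 50 of the 57 edges, and an edge between them is counted
    -- in both degrees.
    D-pair : ∀ {x y} → x ∈ vs → y ∈ vs → x ≢ y → 7 + ⟦ a x y ⟧ ≤ D x + D y
    D-pair {x} {y} x∈ y∈ x≢y = case extract (x ∷ y ∷ []) (x∈ ∷ y∈ ∷ []) ((x≢y ∷ []) ∷ [] ∷ []) of λ where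
      (us , p) →
        let le = bound23 us (Unique-drop (x ∷ y ∷ []) (Unique-↭ p un)) (perm-length (x ∷ y ∷ []) p len)
            Dx = ≡.trans (deg-↭ x p) (deg-self x (y ∷ us))
            Dy = ≡.trans (deg-↭ y p) (cong₂ _+_ (cong ⟦_⟧ (a-sym y x)) (deg-self y us)) in
          +-cancelʳ-≤ 50 _ _ (begin
          7 + ⟦ a x y ⟧ + 50                               ≡⟨ solve 1 (λ b → con 7 :+ b :+ con 50 := b :+ con 57) refl ⟦ a x y ⟧ ⟩
          ⟦ a x y ⟧ + 57                                   ≡⟨ cong (⟦ a x y ⟧ +_) (≡.trans (sym e) (E-↭ p)) ⟩
          ⟦ a x y ⟧ + (degIn x (y ∷ us) + (degIn y us + E us)) ≤⟨ +-monoʳ-≤ ⟦ a x y ⟧ (+-monoʳ-≤ (degIn x (y ∷ us)) (+-monoʳ-≤ (degIn y us) le)) ⟩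
          ⟦ a x y ⟧ + (degIn x (y ∷ us) + (degIn y us + 50))   ≡⟨ solve 3 (λ b m n → b :+ (m :+ (n :+ con 50)) := m :+ (b :+ n) :+ con 50) refl ⟦ a x y ⟧ (degIn x (y ∷ us)) (degIn y us) ⟩
          degIn x (y ∷ us) + (⟦ a x y ⟧ + degIn y us) + 50     ≡⟨ cong (_+ 50) (cong₂ _+_ Dx Dy) ⟨
          D x + D y + 50                                   ∎)

    low : ∃[ v ] v ∈ vs × D v ≤ 4
    low with search (λ v → D v ≤ᵇ 4) vs
    ... | inj₁ (v , v∈ , h) = v , v∈ , ≤ᵇ-true (D v) 4 h
    ... | inj₂ none = ⊥-elim (<⇒≱ (115 ≤! 125) (subst₂ _≤_ (≡.trans (∑-const 5 vs) (cong (_* 5) len)) ∑D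
                        (∑-mono vs λ {u} u∈ → ≤ᵇ-false (D u) 4 (none u∈))))

    high : ∃[ v ] v ∈ vs × 5 ≤ D v
    high with search (λ v → 5 ≤ᵇ D v) vs
    ... | inj₁ (v , v∈ , h) = v , v∈ , ≤ᵇ-true 5 (D v) h
    ... | inj₂ none = ⊥-elim (<⇒≱ (101 ≤! 114) (subst₂ _≤_ ∑D (≡.trans (∑-const 4 vs) (cong (_* 4) len))
                        (∑-mono vs λ {u} u∈ → s≤s⁻¹ (≤ᵇ-false 5 (D u) (none u∈)))))

    nsumD : ∀ {u} → u ∈ vs → nsum D u vs ≤ 24
    nsumD u∈ = s≤s⁻¹ (subst (suc (nsum D _ vs) ≤_) len (moore un u∈))

    D≤6 : (∀ {u} → u ∈ vs → 4 ≤ D u) → ∀ {u} → u ∈ vs → D u ≤ 6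
    D≤6 ≥δ {u} u∈ = *-cancelʳ-≤ (D u) 6 4 (≤-trans (≤-trans (≤-reflexive (sym (nsum-const 4 u vs)))
      (nsum-mono u vs (λ w∈ _ → ≥δ w∈))) (nsumD u∈))

    module Degree3 {v} (v∈ : v ∈ vs) (Dv : D v ≡ 3) where

      others : ∀ {u} → u ∈ vs → v ≢ u → 4 + ⟦ a v u ⟧ ≤ D u
      others {u} u∈ v≢u = +-cancelˡ-≤ 3 _ _ (≤-trans (D-pair v∈ u∈ v≢u) (≤-reflexive (cong (_+ D u) Dv)))

      -- The neighbours of `v` have degree at least 5 by `D-pair`, so they can afford the loss of
      -- `v`.
      rest-≥4 : ∀ {us} → vs ↭ v ∷ us → All (v ≢_) us → ∀ {w} → w ∈ us → 4 ≤ degIn w us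
      rest-≥4 {us} p v∉ {w} w∈ = +-cancelˡ-≤ ⟦ a v w ⟧ 4 _ (≤-trans (≤-reflexive (+-comm ⟦ a v w ⟧ 4))
        (≤-trans (others (∈-resp-↭ (↭-sym p) (there w∈)) (All.lookup v∉ w∈))
          (≤-reflexive (≡.trans (deg-↭ w p) (cong (λ b → ⟦ b ⟧ + degIn w us) (a-sym w v))))))

      only : ∀ {u w} → u ∈ vs → w ∈ vs → has 3 vs u ≡ true → has 3 vs w ≡ true → u ≢ w → ⊥
      only u∈ w∈ hu hw u≢w = <⇒≱ (7 ≤! 7) (≤-trans (≤-trans (m≤m+n 7 _) (D-pair u∈ w∈ u≢w))
        (≤-reflexive (cong₂ _+_ (D-has hu) (D-has hw))))

      threes : ∀ u → nbrs (has 3 vs) u vs ≤ 1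
      threes u = count-≤1 (λ w → a u w ∧ has 3 vs w) un λ {w} {w′} w∈ w′∈ h h′ →
        only w∈ w′∈ (proj₂ (∧-split (a u w) h)) (proj₂ (∧-split (a u w′) h′))

      D≤6′ : ∀ {u} → u ∈ vs → D u ≤ 6
      D≤6′ {u} u∈ = s≤s⁻¹ (*-cancelʳ-< 4 (D u) 7 (≤-<-trans (≤-trans (low-nbrs 3 u 3≤D)
        (+-mono-≤ (nsumD u∈) (threes u))) (26 ≤! 28)))

      -- Deleting `v` leaves 54 edges on 24 vertices, with all degrees at least 4. If `u` is not
      -- adjacent to `v`, it keeps six neighbours of degree sum at least 24, too much for `moore`.
      -- Otherwise it keeps five; `v` uses 3 of their allowance of 24, and a degree sum of at most
      -- 21 makes four of them have degree 4, against `few-low-nbrs`.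
      no6 : ∀ {u} → u ∈ vs → D u ≡ 6 → ⊥
      no6 {u} u∈ Du = case remove un v∈ of λ where
          (us , p , un′@(v∉ ∷ unus) , d , ev) → inside p v∉ unus d
        where
        u≢v : v ≢ u
        u≢v refl = case ≡.trans (sym Dv) Du of λ ()
        inside : ∀ {us} → vs ↭ v ∷ us → All (v ≢_) us → Unique us → degIn v vs ≡ degIn v us → ⊥
        inside {us} p v∉ unus d with a u v in uv
        ... | false = <⇒≱ (24 ≤! 24) (≤-trans
                (≤-trans (≤-reflexive (sym (≡.trans (nsum-const 4 u us) (cong (_* 4) du))))
                         (nsum-mono u us (λ w∈ _ → rest-≥4 p v∉ w∈)))
                (s≤s⁻¹ (subst (suc (nsum (λ w → degIn w us) u us) ≤_) lenus (moore unus u∈us))))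
          where
          u∈us = ∈-tail p u∈ u≢v
          lenus = perm-length (v ∷ []) p len
          du : degIn u us ≡ 6
          du = rest-deg u (v ∷ []) (false ∷ []) p refl (uv , tt) Du
        ... | true = few-low-nbrs us unus lenus
                (rest-edges (v ∷ []) us p (≡.trans (+-identityʳ _) (≡.trans (sym d) Dv)) e) u∈us du four
          where
          u∈us = ∈-tail p u∈ u≢v
          lenus = perm-length (v ∷ []) p len
          du : degIn u us ≡ 5
          du = rest-deg u (v ∷ []) (true ∷ []) p refl (uv , tt) Du
          same : ∀ {w} → w ∈ us → a u w ≡ true → degIn w us ≡ D w
          same {w} w∈ uw = sym (≡.trans (deg-↭ w p) (cong (λ b → ⟦ b ⟧ + degIn w us) (no3-false uw uv)))
          four : 4 ≤ nbrs (has 4 us) u us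
          four = +-cancelˡ-≤ 21 4 _ (begin
            25                                              ≡⟨ cong (_* 5) du ⟨
            degIn u us * 5                                    ≤⟨ low-nbrs 4 u (rest-≥4 p v∉) ⟩
            nsum (λ w → degIn w us) u us + nbrs (has 4 us) u us ≤⟨ +-monoˡ-≤ _ sum≤ ⟩
            21 + nbrs (has 4 us) u us                       ∎)
            where
            sum≤ : nsum (λ w → degIn w us) u us ≤ 21
            sum≤ = +-cancelˡ-≤ 3 _ _ (begin
              3 + nsum (λ w → degIn w us) u us                 ≡⟨ cong (_+ nsum (λ w → degIn w us) u us) (sym Dv) ⟩
              D v + nsum (λ w → degIn w us) u us               ≤⟨ +-monoʳ-≤ (D v) (∑-mono us pt) ⟩
              D v + nsum D u us                              ≡⟨ cong (_+ nsum D u us) (≡.trans (cong (λ b → ⟦ b ⟧ * D v) uv) (+-identityʳ (D v))) ⟨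
              nsum D u (v ∷ us)                              ≡⟨ ∑-↭ (λ w → ⟦ a u w ⟧ * D w) p ⟨
              nsum D u vs                                    ≤⟨ nsumD u∈ ⟩
              24 ∎)
              where
              pt : ∀ {w} → w ∈ us → ⟦ a u w ⟧ * degIn w us ≤ ⟦ a u w ⟧ * D w
              pt {w} w∈ with a u w in uw
              ... | true  = ≤-reflexive (cong (_+ 0) (same w∈ uw))
              ... | false = z≤n

      D≤5 : ∀ {u} → u ∈ vs → D u ≤ 5
      D≤5 u∈ = s≤s⁻¹ (≤∧≢⇒< (D≤6′ u∈) (no6 u∈))

    -- A centre for the entries 4, 4, 4, 3, 3. It asks for degree exactly 5, the maximum degree in
    -- the cases where a star is sought.
    Star : V → Set
    Star p = p ∈ vs × D p ≡ 5 × 3 ≤ nbrs (has 5 vs) p vs × (∀ {w} → w ∈ vs → a p w ≡ true → 4 ≤ D w)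

    -- The vertices of degree 6 have only neighbours of degree 4.  Counting for a vertex
    -- w its z neighbours of degree 6, ∑ z = 6k and ∑ z² ≤ k (k + 5).
    few-six : (∀ {u} → u ∈ vs → 4 ≤ D u) → count (has 6 vs) vs ≤ 2
    few-six ≥δ = small (count (has 6 vs) vs) quadratic k≤7
      where
      S F : V → Bool
      S = has 6 vs
      F = has 4 vs
      s f z : V → ℕ
      s w = ⟦ S w ⟧
      f w = ⟦ F w ⟧
      z w = nsum s w vs
      k = ∑ s vs
      ≤Δ : ∀ {u} → u ∈ vs → D u ≤ 6
      ≤Δ = D≤6 ≥δ
      -- By `low-nbrs`, 6 · 5 is at most 24 plus the number of neighbours of degree 4, so all six
      -- have degree 4.
      nbr4 : ∀ {u w} → u ∈ vs → w ∈ vs → S u ≡ true → a u w ≡ true → F w ≡ true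
      nbr4 {u} {w} u∈ w∈ hu uw = ≡.trans (sym (cong (_∧ F w) uw)) (one (a u w) (∑-tight vs
        (λ {x} _ → subst (_≤ ⟦ a u x ⟧) refl (le (a u x) (F x))) tight w∈) uw)
        where
        le : ∀ b c → ⟦ b ∧ c ⟧ ≤ ⟦ b ⟧
        le true  c = ⟦⟧≤1 c
        le false c = z≤n
        one : ∀ b {c} → ⟦ b ∧ c ⟧ ≡ ⟦ b ⟧ → b ≡ true → b ∧ c ≡ true
        one true {true} _ _ = refl
        tight : degIn u vs ≤ nbrs F u vs
        tight = ≤-trans (≤-reflexive (D-has hu)) (+-cancelˡ-≤ 24 6 _ (≤-trans
          (≤-reflexive (cong (_* 5) (sym (D-has hu)))) (≤-trans (low-nbrs 4 u ≥δ) (+-monoˡ-≤ _ (nsumD u∈)))))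
      n4 : ∑ f vs ≡ 11 + k
      n4 = +-cancelˡ-≡ 114 _ _ (begin-equality
        114 + ∑ f vs            ≡⟨ cong (_+ ∑ f vs) ∑D ⟨
        ∑ D vs + ∑ f vs         ≡⟨ ∑-+ D f vs ⟨
        ∑ (λ w → D w + f w) vs  ≡⟨ ∑-cong vs pt ⟩
        ∑ (λ w → 5 + s w) vs    ≡⟨ ≡.trans (∑-+ (const 5) s vs) (cong (_+ k) (≡.trans (∑-const 5 vs) (cong (_* 5) len))) ⟩
        125 + k                 ∎)
        where
        pt : ∀ {w} → w ∈ vs → D w + f w ≡ 5 + s w
        pt {w} w∈ with degIn w vs | ≥δ w∈ | ≤Δ w∈
        ... | 4 | _ | _ = refl
        ... | 5 | _ | _ = refl
        ... | 6 | _ | _ = refl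
        ... | 0 | () | _
        ... | 1 | s≤s () | _
        ... | 2 | s≤s (s≤s ()) | _
        ... | 3 | s≤s (s≤s (s≤s ())) | _
        ... | suc (suc (suc (suc (suc (suc (suc _)))))) | _ | s≤s (s≤s (s≤s (s≤s (s≤s (s≤s ())))))
      k≤7 : k ≤ 7
      k≤7 = *-cancelˡ-≤ 2 (+-cancelˡ-≤ 11 _ _ (begin
        11 + 2 * k              ≡⟨ solve 1 (λ n → con 11 :+ con 2 :* n := (con 11 :+ n) :+ n) refl k ⟩
        11 + k + k              ≡⟨ cong (_+ k) n4 ⟨
        ∑ f vs + ∑ s vs         ≡⟨ ∑-+ f s vs ⟨
        ∑ (λ w → f w + s w) vs  ≤⟨ ∑-≤-length _ vs (λ {w} _ → pt (degIn w vs)) ⟩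
        length vs               ≡⟨ len ⟩
        25                      ∎))
        where
        pt : ∀ n → ⟦ n ≡ᵇ 4 ⟧ + ⟦ n ≡ᵇ 6 ⟧ ≤ 1
        pt n with n ≡ᵇ 4 in h₄ | n ≡ᵇ 6 in h₆
        ... | false | b     = ⟦⟧≤1 b
        ... | true  | false = ≤-refl
        ... | true  | true  = ⊥-elim (case ≡.trans (sym (≡ᵇ-sound n 4 h₄)) (≡ᵇ-sound n 6 h₆) of λ ())
      ∑z : ∑ z vs ≡ 6 * k
      ∑z = ≡.trans (nsum-swap s vs vs) (≡.trans (∑-cong vs pt) (∑-*ˡ 6 s vs))
        where
        pt : ∀ {u} → u ∈ vs → D u * s u ≡ 6 * s u
        pt {u} _ with S u in h
        ... | true  = cong (_* 1) (D-has h)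
        ... | false = *-zeroʳ (D u)
      ∑z² : ∑ (λ w → z w * z w) vs ≤ (k + 5) * k
      ∑z² = begin
        ∑ (λ w → z w * z w) vs          ≡⟨ nsum-adjoint s z vs ⟨
        ∑ (λ p → s p * nsum z p vs) vs  ≤⟨ ∑-mono vs at ⟩
        ∑ (λ p → (k + 5) * s p) vs      ≡⟨ ∑-*ˡ (k + 5) s vs ⟩
        (k + 5) * k                     ∎
        where
        at : ∀ {p} → p ∈ vs → s p * nsum z p vs ≤ (k + 5) * s p
        at {p} p∈ with r ← reach s un p∈ with S p in h
        ... | false = z≤n
        ... | true rewrite D-has {6} {p} h | +-identityʳ (nsum z p vs) | *-identityʳ (k + 5) =
          +-cancelʳ-≤ 1 _ _ (≤-trans (+-monoˡ-≤ 1 (m≤m+n (nsum z p vs) (z p)))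
            (≤-trans r (≤-reflexive (sym (+-assoc k 5 1)))))
      -- This is (n - 1)(n - 2) ≥ 0.
      3z≤ : ∀ n → 3 * n ≤ n * n + 2
      3z≤ 0 = z≤n
      3z≤ 1 = 3 ≤! 3
      3z≤ 2 = 6 ≤! 6
      3z≤ n@(suc (suc (suc m))) = ≤-trans (*-monoˡ-≤ n (s≤s (s≤s (s≤s (z≤n {m}))))) (m≤m+n (n * n) 2)
      point : ∀ {w} → w ∈ vs → 3 * z w ≤ z w * z w + 2 * f w
      point {w} w∈ with F w in h
      ... | true  = 3z≤ (z w)
      ... | false = subst (λ n → 3 * n ≤ n * n + 0) (sym z0) z≤n
        where
        pt : ∀ {x} → x ∈ vs → ⟦ a w x ⟧ * s x ≡ 0
        pt {x} x∈ with a w x in wx | S x in h′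
        ... | false | _     = refl
        ... | true  | false = refl
        ... | true  | true  = ⊥-elim (true≢false (nbr4 x∈ w∈ h′ (sym-true wx)) h)
        z0 : z w ≡ 0
        z0 = ≡.trans (∑-cong vs pt) (≡.trans (∑-const 0 vs) (*-zeroʳ (length vs)))
      quadratic : 3 * (6 * k) ≤ (k + 5) * k + 2 * (11 + k)
      quadratic = begin
        3 * (6 * k)                               ≡⟨ cong (3 *_) ∑z ⟨
        3 * ∑ z vs                                ≡⟨ ∑-*ˡ 3 z vs ⟨
        ∑ (λ w → 3 * z w) vs                      ≤⟨ ∑-mono vs point ⟩
        ∑ (λ w → z w * z w + 2 * f w) vs          ≡⟨ ≡.trans (∑-+ _ _ vs) (cong (∑ (λ w → z w * z w) vs +_) (∑-*ˡ 2 f vs)) ⟩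
        ∑ (λ w → z w * z w) vs + 2 * ∑ f vs       ≤⟨ +-mono-≤ ∑z² (≤-reflexive (cong (2 *_) n4)) ⟩
        (k + 5) * k + 2 * (11 + k)                ∎
      -- The inequality reads k² - 11k + 22 ≥ 0. It fails for k from 3 to 8 but holds again from 9
      -- on, hence the separate bound by 7.
      small : ∀ k → 3 * (6 * k) ≤ (k + 5) * k + 2 * (11 + k) → k ≤ 7 → k ≤ 2
      small 0 _ _ = z≤n
      small 1 _ _ = 1 ≤! 2
      small 2 _ _ = 2 ≤! 2
      small 3 h _ = ⊥-elim (<⇒≱ (53 ≤! 54) h)
      small 4 h _ = ⊥-elim (<⇒≱ (67 ≤! 72) h)
      small 5 h _ = ⊥-elim (<⇒≱ (83 ≤! 90) h)
      small 6 h _ = ⊥-elim (<⇒≱ (101 ≤! 108) h)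
      small 7 h _ = ⊥-elim (<⇒≱ (121 ≤! 126) h)
      small (suc (suc (suc (suc (suc (suc (suc (suc _)))))))) _ (s≤s (s≤s (s≤s (s≤s (s≤s (s≤s (s≤s ())))))))

  -- The star when all degrees are 4 or 5

  module Stars25 (vs : List V) (un : Unique vs) (len : length vs ≡ 25) (e : E vs ≡ 57) where

    open Order25 vs un len e
    open ≤-Reasoning

    private
      T′ F : V → Bool
      T′ = has 5 vs
      F  = has 4 vs
      t f : V → ℕ
      t w = ⟦ T′ w ⟧
      f w = ⟦ F w ⟧

    4≢5 : ∀ {u w} → T′ u ≡ true → F w ≡ true → u ≢ w
    4≢5 hu hw refl = case ≡.trans (sym (D-has hu)) (D-has hw) of λ ()

    -- Let s₁, n₁, m, n₂, s₂ be a path of vertices of degree 5.  If each of them has at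
    -- least three neighbours of degree 4, those of m, n₁ and n₂ make up nine of the
    -- eleven vertices of degree 4, and both s₁ and s₂ are adjacent to the other two.
    no-path : count F vs ≡ 11 → (∀ {u} → u ∈ vs → T′ u ≡ true → 3 ≤ nbrs F u vs) →
      ∀ {m n₁ n₂ s₁ s₂} → m ∈ vs → n₁ ∈ vs → n₂ ∈ vs → s₁ ∈ vs → s₂ ∈ vs →
      T′ m ≡ true → T′ n₁ ≡ true → T′ n₂ ≡ true → T′ s₁ ≡ true → T′ s₂ ≡ true →
      a m n₁ ≡ true → a m n₂ ≡ true → n₁ ≢ n₂ → a n₁ s₁ ≡ true → a n₂ s₁ ≡ false →
      a n₂ s₂ ≡ true → a n₁ s₂ ≡ false → ⊥
    no-path #F three {m} {n₁} {n₂} {s₁} {s₂} m∈ n₁∈ n₂∈ s₁∈ s₂∈ Tm Tn₁ Tn₂ Ts₁ Ts₂ mn₁ mn₂ n₁≢n₂ n₁s₁ n₂s₁ n₂s₂ n₁s₂ =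
      <⇒≱ (4 ≤! 4) (begin
        4                                                       ≤⟨ +-mono-≤ (two s₁∈ Ts₁ n₁s₁ n₂s₁ mn₁ mn₂ Tn₁ other₁)
                                                                              (two s₂∈ Ts₂ n₂s₂ n₁s₂ mn₂ mn₁ Tn₂ other₂) ⟩
        count (λ w → a s₁ w ∧ z w) vs + count (λ w → a s₂ w ∧ z w) vs ≡⟨ ∑-+ _ _ vs ⟨
        ∑ (λ w → ⟦ a s₁ w ∧ z w ⟧ + ⟦ a s₂ w ∧ z w ⟧) vs        ≤⟨ ∑-mono vs (λ {w} _ → both (a s₁ w) (a s₂ w) (z w)) ⟩
        ∑ (λ w → ⟦ z w ⟧ + ⟦ a s₁ w ∧ a s₂ w ⟧) vs              ≡⟨ ∑-+ _ _ vs ⟩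
        count z vs + count (λ w → a s₁ w ∧ a s₂ w) vs           ≤⟨ +-mono-≤ #z (codegree-≤1 un s₁≢s₂) ⟩
        3 ∎)
      where
      z : V → Bool
      z w = F w ∧ (not (a m w) ∧ (not (a n₁ w) ∧ not (a n₂ w)))
      s₁≢s₂ : s₁ ≢ s₂
      s₁≢s₂ refl = true≢false n₂s₂ n₂s₁
      both : ∀ b c d → ⟦ b ∧ d ⟧ + ⟦ c ∧ d ⟧ ≤ ⟦ d ⟧ + ⟦ b ∧ c ⟧
      both true  true  true  = ≤-refl
      both true  false true  = ≤-refl
      both false true  true  = ≤-refl
      both false false true  = z≤n
      both true  true  false = z≤n
      both true  false false = z≤n
      both false true  false = z≤n
      both false false false = z≤n
      #z : count z vs ≤ 2
      #z = +-cancelˡ-≤ 9 _ _ (begin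
        9 + count z vs
          ≤⟨ +-monoˡ-≤ (count z vs) (+-mono-≤ (+-mono-≤ (three m∈ Tm) (three n₁∈ Tn₁)) (three n₂∈ Tn₂)) ⟩
        nbrs F m vs + nbrs F n₁ vs + nbrs F n₂ vs + count z vs
          ≡⟨ ≡.trans (∑-+ _ (⟦_⟧ ∘ z) vs) (cong (_+ count z vs) (≡.trans (∑-+ _ _ vs) (cong (_+ nbrs F n₂ vs) (∑-+ _ _ vs)))) ⟨
        ∑ (λ w → ⟦ a m w ∧ F w ⟧ + ⟦ a n₁ w ∧ F w ⟧ + ⟦ a n₂ w ∧ F w ⟧ + ⟦ z w ⟧) vs
          ≤⟨ ∑-mono vs point ⟩
        count F vs
          ≡⟨ #F ⟩
        11 ∎)
        where
        point : ∀ {w} → w ∈ vs → ⟦ a m w ∧ F w ⟧ + ⟦ a n₁ w ∧ F w ⟧ + ⟦ a n₂ w ∧ F w ⟧ + ⟦ z w ⟧ ≤ ⟦ F w ⟧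
        point {w} w∈ with F w in Fw | a m w in mw | a n₁ w in n₁w | a n₂ w in n₂w
        ... | true  | true  | true  | _     = ⊥-elim (no3 mn₁ n₁w (sym-true mw))
        ... | true  | true  | false | true  = ⊥-elim (no3 mn₂ n₂w (sym-true mw))
        ... | true  | true  | false | false = ≤-refl
        ... | true  | false | true  | true  = ⊥-elim (no4 (sym-true mn₁) mn₂ n₂w (sym-true n₁w) n₁≢n₂ (4≢5 Tm Fw))
        ... | true  | false | true  | false = ≤-refl
        ... | true  | false | false | true  = ≤-refl
        ... | true  | false | false | false = ≤-refl
        ... | false | true  | true  | true  = z≤n
        ... | false | true  | true  | false = z≤n
        ... | false | true  | false | true  = z≤n
        ... | false | true  | false | false = z≤n
        ... | false | false | true  | true  = z≤n
        ... | false | false | true  | false = z≤n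
        ... | false | false | false | true  = z≤n
        ... | false | false | false | false = z≤n
      Other : V → V → Set
      Other n n′ = ∀ {w} → a m w ≡ false → a n w ≡ false → a n′ w ≡ false → F w ≡ true → z w ≡ true
      other₁ : Other n₁ n₂
      other₁ p q r Fw rewrite p | q | r | Fw = refl
      other₂ : Other n₂ n₁
      other₂ p q r Fw rewrite p | q | r | Fw = refl
      -- Of the three or more neighbours of `s` of degree 4, none is adjacent to `n` (a triangle) or
      -- to `m` (a 4-cycle through `n`), and at most one is adjacent to `n′`.
      two : ∀ {s n n′} → s ∈ vs → T′ s ≡ true → a n s ≡ true → a n′ s ≡ false → a m n ≡ true → a m n′ ≡ true →
            T′ n ≡ true → Other n n′ → 2 ≤ count (λ w → a s w ∧ z w) vs
      two {s} {n} {n′} s∈ Ts ns n′s mn mn′ Tn other = +-cancelʳ-≤ 1 2 _ (begin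
        3                                                                    ≤⟨ three s∈ Ts ⟩
        nbrs F s vs                                                          ≤⟨ ∑-mono vs point ⟩
        ∑ (λ w → ⟦ a s w ∧ z w ⟧ + ⟦ a s w ∧ a n′ w ⟧) vs                    ≡⟨ ∑-+ _ _ vs ⟩
        count (λ w → a s w ∧ z w) vs + count (λ w → a s w ∧ a n′ w) vs       ≤⟨ +-monoʳ-≤ _ (codegree-≤1 un s≢n′) ⟩
        count (λ w → a s w ∧ z w) vs + 1                                     ∎)
        where
        s≢n′ : s ≢ n′
        s≢n′ refl = true≢false ns (no3-false mn mn′)
        s≢m : s ≢ m
        s≢m refl = true≢false (sym-true mn′) n′s
        point : ∀ {w} → w ∈ vs → ⟦ a s w ∧ F w ⟧ ≤ ⟦ a s w ∧ z w ⟧ + ⟦ a s w ∧ a n′ w ⟧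
        point {w} w∈ with a s w in sw | F w in Fw | a n′ w in n′w
        ... | false | _     | _     = z≤n
        ... | true  | false | _     = z≤n
        ... | true  | true  | true  = m≤n+m 1 _
        ... | true  | true  | false = ≤-trans (≤-reflexive (cong ⟦_⟧ (sym zw))) (m≤m+n _ 0)
          where
          zw : true ∧ (not (a m w) ∧ (not (a n₁ w) ∧ not (a n₂ w))) ≡ true
          zw = subst (λ b → b ∧ (not (a m w) ∧ (not (a n₁ w) ∧ not (a n₂ w))) ≡ true) Fw
            (other (no4-false mn ns sw (s≢m ∘ sym) (4≢5 Tn Fw))
                   (no3-false (sym-true ns) sw) n′w Fw)

    -- Otherwise each of the 14 vertices of degree 5 has at most two neighbours of degree 5; let `d`
    -- be the deficit to two. These vertices send 42 edges plus the total deficit to the 11 vertices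
    -- of degree 4, which take at most 44, so the total deficit is at most 2. At most 4 vertices of
    -- degree 5 have a deficit or a neighbour with one. Any other of them is the middle of a path
    -- excluded by `no-path`.
    star45 : (∀ {u} → u ∈ vs → 4 ≤ D u) → (∀ {u} → u ∈ vs → D u ≤ 5) → ∃[ p ] Star p
    star45 ≥δ ≤Δ = case search (λ p → T′ p ∧ (3 ≤ᵇ nbrs T′ p vs)) vs of λ where
        (inj₁ (p , p∈ , h)) → let h₁ , h₂ = ∧-split (T′ p) h in
          p , p∈ , D-has h₁ , ≤ᵇ-true 3 (nbrs T′ p vs) h₂ , (λ {w} w∈ _ → ≥δ w∈)
        (inj₂ none) → ⊥-elim (contradiction none)
      where
      x : V → ℕ
      x w = nsum t w vs
      D45 : ∀ {w} → w ∈ vs → f w + t w ≡ 1 × D w + f w ≡ 5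
      D45 {w} w∈ with degIn w vs | ≥δ w∈ | ≤Δ w∈
      ... | 4 | _ | _ = refl , refl
      ... | 5 | _ | _ = refl , refl
      ... | 0 | () | _
      ... | 1 | s≤s () | _
      ... | 2 | s≤s (s≤s ()) | _
      ... | 3 | s≤s (s≤s (s≤s ())) | _
      ... | suc (suc (suc (suc (suc (suc _))))) | _ | s≤s (s≤s (s≤s (s≤s (s≤s ()))))
      #f : ∑ f vs ≡ 11
      #f = +-cancelˡ-≡ 114 (∑ f vs) 11 (begin-equality
        114 + ∑ f vs            ≡⟨ cong (_+ ∑ f vs) ∑D ⟨
        ∑ D vs + ∑ f vs         ≡⟨ ∑-+ D f vs ⟨
        ∑ (λ w → D w + f w) vs  ≡⟨ ∑-cong vs (λ w∈ → proj₂ (D45 w∈)) ⟩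
        ∑ (const 5) vs          ≡⟨ ≡.trans (∑-const 5 vs) (cong (_* 5) len) ⟩
        125                     ∎)
      #t : ∑ t vs ≡ 14
      #t = +-cancelˡ-≡ 11 (∑ t vs) 14 (begin-equality
        11 + ∑ t vs             ≡⟨ cong (_+ ∑ t vs) #f ⟨
        ∑ f vs + ∑ t vs         ≡⟨ ∑-+ f t vs ⟨
        ∑ (λ w → f w + t w) vs  ≡⟨ ∑-cong vs (λ w∈ → proj₁ (D45 w∈)) ⟩
        ∑ (const 1) vs          ≡⟨ ≡.trans (∑-const 1 vs) (cong (_* 1) len) ⟩
        25                      ∎)
      contradiction : (∀ {p} → p ∈ vs → T′ p ∧ (3 ≤ᵇ nbrs T′ p vs) ≡ false) → ⊥
      contradiction none = case search (λ m → T′ m ∧ (d m + nsum d m vs ≡ᵇ 0)) vs of λ where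
          (inj₁ (m , m∈ , h)) → let h₁ , h₂ = ∧-split (T′ m) h in at m∈ h₁ (≡ᵇ-sound (d m + nsum d m vs) 0 h₂)
          (inj₂ none′) → <⇒≱ (5 ≤! 14) (many none′)
        where
        x≤2 : ∀ {p} → p ∈ vs → T′ p ≡ true → x p ≤ 2
        x≤2 {p} p∈ Tp with nn ← none p∈ rewrite Tp =
          ≤-trans (≤-reflexive (sym (nbrs-nsum T′ p vs))) (s≤s⁻¹ (≤ᵇ-false 3 (nbrs T′ p vs) nn))
        d : V → ℕ
        d p = t p * (2 ∸ x p)
        f+x : ∀ w → nsum f w vs + x w ≡ D w
        f+x w = ≡.trans (sym (nsum-+ f t w vs)) (∑-cong vs λ {u} u∈ → ≡.trans (cong (⟦ a w u ⟧ *_) (proj₁ (D45 u∈))) (*-identityʳ _))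
        ∑d : ∑ d vs ≤ 2
        ∑d = +-cancelʳ-≤ 70 _ _ (begin
          ∑ d vs + 70
            ≡⟨ cong (∑ d vs +_) (≡.trans (cong (5 *_) (sym #t)) (≡.trans (sym (∑-*ˡ 5 t vs)) (≡.trans (∑-cong vs five) (∑-+ _ _ vs)))) ⟩
          ∑ d vs + (∑ (λ p → t p * nsum f p vs) vs + ∑ (λ p → t p * x p) vs)
            ≡⟨ solve 3 (λ m n k → m :+ (n :+ k) := n :+ (m :+ k)) refl
                 (∑ d vs) (∑ (λ p → t p * nsum f p vs) vs) (∑ (λ p → t p * x p) vs) ⟩
          ∑ (λ p → t p * nsum f p vs) vs + (∑ d vs + ∑ (λ p → t p * x p) vs)
            ≡⟨ cong₂ _+_ (nsum-adjoint t f vs) (≡.trans (sym (∑-+ _ _ vs)) (≡.trans (∑-cong vs deficit) (≡.trans (∑-*ˡ 2 t vs) (cong (2 *_) #t)))) ⟩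
          ∑ (λ w → f w * x w) vs + 28
            ≤⟨ +-monoˡ-≤ 28 (≤-trans (∑-mono vs four) (≤-reflexive (≡.trans (∑-*ˡ 4 f vs) (cong (4 *_) #f)))) ⟩
          72 ∎)
          where
          five : ∀ {p} → p ∈ vs → 5 * t p ≡ t p * nsum f p vs + t p * x p
          five {p} _ with T′ p in h
          ... | false = refl
          ... | true  = ≡.trans (sym (D-has h)) (≡.trans (sym (f+x p)) (cong₂ _+_ (sym (+-identityʳ (nsum f p vs))) (sym (+-identityʳ (x p)))))
          deficit : ∀ {p} → p ∈ vs → d p + t p * x p ≡ 2 * t p
          deficit {p} p∈ with le ← x≤2 p∈ with T′ p
          ... | false = refl
          ... | true  = ≡.trans (cong₂ _+_ (+-identityʳ (2 ∸ x p)) (+-identityʳ (x p))) (m∸n+n≡m (le refl))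
          four : ∀ {w} → w ∈ vs → f w * x w ≤ 4 * f w
          four {w} _ with F w in h
          ... | false = z≤n
          ... | true  = ≤-trans (≤-reflexive (+-identityʳ (x w))) (≤-trans (m≤n+m (x w) (nsum f w vs)) (≤-reflexive (≡.trans (f+x w) (D-has h))))
        many : (∀ {m} → m ∈ vs → T′ m ∧ (d m + nsum d m vs ≡ᵇ 0) ≡ false) → 14 ≤ 4
        many none′ = begin
          14                                                       ≡⟨ #t ⟨
          ∑ t vs                                                   ≤⟨ ∑-mono vs point ⟩
          ∑ (λ p → d p + t p * nsum d p vs) vs                     ≡⟨ ∑-+ _ _ vs ⟩
          ∑ d vs + ∑ (λ p → t p * nsum d p vs) vs                  ≡⟨ cong (∑ d vs +_) (nsum-adjoint t d vs) ⟩
          ∑ d vs + ∑ (λ w → d w * x w) vs                          ≤⟨ +-mono-≤ ∑d (≤-trans (∑-mono vs (λ {w} w∈ → dx w∈)) ∑d) ⟩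
          4                                                        ∎
          where
          point : ∀ {p} → p ∈ vs → t p ≤ d p + t p * nsum d p vs
          point {p} p∈ with nn ← none′ p∈ with T′ p
          ... | false = z≤n
          ... | true  = ≤-trans (n≢0⇒n>0 (≡ᵇ-false nn)) (+-monoʳ-≤ (2 ∸ x p + 0) (≤-reflexive (sym (+-identityʳ (nsum d p vs)))))
          -- Where the deficit is positive, `x w` is at most 1.
          dx : ∀ {w} → w ∈ vs → d w * x w ≤ d w
          dx {w} w∈ with le ← x≤2 w∈ with T′ w
          ... | false = z≤n
          ... | true  = go (x w) (le refl)
            where
            go : ∀ n → n ≤ 2 → (2 ∸ n + 0) * n ≤ 2 ∸ n + 0
            go 0 _ = z≤n
            go 1 _ = ≤-refl
            go 2 _ = z≤n
            go (suc (suc (suc _))) (s≤s (s≤s ()))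
        three : ∀ {u} → u ∈ vs → T′ u ≡ true → 3 ≤ nbrs F u vs
        three {u} u∈ Tu = +-cancelʳ-≤ 2 3 _ (begin
          5                    ≡⟨ ≡.trans (sym (D-has Tu)) (sym (f+x u)) ⟩
          nsum f u vs + x u    ≤⟨ +-mono-≤ (≤-reflexive (sym (nbrs-nsum F u vs))) (x≤2 u∈ Tu) ⟩
          nbrs F u vs + 2      ∎)
        two : ∀ {u} → T′ u ≡ true → d u ≡ 0 → 2 ≤ nbrs T′ u vs
        two {u} Tu d0 rewrite Tu = ≤-trans (m∸n≡0⇒m≤n (≡.trans (sym (+-identityʳ (2 ∸ x u))) d0))
                                           (≤-reflexive (sym (nbrs-nsum T′ u vs)))
        at : ∀ {m} → m ∈ vs → T′ m ≡ true → d m + nsum d m vs ≡ 0 → ⊥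
        at {m} m∈ Tm h = case nbr-pick₂ T′ m∈ un (two Tm (m+n≡0⇒m≡0 (d m) h)) of λ where
            (n₁ , n₂ , us , p , (mn₁ , Tn₁) , (mn₂ , Tn₂)) →
              let n₁∈ = ∈-resp-↭ (↭-sym p) (here refl) ; n₂∈ = ∈-resp-↭ (↭-sym p) (there (here refl))
                  n₁≢n₂ = case Unique-↭ p un of λ { ((n₁≢n₂ ∷ _) ∷ _) → n₁≢n₂ } in
              case away n₁∈ mn₁ Tn₁ n₁≢n₂ of λ where
                (s₁ , s₁∈ , n₁s₁ , Ts₁ , n₂s₁) → case away n₂∈ mn₂ Tn₂ (n₁≢n₂ ∘ sym) of λ where
                  (s₂ , s₂∈ , n₂s₂ , Ts₂ , n₁s₂) →
                    no-path #f three m∈ n₁∈ n₂∈ s₁∈ s₂∈ Tm Tn₁ Tn₂ Ts₁ Ts₂ mn₁ mn₂ n₁≢n₂ n₁s₁ n₂s₁ n₂s₂ n₁s₂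
          where
          zero-nbr : ∀ {n} → n ∈ vs → a m n ≡ true → d n ≡ 0
          zero-nbr {n} n∈ mn = n≤0⇒n≡0 (≤-trans (≤-reflexive (sym (≡.trans (cong (λ b → ⟦ b ⟧ * d n) mn) (+-identityʳ (d n)))))
            (≤-trans (member n∈) (≤-reflexive (m+n≡0⇒n≡0 (d m) h))))
            where
            member : ∀ {xs n} → n ∈ xs → ⟦ a m n ⟧ * d n ≤ nsum d m xs
            member (here refl) = m≤m+n _ _
            member (there n∈)  = ≤-trans (member n∈) (m≤n+m _ _)
          -- `n` has two neighbours of degree 5 but shares at most one neighbour with `n′`.
          away : ∀ {n n′} → n ∈ vs → a m n ≡ true → T′ n ≡ true → n ≢ n′ →
                 ∃[ s ] s ∈ vs × a n s ≡ true × T′ s ≡ true × a n′ s ≡ false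
          away {n} {n′} n∈ mn Tn n≢n′ =
            case count-< (λ w → a n w ∧ T′ w) (λ w → a n w ∧ a n′ w) vs
                   (≤-trans (s≤s (codegree-≤1 un n≢n′)) (two Tn (zero-nbr n∈ mn))) of λ where
              (s , s∈ , h₁ , h₂) → let ns , Ts = ∧-split (a n s) h₁ in
                s , s∈ , ns , Ts , ≡.trans (sym (cong (_∧ a n′ s) ns)) h₂

  -- The star when there is a vertex of degree 3

  module Stars35 (vs : List V) (un : Unique vs) (len : length vs ≡ 25) (e : E vs ≡ 57)
                 {v : V} (v∈ : v ∈ vs) (Dv : degIn v vs ≡ 3) where

    open Order25 vs un len e
    open Degree3 v∈ Dv
    open ≤-Reasoning

    private
      -- The vertices of degree 5 are split by adjacency to `v`: those in `N` have a neighbour of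
      -- degree 3 and cannot be the centre sought.
      h₃ F T′ N P : V → Bool
      h₃ = has 3 vs
      F  = has 4 vs
      T′ = has 5 vs
      N w = T′ w ∧ a v w
      P w = T′ w ∧ not (a v w)
      h f n p : V → ℕ
      h w = ⟦ h₃ w ⟧
      f w = ⟦ F w ⟧
      n w = ⟦ N w ⟧
      p w = ⟦ P w ⟧

      n+p : ∀ w → n w + p w ≡ ⟦ T′ w ⟧
      n+p w with T′ w | a v w
      ... | false | _     = refl
      ... | true  | true  = refl
      ... | true  | false = refl

      D345 : ∀ {w} → w ∈ vs → h w + f w + ⟦ T′ w ⟧ ≡ 1 × D w + (2 * h w + f w) ≡ 5
      D345 {w} w∈ = go (degIn w vs) (3≤D w∈) (D≤5 w∈)
        where
        go : ∀ d → 3 ≤ d → d ≤ 5 → ⟦ d ≡ᵇ 3 ⟧ + ⟦ d ≡ᵇ 4 ⟧ + ⟦ d ≡ᵇ 5 ⟧ ≡ 1 × d + (2 * ⟦ d ≡ᵇ 3 ⟧ + ⟦ d ≡ᵇ 4 ⟧) ≡ 5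
        go 3 _ _ = refl , refl
        go 4 _ _ = refl , refl
        go 5 _ _ = refl , refl
        go 0 () _
        go 1 (s≤s ()) _
        go 2 (s≤s (s≤s ())) _
        go (suc (suc (suc (suc (suc (suc _)))))) _ (s≤s (s≤s (s≤s (s≤s (s≤s ())))))

      v-nbr : ∀ {w} → w ∈ vs → a v w ≡ true → D w ≡ 5
      v-nbr {w} w∈ vw = ≤-antisym (D≤5 w∈)
        (≤-trans (≤-reflexive (cong (λ b → 4 + ⟦ b ⟧) (sym vw))) (others w∈ (adj-≢ vw)))

      hv : h₃ v ≡ true
      hv = ≡ᵇ-true Dv

      parts : ∀ w → nsum h w vs + nsum f w vs + (nsum n w vs + nsum p w vs) ≡ D w
      parts w = begin-equality
        nsum h w vs + nsum f w vs + (nsum n w vs + nsum p w vs)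
          ≡⟨ cong₂ _+_ (nsum-+ h f w vs) (nsum-+ n p w vs) ⟨
        nsum (λ u → h u + f u) w vs + nsum (λ u → n u + p u) w vs
          ≡⟨ nsum-+ (λ u → h u + f u) (λ u → n u + p u) w vs ⟨
        nsum (λ u → h u + f u + (n u + p u)) w vs
          ≡⟨ ∑-cong vs (λ {u} u∈ → ≡.trans (cong (⟦ a w u ⟧ *_)
               (≡.trans (cong (h u + f u +_) (n+p u)) (proj₁ (D345 u∈)))) (*-identityʳ ⟦ a w u ⟧)) ⟩
        D w ∎

      #h : ∑ h vs ≡ 1
      #h = ≤-antisym (count-≤1 h₃ un (λ x∈ y∈ → only x∈ y∈)) (count-∈ h₃ v∈ hv)

      #f : ∑ f vs ≡ 9
      #f = +-cancelˡ-≡ 116 (∑ f vs) 9 (begin-equality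
        114 + (2 * 1 + ∑ f vs)                ≡⟨ cong (_+ (2 * 1 + ∑ f vs)) ∑D ⟨
        ∑ D vs + (2 * 1 + ∑ f vs)             ≡⟨ cong (λ k → ∑ D vs + (2 * k + ∑ f vs)) #h ⟨
        ∑ D vs + (2 * ∑ h vs + ∑ f vs)        ≡⟨ cong (λ x → ∑ D vs + (x + ∑ f vs)) (∑-*ˡ 2 h vs) ⟨
        ∑ D vs + (∑ (λ w → 2 * h w) vs + ∑ f vs) ≡⟨ cong (∑ D vs +_) (∑-+ (λ w → 2 * h w) f vs) ⟨
        ∑ D vs + ∑ (λ w → 2 * h w + f w) vs   ≡⟨ ∑-+ D (λ w → 2 * h w + f w) vs ⟨
        ∑ (λ w → D w + (2 * h w + f w)) vs    ≡⟨ ∑-cong vs (λ w∈ → proj₂ (D345 w∈)) ⟩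
        ∑ (const 5) vs                        ≡⟨ ≡.trans (∑-const 5 vs) (cong (_* 5) len) ⟩
        125                                   ∎)

      #n : ∑ n vs ≡ 3
      #n = ≡.trans (∑-cong vs pt) Dv
        where
        pt : ∀ {w} → w ∈ vs → n w ≡ ⟦ a v w ⟧
        pt {w} w∈ with a v w in vw
        ... | true  = cong (λ b → ⟦ b ∧ true ⟧) (≡ᵇ-true (v-nbr w∈ vw))
        ... | false with T′ w
        ...   | true  = refl
        ...   | false = refl

      #p : ∑ p vs ≡ 12
      #p = +-cancelˡ-≡ 13 (∑ p vs) 12 (begin-equality
        1 + 9 + (3 + ∑ p vs)                               ≡⟨ cong₂ (λ x y → x + (y + ∑ p vs)) (cong₂ _+_ #h #f) #n ⟨
        ∑ h vs + ∑ f vs + (∑ n vs + ∑ p vs)                ≡⟨ cong₂ _+_ (∑-+ h f vs) (∑-+ n p vs) ⟨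
        ∑ (λ w → h w + f w) vs + ∑ (λ w → n w + p w) vs    ≡⟨ ∑-+ (λ w → h w + f w) (λ w → n w + p w) vs ⟨
        ∑ (λ w → h w + f w + (n w + p w)) vs
          ≡⟨ ∑-cong vs (λ {w} w∈ → ≡.trans (cong (h w + f w +_) (n+p w)) (proj₁ (D345 w∈))) ⟩
        ∑ (const 1) vs                                     ≡⟨ ≡.trans (∑-const 1 vs) (cong (_* 1) len) ⟩
        25                                                 ∎)

      far-from-v : ∀ {u w} → w ∈ vs → a v u ≡ false → a u w ≡ true → h₃ w ≡ true → ⊥
      far-from-v {u} {w} w∈ vu uw hw = only w∈ v∈ hw hv λ { refl → true≢false (sym-true uw) vu }

    -- Otherwise each of the 12 vertices of P has at least three neighbours of degree
    -- 4; these account for all neighbours of the nine vertices of degree 4, so that a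
    -- neighbour of v has four neighbours in P, each of which reaches too much of P.
    star35 : ∃[ s ] Star s
    star35 = case search (λ s → P s ∧ (3 ≤ᵇ nbrs T′ s vs)) vs of λ where
        (inj₁ (s , s∈ , hs)) →
          let Ps , h₂ = ∧-split (P s) hs ; Ts , vs′ = ∧-split (T′ s) Ps in
          s , s∈ , D-has Ts , ≤ᵇ-true 3 (nbrs T′ s vs) h₂ , λ {w} w∈ sw → ≤-trans (m≤m+n 4 _)
            (others w∈ λ { refl → true≢false (sym-true sw) (not-true vs′) })
        (inj₂ none) → ⊥-elim (contradiction none)
      where
      contradiction : (∀ {s} → s ∈ vs → P s ∧ (3 ≤ᵇ nbrs T′ s vs) ≡ false) → ⊥
      contradiction none = case pick (a v) vs (subst (1 ≤_) (sym Dv) (1 ≤! 3)) of λ where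
          (x , us , per , vx , _) → from-x (∈-resp-↭ (↭-sym per) (here refl)) vx
        where
        g : V → ℕ
        g w = nsum p w vs
        f≥3 : ∀ {s} → s ∈ vs → P s ≡ true → 3 ≤ nsum f s vs
        f≥3 {s} s∈ Ps with Ts , vs′ ← ∧-split (T′ s) Ps with nn ← none s∈ = +-cancelʳ-≤ 2 3 _ (begin
            5                                                        ≡⟨ D-has Ts ⟨
            D s                                                      ≡⟨ parts s ⟨
            nsum h s vs + nsum f s vs + (nsum n s vs + nsum p s vs)  ≤⟨ +-mono-≤ (≤-reflexive (cong (_+ nsum f s vs) h0)) t≤2 ⟩
            nsum f s vs + 2                                          ∎)
          where
          h0 : nsum h s vs ≡ 0
          h0 = ≡.trans (∑-cong vs pt) (≡.trans (∑-const 0 vs) (*-zeroʳ (length vs)))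
            where
            pt : ∀ {w} → w ∈ vs → ⟦ a s w ⟧ * h w ≡ 0
            pt {w} w∈ with a s w in sw | h₃ w in hw
            ... | false | _     = refl
            ... | true  | false = refl
            ... | true  | true  = ⊥-elim (far-from-v w∈ (not-true vs′) sw hw)
          t≤2 : nsum n s vs + nsum p s vs ≤ 2
          t≤2 = ≤-trans (≤-reflexive (≡.trans (sym (nsum-+ n p s vs)) (≡.trans
              (∑-cong vs λ {w} _ → cong (⟦ a s w ⟧ *_) (n+p w)) (sym (nbrs-nsum T′ s vs)))))
            (s≤s⁻¹ (≤ᵇ-false 3 (nbrs T′ s vs) (≡.trans (cong (_∧ (3 ≤ᵇ nbrs T′ s vs)) (sym Ps)) nn)))
        -- The 12 vertices of `P` send at least 36 edges to the nine vertices of degree 4, whose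
        -- degrees sum to just 36.
        g-F : ∀ {w} → w ∈ vs → F w ≡ true → g w ≡ 4
        g-F {w} w∈ Fw = ≡.trans (sym (+-identityʳ (g w))) (≡.trans (cong (λ b → ⟦ b ⟧ * g w) (sym Fw))
            (≡.trans (∑-tight vs le total w∈) (cong (λ b → ⟦ b ⟧ * 4) Fw)))
          where
          le : ∀ {w} → w ∈ vs → f w * g w ≤ f w * 4
          le {w} _ with F w in Fw
          ... | false = z≤n
          ... | true  = +-monoˡ-≤ 0 (≤-trans (≤-trans (m≤n+m (g w) (nsum n w vs)) (m≤n+m _ (nsum h w vs + nsum f w vs)))
                                             (≤-reflexive (≡.trans (parts w) (D-has Fw))))
          total : ∑ (λ w → f w * 4) vs ≤ ∑ (λ w → f w * g w) vs
          total = begin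
            ∑ (λ w → f w * 4) vs              ≡⟨ ≡.trans (∑-*ʳ 4 f vs) (cong (_* 4) #f) ⟩
            36                                ≡⟨ ≡.trans (∑-*ʳ 3 p vs) (cong (_* 3) #p) ⟨
            ∑ (λ s → p s * 3) vs              ≤⟨ ∑-mono vs pt ⟩
            ∑ (λ s → p s * nsum f s vs) vs    ≡⟨ nsum-adjoint p f vs ⟩
            ∑ (λ w → f w * g w) vs            ∎
            where
            pt : ∀ {s} → s ∈ vs → p s * 3 ≤ p s * nsum f s vs
            pt {s} s∈ = go (P s) (f≥3 s∈)
              where
              go : ∀ b → (b ≡ true → 3 ≤ nsum f s vs) → ⟦ b ⟧ * 3 ≤ ⟦ b ⟧ * nsum f s vs
              go false _  = z≤n
              go true  fs = +-monoˡ-≤ 0 (fs refl)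
        member : ∀ q {u w xs} → w ∈ xs → a u w ≡ true → q w ≡ 1 → 1 ≤ nsum q u xs
        member q {u} {w} (here refl) uw qw rewrite uw | qw = s≤s z≤n
        member q (there w∈) uw qw = ≤-trans (member q w∈ uw qw) (m≤n+m _ _)
        N-true : ∀ {w} → w ∈ vs → a v w ≡ true → n w ≡ 1
        N-true w∈ vw = cong₂ (λ b c → ⟦ b ∧ c ⟧) (≡ᵇ-true (v-nbr w∈ vw)) vw
        -- At most one of the five neighbours has degree 3. None has degree 4, since those vertices
        -- have all their neighbours in `P`, and none lies in `N`, since that would close a triangle
        -- with `v`.
        g-N : ∀ {w} → w ∈ vs → a v w ≡ true → 4 ≤ g w
        g-N {w} w∈ vw = +-cancelˡ-≤ 1 4 _ (begin
            5                                                        ≡⟨ v-nbr w∈ vw ⟨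
            D w                                                      ≡⟨ parts w ⟨
            nsum h w vs + nsum f w vs + (nsum n w vs + nsum p w vs)
              ≤⟨ +-mono-≤ (+-mono-≤ (≤-trans (≤-reflexive (sym (nbrs-nsum h₃ w vs))) (threes w)) (≤-reflexive f0))
                          (+-monoˡ-≤ (g w) (≤-reflexive n0)) ⟩
            1 + g w                                                  ∎)
          where
          f0 : nsum f w vs ≡ 0
          f0 = ≡.trans (∑-cong vs pt) (≡.trans (∑-const 0 vs) (*-zeroʳ (length vs)))
            where
            pt : ∀ {u} → u ∈ vs → ⟦ a w u ⟧ * f u ≡ 0
            pt {u} u∈ with a w u in wu | F u in Fu
            ... | false | _     = refl
            ... | true  | false = refl
            ... | true  | true  = ⊥-elim (<⇒≱ (5 ≤! 5) (begin
                  1 + 4                                                   ≤⟨ +-mono-≤ (member n w∈ (sym-true wu) (N-true w∈ vw)) (≤-reflexive (sym (g-F u∈ Fu))) ⟩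
                  nsum n u vs + g u                                       ≤⟨ m≤n+m _ (nsum h u vs + nsum f u vs) ⟩
                  nsum h u vs + nsum f u vs + (nsum n u vs + nsum p u vs) ≡⟨ parts u ⟩
                  D u                                                     ≡⟨ D-has Fu ⟩
                  4                                                       ∎))
          n0 : nsum n w vs ≡ 0
          n0 = ≡.trans (∑-cong vs pt) (≡.trans (∑-const 0 vs) (*-zeroʳ (length vs)))
            where
            pt : ∀ {u} → u ∈ vs → ⟦ a w u ⟧ * n u ≡ 0
            pt {u} u∈ with a w u in wu | T′ u | a v u in vu
            ... | false | _     | _     = refl
            ... | true  | false | _     = refl
            ... | true  | true  | false = refl
            ... | true  | true  | true  = ⊥-elim (no3 vw wu (sym-true vu))
        from-x : ∀ {x} → x ∈ vs → a v x ≡ true → ⊥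
        from-x {x} x∈ vx = case nbr-pick P x∈ (≤-trans (≤-trans (1 ≤! 4) (g-N x∈ vx)) (≤-reflexive (sym (nbrs-nsum P x vs)))) of λ where
            (s , us , per , xs , Ps) → from-s (∈-resp-↭ (↭-sym per) (here refl)) xs Ps
          where
          from-s : ∀ {s} → s ∈ vs → a x s ≡ true → P s ≡ true → ⊥
          from-s {s} s∈ xs Ps with Ts , vs′ ← ∧-split (T′ s) Ps = <⇒≱ (18 ≤! 18) (begin
              18                                       ≤⟨ +-monoˡ-≤ 1 lower ⟩
              nsum g s vs + 1                          ≤⟨ +-mono-≤ (m≤m+n (nsum g s vs) (g s)) (≤-reflexive (cong ⟦_⟧ (sym Ps))) ⟩
              nsum g s vs + g s + p s                  ≤⟨ reach p un s∈ ⟩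
              ∑ p vs + D s * p s                       ≡⟨ cong₂ _+_ #p (cong₂ _*_ (D-has Ts) (cong ⟦_⟧ Ps)) ⟩
              17                                       ∎)
            where
            -- Every neighbour `w` of `s` has `s` itself as a neighbour in `P`, which gives 1. It
            -- gives 3 more if `w` has degree 4 or lies in `N`, where `g w` is at least 4; at least
            -- three neighbours are of the former kind and at least one is of the latter.
            lower : 17 ≤ nsum g s vs
            lower = begin
              17
                ≤⟨ +-mono-≤ (≤-reflexive (sym (D-has Ts))) (*-monoʳ-≤ 3 (+-mono-≤ (f≥3 s∈ Ps) (member n x∈ (sym-true xs) (N-true x∈ vx)))) ⟩
              D s + 3 * (nsum f s vs + nsum n s vs)
                ≡⟨ cong₂ _+_ (≡.trans (nsum-const 1 s vs) (*-identityʳ (D s)))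
                     (≡.trans (∑-*ˡ 3 (λ w → ⟦ a s w ⟧ * (f w + n w)) vs) (cong (3 *_) (nsum-+ f n s vs))) ⟨
              nsum (const 1) s vs + ∑ (λ w → 3 * (⟦ a s w ⟧ * (f w + n w))) vs
                ≡⟨ ∑-+ _ _ vs ⟨
              ∑ (λ w → ⟦ a s w ⟧ * 1 + 3 * (⟦ a s w ⟧ * (f w + n w))) vs
                ≤⟨ ∑-mono vs pt ⟩
              nsum g s vs ∎
              where
              pt : ∀ {w} → w ∈ vs → ⟦ a s w ⟧ * 1 + 3 * (⟦ a s w ⟧ * (f w + n w)) ≤ ⟦ a s w ⟧ * g w
              pt {w} w∈ with a s w in sw
              ... | false = z≤n
              ... | true  = ≤-trans go (≤-reflexive (sym (+-identityʳ (g w))))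
                where
                go : 1 + 3 * (f w + n w + 0) ≤ g w
                go with F w in Fw | T′ w in Tw | a v w in vw
                ... | true  | true  | _     = ⊥-elim (case ≡.trans (sym (D-has {u = w} Fw)) (D-has {u = w} Tw) of λ ())
                ... | true  | false | _     = ≤-reflexive (sym (g-F w∈ Fw))
                ... | false | true  | true  = g-N w∈ vw
                ... | false | true  | false = member p s∈ (sym-true sw) (cong ⟦_⟧ Ps)
                ... | false | false | _     = member p s∈ (sym-true sw) (cong ⟦_⟧ Ps)

-- From Boolean adjacency to the graph of the theorem

does-sound : ∀ {P : Set} (P? : Dec P) → does P? ≡ true → P
does-sound (yes p) _ = p

length-filter : ∀ {P : A → Set} (P? : ∀ x → Dec (P x)) xs → length (filter P? xs) ≡ ∑ (λ x → ⟦ does (P? x) ⟧) xs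
length-filter P? []       = refl
length-filter P? (x ∷ xs) with does (P? x)
... | true  = cong suc (length-filter P? xs)
... | false = length-filter P? xs

count-filter : ∀ {P : A → Set} (P? : ∀ x → Dec (P x)) q xs →
               count q (filter P? xs) ≡ count (λ x → does (P? x) ∧ q x) xs
count-filter P? q []       = refl
count-filter P? q (x ∷ xs) with does (P? x)
... | true  = cong (⟦ q x ⟧ +_) (count-filter P? q xs)
... | false = count-filter P? q xs

∑-++ : ∀ (f : A → ℕ) xs ys → ∑ f (xs ++ ys) ≡ ∑ f xs + ∑ f ys
∑-++ f []       ys = refl
∑-++ f (x ∷ xs) ys = ≡.trans (cong (f x +_) (∑-++ f xs ys)) (sym (+-assoc (f x) (∑ f xs) (∑ f ys)))

∑-map : ∀ (f : B → ℕ) (g : A → B) xs → ∑ f (map g xs) ≡ ∑ (f ∘ g) xs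
∑-map f g []       = refl
∑-map f g (x ∷ xs) = cong (f (g x) +_) (∑-map f g xs)

∑-product : ∀ (f : A × B → ℕ) xs ys → ∑ f (cartesianProduct xs ys) ≡ ∑ (λ x → ∑ (λ y → f (x , y)) ys) xs
∑-product f []       ys = refl
∑-product f (x ∷ xs) ys = ≡.trans (∑-++ f (map (x ,_) ys) (cartesianProduct xs ys))
  (cong₂ _+_ (∑-map f (x ,_) ys) (∑-product f xs ys))

-- Greedy: `k` entries of large degree are moved to the front, after which any order will do.
arrange : ∀ (d : A → ℕ) k j L → length L ≡ k + j → (∀ {w} → w ∈ L → 4 ≤ d w) → k ≤ count (λ w → 5 ≤ᵇ d w) L →
  Σ[ ws ∈ Vec A (k + j) ] toList ws ↭ L × Pointwise (λ e w → suc e ≤ d w) (Vec.replicate k 4 Vec.++ Vec.replicate j 3) ws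
arrange d zero zero    []      len δ le = [] , ↭-refl , []
arrange d zero (suc j) (w ∷ L) len δ le with ws , p , pw ← arrange d zero j L (suc-injective len) (λ w∈ → δ (there w∈)) z≤n =
  w ∷ ws , prep w p , δ (here refl) ∷ pw
arrange d (suc k) j L len δ le with w , L′ , p , h , le′ ← pick (λ w → 5 ≤ᵇ d w) L le
  with ws , q , pw ← arrange d k j L′ (suc-injective (≡.trans (sym (↭-length p)) len))
                       (λ w∈ → δ (∈-resp-↭ (↭-sym p) (there w∈))) le′ =
  w ∷ ws , ↭-trans (prep w q) (↭-sym p) , ≤ᵇ-true 5 (d w) h ∷ pw

-- The order is a variable with a proof that it equals 25, so that `allFin n` and the sums over it
-- do not unfold.
module Bridge {n} (Γ : Graph n) (girth : GirthAtLeast5 Γ) (n≡25 : n ≡ 25) (57-edges : edgeCount Γ ≡ 57) where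

  open Graph Γ

  a : Fin n → Fin n → Bool
  a u v = does (u ~? v)

  a-true : ∀ {u v} → a u v ≡ true → u ~ v
  a-true {u} {v} = does-sound (u ~? v)

  a-sym : ∀ u v → a u v ≡ a v u
  a-sym u v with u ~? v
  ... | yes u~v = sym (dec-true (v ~? u) (~-sym u~v))
  ... | no  u≁v = sym (dec-false (v ~? u) (u≁v ∘ ~-sym))

  a-irrefl : ∀ v → a v v ≡ false
  a-irrefl v = dec-false (v ~? v) (~-irrefl refl)

  no3 : ∀ {u v w} → a u v ≡ true → a v w ≡ true → a w u ≡ true → ⊥
  no3 uv vw wu = proj₁ girth _ _ _ (a-true uv , a-true vw , a-true wu)

  no4 : ∀ {u v w x} → a u v ≡ true → a v w ≡ true → a w x ≡ true → a x u ≡ true → u ≢ w → v ≢ x → ⊥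
  no4 uv vw wx xu u≢w v≢x = proj₂ girth _ _ _ _ (a-true uv , a-true vw , a-true wx , a-true xu , u≢w , v≢x)

  v₀ : Fin n
  v₀ = subst Fin (sym n≡25) Fin.zero

  open Girth5 a v₀ a-sym a-irrefl no3 no4

  vs : List (Fin n)
  vs = allFin n

  un : Unique vs
  un = allFin⁺ n

  len : length vs ≡ 25
  len = ≡.trans (length-tabulate id) n≡25

  -- `edges` has every edge at its smaller end only, so the degree sum counts that list twice, once
  -- from each end.
  e : E vs ≡ 57
  e = *-cancelˡ-≡ (E vs) 57 2 (begin-equality
    2 * E vs                                            ≡⟨ degree-sum vs ⟨
    ∑ (λ u → ∑ (λ v → ⟦ a u v ⟧) vs) vs                 ≡⟨ ∑-cong vs (λ {u} _ → ≡.trans (∑-cong vs (λ {v} _ → ordered u v)) (∑-+ (below u) (λ v → below v u) vs)) ⟩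
    ∑ (λ u → ∑ (λ v → below u v) vs + ∑ (λ v → below v u) vs) vs ≡⟨ ∑-+ _ _ vs ⟩
    edgeSum + ∑ (λ u → ∑ (λ v → below v u) vs) vs       ≡⟨ cong (edgeSum +_) (∑-swap (λ u v → below v u) vs vs) ⟩
    edgeSum + edgeSum                                   ≡⟨ cong₂ _+_ 57≡ 57≡ ⟨
    114                                                 ∎)
    where
    open ≤-Reasoning
    below : Fin n → Fin n → ℕ
    below u v = ⟦ does (u <F? v) ∧ a u v ⟧
    edgeSum = ∑ (λ u → ∑ (below u) vs) vs
    57≡ : 57 ≡ edgeSum
    57≡ = ≡.trans (sym 57-edges) (≡.trans (length-filter (λ (u , v) → (u <F? v) ×-dec (u ~? v)) (cartesianProduct vs vs))
                                          (∑-product _ vs vs))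
    ordered : ∀ u v → ⟦ a u v ⟧ ≡ below u v + below v u
    ordered u v with <F-cmp u v
    ... | tri< u<v _ v≮u rewrite dec-true (u <F? v) u<v | dec-false (v <F? u) v≮u = sym (+-identityʳ _)
    ... | tri> u≮v _ v<u rewrite dec-false (u <F? v) u≮v | dec-true (v <F? u) v<u = cong ⟦_⟧ (a-sym u v)
    ... | tri≈ u≮u refl _ rewrite dec-false (u <F? u) u≮u = cong ⟦_⟧ (a-irrefl u)

  open Order25 vs un len e
  open Stars25 vs un len e

  degree≡ : ∀ u → degree Γ u ≡ D u
  degree≡ u = length-filter (u ~?_) vs

  member : ∀ u → u ∈ vs
  member = ∈-allFin

  degrees : List ℕ
  degrees = map (degree Γ) vs

  all-degrees : ∀ {P : ℕ → Set} → (∀ u → P (D u)) → All P degrees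
  all-degrees {P} h = All.tabulate λ d∈ → case ∈-map⁻ (degree Γ) d∈ of λ where
    (u , _ , refl) → subst P (sym (degree≡ u)) (h u)

  δ≡ : ∀ {d} → (∀ u → d ≤ D u) → ∃[ u ] D u ≡ d → δ Γ ≡ d
  δ≡ {d} h (u , Du) = ≤-antisym
    (min≤v⁺ n degrees (inj₂ (lose (∈-map⁺ (degree Γ) (member u)) (≤-reflexive (≡.trans (degree≡ u) Du)))))
    -- The default value `n` of the minimum has to be at least `d` as well; it is, because it bounds
    -- every degree.
    (v≤min⁺ (≤-trans (h u) (≤-trans (deg-≤ u vs) (≤-reflexive (length-tabulate id)))) (all-degrees h))

  Δ≡ : ∀ {d} → (∀ u → D u ≤ d) → ∃[ u ] D u ≡ d → Δ Γ ≡ d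
  Δ≡ {d} h (u , Du) = ≤-antisym (max≤v⁺ z≤n (all-degrees h))
    (v≤max⁺ 0 degrees (inj₂ (lose (∈-map⁺ (degree Γ) (member u)) (≤-reflexive (sym (≡.trans (degree≡ u) Du))))))

  δ≤D : ∀ u → δ Γ ≤ D u
  δ≤D u = subst (δ Γ ≤_) (degree≡ u) (All.lookup (min≤xs n degrees) (∈-map⁺ (degree Γ) (member u)))

  D≤Δ : ∀ u → D u ≤ Δ Γ
  D≤Δ u = subst (_≤ Δ Γ) (degree≡ u) (All.lookup (xs≤max 0 degrees) (∈-map⁺ (degree Γ) (member u)))

  4≤D : (∀ {v} → v ∈ vs → has 3 vs v ≡ false) → ∀ {u} → u ∈ vs → 4 ≤ D u
  4≤D none u∈ = ≤∧≢⇒< (3≤D u∈) (≡ᵇ-false (none u∈) ∘ sym)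

  δΔ-three : ∀ {v} → v ∈ vs → D v ≡ 3 → δ Γ ≡ 3 × Δ Γ ≡ 5
  δΔ-three {v} v∈ Dv = δ≡ (λ u → 3≤D (member u)) (v , Dv) , (case high of λ where
    (u , u∈ , 5≤) → Δ≡ (λ u → Degree3.D≤5 v∈ Dv (member u)) (u , ≤-antisym (Degree3.D≤5 v∈ Dv u∈) 5≤))

  δ-four : (∀ {u} → u ∈ vs → 4 ≤ D u) → δ Γ ≡ 4
  δ-four ≥4 = case low of λ where
    (v , v∈ , ≤4) → δ≡ (λ u → ≥4 (member u)) (v , ≤-antisym ≤4 (≥4 v∈))

  Δ-five : (∀ {u} → u ∈ vs → D u ≤ 5) → Δ Γ ≡ 5
  Δ-five ≤5 = case high of λ where
    (w , w∈ , 5≤) → Δ≡ (λ u → ≤5 (member u)) (w , ≤-antisym (≤5 w∈) 5≤)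

  six-or-five : (∀ {u} → u ∈ vs → 4 ≤ D u) →
                (∃[ w ] w ∈ vs × has 6 vs w ≡ true) ⊎ (∀ {w} → w ∈ vs → has 6 vs w ≡ false) → Δ Γ ≡ 5 ⊎ Δ Γ ≡ 6
  six-or-five ≥4 (inj₁ (w , w∈ , h)) = inj₂ (Δ≡ (λ u → D≤6 ≥4 (member u)) (w , D-has h))
  six-or-five ≥4 (inj₂ none) = inj₁ (Δ-five (λ {u} u∈ → s≤s⁻¹ (≤∧≢⇒< (D≤6 ≥4 u∈) (≡ᵇ-false (none u∈)))))

  three-or-four : (∃[ v ] v ∈ vs × has 3 vs v ≡ true) ⊎ (∀ {v} → v ∈ vs → has 3 vs v ≡ false) →
                  (δ Γ ≡ 3 × Δ Γ ≡ 5) ⊎ (∀ {u} → u ∈ vs → 4 ≤ D u)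
  three-or-four (inj₁ (v , v∈ , h)) = inj₁ (δΔ-three v∈ (D-has h))
  three-or-four (inj₂ none) = inj₂ (4≤D none)

  δΔ : (δ Γ ≡ 3 × Δ Γ ≡ 5) ⊎ (δ Γ ≡ 4 × Δ Γ ≡ 5) ⊎ (δ Γ ≡ 4 × Δ Γ ≡ 6)
  δΔ = case three-or-four (search (has 3 vs) vs) of λ where
    (inj₁ h)  → inj₁ h
    (inj₂ ≥4) → case six-or-five ≥4 (search (has 6 vs) vs) of λ where
      (inj₁ Δ5) → inj₂ (inj₁ (δ-four ≥4 , Δ5))
      (inj₂ Δ6) → inj₂ (inj₂ (δ-four ≥4 , Δ6))

  star-three : δ Γ ≡ 3 →
    (∃[ v ] v ∈ vs × has 3 vs v ≡ true) ⊎ (∀ {v} → v ∈ vs → has 3 vs v ≡ false) → ∃[ s ] Star s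
  star-three δ3 (inj₁ (v , v∈ , h)) = Stars35.star35 vs un len e v∈ (D-has h)
  star-three δ3 (inj₂ none) = ⊥-elim (<⇒≱ (4 ≤! 4) (subst (4 ≤_) δ3
    (v≤min⁺ (≤-trans (4 ≤! 25) (≤-reflexive (sym n≡25))) (all-degrees λ u → 4≤D none (member u)))))

  star : δ Γ ≡ 3 × Δ Γ ≡ 5 ⊎ δ Γ ≡ 4 × Δ Γ ≡ 5 → ∃[ s ] Star s
  star (inj₁ (δ3 , _))  = star-three δ3 (search (has 3 vs) vs)
  star (inj₂ (δ4 , Δ5)) = star45 (λ {u} _ → subst (_≤ D u) δ4 (δ≤D u)) (λ {u} _ → subst (D u ≤_) Δ5 (D≤Δ u))

  -- A decidable criterion for the centre of a star with `k` entries 4 and the others 3. The second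
  -- alternative of the theorem contains a negation, so the existence of the first star has to be
  -- decided.
  centre : ℕ → Fin n → Bool
  centre k p = has 5 vs p ∧ ((k ≤ᵇ nbrs (λ w → 5 ≤ᵇ degree Γ w) p vs) ∧ (nbrs (λ w → degree Γ w ≤ᵇ 3) p vs ≡ᵇ 0))

  nbrs≡ : ∀ q p → count q (neighbours Γ p) ≡ nbrs q p vs
  nbrs≡ q p = count-filter (p ~?_) q vs

  has-star : ∀ k j p → D p ≡ k + j → k ≤ nbrs (λ w → 5 ≤ᵇ degree Γ w) p vs →
             (∀ {w} → a p w ≡ true → 4 ≤ D w) → HasStar Γ (k + j) (Vec.replicate k 4 Vec.++ Vec.replicate j 3)
  has-star k j p Dp le δ = p , ≡.trans (degree≡ p) Dp ,
    arrange (degree Γ) k j (neighbours Γ p) (≡.trans (degree≡ p) Dp)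
      (λ {w} w∈ → subst (4 ≤_) (sym (degree≡ w)) (δ (dec-true (p ~? w) (proj₂ (∈-filter⁻ (p ~?_) {xs = vs} w∈)))))
      (subst (k ≤_) (sym (nbrs≡ _ p)) le)

  centre-star : ∀ k j p → k + j ≡ 5 → centre k p ≡ true → HasStar Γ (k + j) (Vec.replicate k 4 Vec.++ Vec.replicate j 3)
  centre-star k j p k+j h = let h₁ , h₂ = ∧-split (has 5 vs p) h ; h₃ , h₄ = ∧-split (k ≤ᵇ _) h₂ in
    has-star k j p (≡.trans (D-has h₁) (sym k+j)) (≤ᵇ-true k _ h₃) λ {w} pw →
      ≰⇒> λ ≤3 → true≢false (cong₂ _∧_ pw (Equivalence.to T-≡ (≤⇒≤ᵇ (≤-trans (≤-reflexive (degree≡ w)) ≤3))))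
        (count-zero (λ w → a p w ∧ (degree Γ w ≤ᵇ 3)) vs (≡ᵇ-sound _ 0 h₄) (member w))

  -- The converse of `centre-star` for `k` equal to 4; it turns a failed search for a centre into
  -- the absence of the star.
  star-centre : HasStar Γ 5 (4 ∷ 4 ∷ 4 ∷ 4 ∷ 3 ∷ []) → ∃[ p ] centre 4 p ≡ true
  star-centre (p , dp , w₁ ∷ w₂ ∷ w₃ ∷ w₄ ∷ w₅ ∷ [] , per , h₁ ∷ h₂ ∷ h₃ ∷ h₄ ∷ h₅ ∷ []) =
    p , cong₂ _∧_ (≡ᵇ-true (≡.trans (sym (degree≡ p)) dp)) (cong₂ _∧_
      (Equivalence.to T-≡ (≤⇒≤ᵇ (≤-trans four (≤-reflexive (≡.trans (∑-↭ _ per) (nbrs≡ _ p))))))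
      (≡ᵇ-true (≡.trans (sym (≡.trans (∑-↭ _ per) (nbrs≡ _ p))) none)))
    where
    five : ∀ {w} → 5 ≤ degree Γ w → (5 ≤ᵇ degree Γ w) ≡ true
    five h = Equivalence.to T-≡ (≤⇒≤ᵇ h)
    four : 4 ≤ count (λ w → 5 ≤ᵇ degree Γ w) (w₁ ∷ w₂ ∷ w₃ ∷ w₄ ∷ w₅ ∷ [])
    four rewrite five h₁ | five h₂ | five h₃ | five h₄ = s≤s (s≤s (s≤s (s≤s z≤n)))
    big : ∀ {w} → 4 ≤ degree Γ w → (degree Γ w ≤ᵇ 3) ≡ false
    big {w} h with degree Γ w ≤ᵇ 3 in eq
    ... | false = refl
    ... | true  = ⊥-elim (<⇒≱ h (≤ᵇ-true _ 3 eq))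
    none : count (λ w → degree Γ w ≤ᵇ 3) (w₁ ∷ w₂ ∷ w₃ ∷ w₄ ∷ w₅ ∷ []) ≡ 0
    none rewrite big {w₁} (≤-trans (n≤1+n 4) h₁) | big {w₂} (≤-trans (n≤1+n 4) h₂) | big {w₃} (≤-trans (n≤1+n 4) h₃)
               | big {w₄} (≤-trans (n≤1+n 4) h₄) | big {w₅} h₅ = refl

  stars5 : δ Γ ≡ 3 × Δ Γ ≡ 5 ⊎ δ Γ ≡ 4 × Δ Γ ≡ 5 →
    HasStar Γ 5 (4 ∷ 4 ∷ 4 ∷ 4 ∷ 3 ∷ [])
    ⊎ (¬ HasStar Γ 5 (4 ∷ 4 ∷ 4 ∷ 4 ∷ 3 ∷ []) × HasStar Γ 5 (4 ∷ 4 ∷ 4 ∷ 3 ∷ 3 ∷ []))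
  stars5 cases = case search (centre 4) vs of λ where
      (inj₁ (p , _ , h)) → inj₁ (centre-star 4 1 p refl h)
      (inj₂ none) → inj₂ ((λ hs → let p , h = star-centre hs in true≢false h (none (member p))) ,
        (case star cases of λ where
          (s , s∈ , Ds , three , 4≤) → has-star 3 2 s Ds (≤-trans three (∑-mono vs λ {w} _ → weaken s w)) (λ {w} → 4≤ (member w))))
    where
    -- `Star` counts neighbours of degree exactly 5, whereas `has-star` asks for at least 5.
    weaken : ∀ s w → ⟦ a s w ∧ has 5 vs w ⟧ ≤ ⟦ a s w ∧ (5 ≤ᵇ degree Γ w) ⟧
    weaken s w with a s w | degIn w vs ≡ᵇ 5 in h
    ... | false | _     = z≤n
    ... | true  | false = z≤n
    ... | true  | true  = ≤-reflexive (cong ⟦_⟧ (sym (Equivalence.to T-≡ (≤⇒≤ᵇ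
                            (≤-reflexive (sym (≡.trans (degree≡ w) (≡ᵇ-sound _ 5 h))))))))

  deg-count : deg Γ 6 ≡ count (has 6 vs) vs
  deg-count = ≡.trans (length-filter (λ v → degree Γ v ≟ 6) vs)
    (∑-cong vs λ {v} _ → cong (λ d → ⟦ d ≡ᵇ 6 ⟧) (degree≡ v))

  -- With least degree 4, any vertex of degree 6 is already the centre of the star.
  stars6 : δ Γ ≡ 4 × Δ Γ ≡ 6 → (1 ≤ deg Γ 6 × deg Γ 6 ≤ 2) × HasStar Γ 6 (3 ∷ 3 ∷ 3 ∷ 3 ∷ 3 ∷ 3 ∷ [])
  stars6 (δ4 , Δ6) = case search (has 6 vs) vs of λ where
      (inj₁ (u , u∈ , h)) →
        (subst (1 ≤_) (sym deg-count) (count-∈ (has 6 vs) u∈ h) , subst (_≤ 2) (sym deg-count) (few-six ≥4)) ,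
        has-star 0 6 u (D-has h) z≤n (λ {w} _ → ≥4 (member w))
      (inj₂ none) → ⊥-elim (<⇒≱ (6 ≤! 6) (subst (_≤ 5) Δ6 (max≤v⁺ z≤n
        (all-degrees λ u → s≤s⁻¹ (≤∧≢⇒< (D≤6 ≥4 (member u)) (≡ᵇ-false (none (member u))))))))
    where
    ≥4 : ∀ {u} → u ∈ vs → 4 ≤ D u
    ≥4 {u} _ = subst (_≤ D u) δ4 (δ≤D u)

theorem7 : (Γ : Graph 25) → GirthAtLeast5 Γ → edgeCount Γ ≡ 57 →
    ((δ Γ ≡ 3 × Δ Γ ≡ 5) ⊎ (δ Γ ≡ 4 × Δ Γ ≡ 5) ⊎ (δ Γ ≡ 4 × Δ Γ ≡ 6))
    ×
    ((δ Γ ≡ 3 × Δ Γ ≡ 5) ⊎ (δ Γ ≡ 4 × Δ Γ ≡ 5) →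
    HasStar Γ 5 (4 ∷ 4 ∷ 4 ∷ 4 ∷ 3 ∷ [])
    ⊎ (¬ HasStar Γ 5 (4 ∷ 4 ∷ 4 ∷ 4 ∷ 3 ∷ []) × HasStar Γ 5 (4 ∷ 4 ∷ 4 ∷ 3 ∷ 3 ∷ [])))
    ×
    ((δ Γ ≡ 4 × Δ Γ ≡ 6) →
    (1 ≤ deg Γ 6 × deg Γ 6 ≤ 2) × HasStar Γ 6 (3 ∷ 3 ∷ 3 ∷ 3 ∷ 3 ∷ 3 ∷ []))
theorem7 Γ girth edges = δΔ , stars5 , stars6
  where open Bridge Γ girth refl edges
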